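{- For an integer $T\ge 1$ let $$\mathcal F(T)=\{a/b:\ (a,b)\in\mathbb Z^2,\ 0\le a<b\le T,\ \gcd(a,b)=1\}$$ be the set of Farey fractions of order $T$, let $F(T)=\#\mathcal F(T)$, let $$G(T)=\sum_{\substack{\xi\in\mathcal F(T)\\ \xi\le 1/2}}\xi^2,$$ and let $$C(T)=\sum_{a/b\in\mathcal F(T)\cap[0,1/2]}\#\bigl(\mathcal F(T)\cap[1-a^2/b^2,\,1]\bigr),$$ where each $a/b$ is written in lowest terms. Let $M(t)=\sum_{1\le k\le t}\mu(k)$, where $\mu$ is the M\"obius function, and let $\delta(t)$ be any decreasing function such that $|M(t)|\le t\,\delta(t)$ holds for all $t\ge 1$. Then, as $T\to\infty$, $$C(T)=F(T)G(T)+O\bigl(T^{11/4+o(1)}+T^3\,\delta(T^{1/2})\log T\bigr),$$ where the implied constant is absolute.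
   Context: $\mu$ denotes the M\"obius function. The notation $A=O(B)$ means $|A|\le c|B|$ for an absolute constant $c>0$, and $o(1)$ denotes a quantity tending to $0$ as $T\to\infty$. -}

module Defs where

open import Data.Nat.Base as ℕ using (ℕ; zero; suc)
import Data.Nat.Properties as ℕ
import Data.Nat.Coprimality as Coprime
open import Data.Nat.ListAction using () renaming (sum to sumℕ)
open import Data.Nat.Primality.Factorisation using (factorise; factors)
open import Data.Integer.Base as ℤ using (ℤ; +_; -[1+_]; 0ℤ; -1ℤ)
import Data.Integer.Properties as ℤ
open import Data.Rational.Base as ℚ using (ℚ; mkℚ; 0ℚ; 1ℚ; ½; _/_; _+_; _*_; _-_; -_; ∣_∣; _≤_; _<_; ↥_; ↧ₙ_; *<*)
open import Data.Rational.Properties as ℚ using (_≤?_; toℚᵘ-injective; toℚᵘ-fromℚᵘ; toℚᵘ-homo-+; toℚᵘ-homo-*)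
open import Data.Rational.Solver using (module +-*-Solver)
import Data.Rational.Unnormalised.Base as ℚᵘ
import Data.Rational.Unnormalised.Properties as ℚᵘ
open import Data.List.Base using (List; map; filter; concatMap; upTo; length; foldr)
open import Data.List.Relation.Unary.Unique.DecPropositional ℕ._≟_ using (unique?)
open import Data.Product.Base using (∃-syntax; _×_; _,_; proj₁; proj₂)
open import Data.Sum.Base using (inj₁; inj₂)
open import Relation.Nullary.Decidable using (yes; no; _×-dec_)
open import Relation.Binary.PropositionalEquality using (_≡_; refl; sym; trans; cong; cong₂; subst)

-- The sublist for denominator suc d is { a/(suc d) : a < suc d, gcd = 1 };
-- distinct pairs in lowest terms are distinct rationals, so the list has no
-- repetitions and its length is the cardinality of the set.
farey : ℕ → List ℚ
farey T = concatMap withDenominator (upTo T)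
  where
  withDenominator : ℕ → List ℚ
  withDenominator d =
    map (λ a → + a / suc d) (filter (λ a → Coprime.coprime? a (suc d)) (upTo (suc d)))

sumℚ : List ℚ → ℚ
sumℚ = foldr _+_ 0ℚ

fareyUpToHalf : ℕ → List ℚ
fareyUpToHalf T = filter (_≤? ½) (farey T)

F : ℕ → ℕ
F T = length (farey T)

G : ℕ → ℚ
G T = sumℚ (map (λ ξ → ξ * ξ) (fareyUpToHalf T))

C : ℕ → ℕ
C T = sumℕ (map (λ ξ → length (filter (λ ζ → (1ℚ - ξ * ξ ≤? ζ) ×-dec (ζ ≤? 1ℚ)) (farey T)))
                (fareyUpToHalf T))

μ : (n : ℕ) → .{{ℕ.NonZero n}} → ℤ
μ n with unique? (factors (factorise n))
... | yes _ = -1ℤ ℤ.^ length (factors (factorise n))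
... | no  _ = 0ℤ

M : ℕ → ℤ
M zero    = 0ℤ
M (suc n) = M n ℤ.+ μ (suc n)

infix 4 _≃_ _≤ʳ_ _<ʳ_

-- Cauchy sequences of rationals; equality of reals is _≃_, not _≡_.
record ℝ : Set where
  constructor mkℝ
  field
    seq    : ℕ → ℚ
    cauchy : ∀ ε → 0ℚ < ε → ∃[ N ] ∀ m n → N ℕ.≤ m → N ℕ.≤ n → ∣ seq m - seq n ∣ ≤ ε

open ℝ public

_≤ʳ_ : ℝ → ℝ → Set
x ≤ʳ y = ∀ ε → 0ℚ < ε → ∃[ N ] ∀ n → N ℕ.≤ n → seq x n ≤ seq y n + ε

_<ʳ_ : ℝ → ℝ → Set
x <ʳ y = ∃[ ε ] 0ℚ < ε × ∃[ N ] ∀ n → N ℕ.≤ n → seq x n + ε ≤ seq y n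

_≃_ : ℝ → ℝ → Set
x ≃ y = x ≤ʳ y × y ≤ʳ x

open +-*-Solver using (solve; _:=_; _:+_; _:*_; _:-_; :-_; con)

ring1 : ∀ p q → q + p * q ≡ (1ℚ + p) * q
ring1 = solve 2 (λ p q → q :+ p :* q := (con 1ℚ :+ p) :* q) refl

ring2 : ∀ p → p * ½ + p * ½ ≡ p
ring2 = solve 1 (λ p → p :* con ½ :+ p :* con ½ := p) refl

ring3 : ∀ p q → p - q ≡ - (q - p)
ring3 = solve 2 (λ p q → p :- q := :- (q :- p)) refl

ring4 : ∀ p q r → (p - q) + (q - r) ≡ p - r
ring4 = solve 3 (λ p q r → (p :- q) :+ (q :- r) := p :- r) refl

ring5 : ∀ p q → q - p ≡ - (p - q)
ring5 = solve 2 (λ p q → q :- p := :- (p :- q)) refl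

ring6 : ∀ p q → p ≡ (p - q) + q
ring6 = solve 2 (λ p q → p := (p :- q) :+ q) refl

ring7 : ∀ p q → (p + q) - q ≡ p
ring7 = solve 2 (λ p q → (p :+ q) :- q := p) refl

ring8 : ∀ p q r → p * (q * r) ≡ q * (p * r)
ring8 = solve 3 (λ p q r → p :* (q :* r) := q :* (p :* r)) refl

ring9 : ∀ p q r → p * q * r ≡ p * (r * q)
ring9 = solve 3 (λ p q r → p :* q :* r := p :* (r :* q)) refl

ring10 : ∀ p q r s → (p + q) - (r + s) ≡ (p - r) + (q - s)
ring10 = solve 4 (λ p q r s → (p :+ q) :- (r :+ s) := (p :- r) :+ (q :- s)) refl

ring11 : ∀ p q r s → p * q - r * s ≡ p * (q - s) + s * (p - r)
ring11 = solve 4 (λ p q r s → p :* q :- r :* s := p :* (q :- s) :+ s :* (p :- r)) refl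

ring12 : ∀ p q r → (p + q) - r ≡ (p - r) + q
ring12 = solve 3 (λ p q r → (p :+ q) :- r := (p :- r) :+ q) refl

ring13 : ∀ p q r → (p - r) + q ≡ (p + q) - r
ring13 = solve 3 (λ p q r → (p :- r) :+ q := (p :+ q) :- r) refl

ring14 : ∀ p q → 1ℚ * (p * 1ℚ) - 1ℚ * (q * 1ℚ) ≡ p - q
ring14 = solve 2 (λ p q → con 1ℚ :* (p :* con 1ℚ) :- con 1ℚ :* (q :* con 1ℚ) := p :- q) refl

ring15 : ∀ p q r s u → p * (r * u) - q * (s * u) ≡ u * (p * (r - s) + s * (p - q))
ring15 = solve 5 (λ p q r s u → p :* (r :* u) :- q :* (s :* u) := u :* (p :* (r :- s) :+ s :* (p :- q))) refl

ring16 : ∀ p q r → p * (r + q * r) ≡ p * (1ℚ + q) * r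
ring16 = solve 3 (λ p q r → p :* (r :+ q :* r) := p :* (con 1ℚ :+ q) :* r) refl

ring17 : ∀ p q r s u → p * (q * (r * s) * u) ≡ s * p * (r * (q * u))
ring17 = solve 5 (λ p q r s u → p :* (q :* (r :* s) :* u) := s :* p :* (r :* (q :* u))) refl

ring18 : ∀ p q r → p * (q * r) + p * (q * r) ≡ p * ((q + q) * r)
ring18 = solve 3 (λ p q r → p :* (q :* r) :+ p :* (q :* r) := p :* ((q :+ q) :* r)) refl

ring19 : ∀ p q → (p + q) - p ≡ q
ring19 = solve 2 (λ p q → (p :+ q) :- p := q) refl

ring20 : ∀ p q → p * (q + q) ≡ (p + p) * q
ring20 = solve 2 (λ p q → p :* (q :+ q) := (p :+ p) :* q) refl

ring21 : ∀ p q r → p * (q * r) ≡ p * r * q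
ring21 = solve 3 (λ p q r → p :* (q :* r) := p :* r :* q) refl

ring22 : ∀ p q r s u → (p + q * r) + s * ((1ℚ - u) * q) * r ≡ (p + s * q * r) + (q * r - (u * s) * (q * r))
ring22 = solve 5 (λ p q r s u → (p :+ q :* r) :+ s :* ((con 1ℚ :- u) :* q) :* r := (p :+ s :* q :* r) :+ (q :* r :- (u :* s) :* (q :* r))) refl

ring23 : ∀ p q → p + (q - 1ℚ * q) ≡ p
ring23 = solve 2 (λ p q → p :+ (q :- con 1ℚ :* q) := p) refl

fromℕ : ℕ → ℚ
fromℕ n = + n / 1

recip : ℕ → ℚ
recip n = + 1 / suc n

fromℕ-+ : ∀ m n → fromℕ (m ℕ.+ n) ≡ fromℕ m + fromℕ n
fromℕ-+ m n = toℚᵘ-injective (ℚᵘ.≃-trans (toℚᵘ-fromℚᵘ (ℚᵘ.mkℚᵘ (+ (m ℕ.+ n)) 0))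
  (ℚᵘ.≃-trans (ℚᵘ.*≡* (cong (ℤ._* + 1) (cong₂ ℤ._+_ (sym (ℤ.*-identityʳ (+ m))) (sym (ℤ.*-identityʳ (+ n))))))
  (ℚᵘ.≃-sym (ℚᵘ.≃-trans (toℚᵘ-homo-+ (fromℕ m) (fromℕ n))
    (ℚᵘ.+-cong (toℚᵘ-fromℚᵘ (ℚᵘ.mkℚᵘ (+ m) 0)) (toℚᵘ-fromℚᵘ (ℚᵘ.mkℚᵘ (+ n) 0)))))))

fromℕ-suc : ∀ n → fromℕ (suc n) ≡ 1ℚ + fromℕ n
fromℕ-suc n = fromℕ-+ 1 n

fromℕ-* : ∀ m n → fromℕ (m ℕ.* n) ≡ fromℕ m * fromℕ n
fromℕ-* zero    n = sym (ℚ.*-zeroˡ (fromℕ n))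
fromℕ-* (suc m) n = trans (fromℕ-+ n (m ℕ.* n)) (trans (cong (λ z → fromℕ n + z) (fromℕ-* m n))
  (trans (ring1 (fromℕ m) (fromℕ n))
         (cong (_* fromℕ n) (sym (fromℕ-suc m)))))

recip-inverse : ∀ n → recip n * fromℕ (suc n) ≡ 1ℚ
recip-inverse n = toℚᵘ-injective (ℚᵘ.≃-trans (toℚᵘ-homo-* (recip n) (fromℕ (suc n)))
  (ℚᵘ.≃-trans (ℚᵘ.*-cong (toℚᵘ-fromℚᵘ (ℚᵘ.mkℚᵘ (+ 1) n)) (toℚᵘ-fromℚᵘ (ℚᵘ.mkℚᵘ (+ suc n) 0)))
  (ℚᵘ.*-inverseˡ (ℚᵘ.mkℚᵘ (+ suc n) 0))))

0≤fromℕ : ∀ n → 0ℚ ≤ fromℕ n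
0≤fromℕ n = ℚ.nonNegative⁻¹ (fromℕ n) {{ℚ.normalize-nonNeg n 1}}

0<recip : ∀ n → 0ℚ < recip n
0<recip n = ℚ.positive⁻¹ (recip n) {{ℚ.normalize-pos 1 (suc n)}}

0≤recip : ∀ n → 0ℚ ≤ recip n
0≤recip n = ℚ.<⇒≤ (0<recip n)

fromℕ-mono : ∀ {m n} → m ℕ.≤ n → fromℕ m ≤ fromℕ n
fromℕ-mono {m} {n} m≤n = begin
  fromℕ m                     ≡⟨ ℚ.+-identityʳ (fromℕ m) ⟨
  fromℕ m + 0ℚ                ≤⟨ ℚ.+-monoʳ-≤ (fromℕ m) (0≤fromℕ (n ℕ.∸ m)) ⟩
  fromℕ m + fromℕ (n ℕ.∸ m)   ≡⟨ fromℕ-+ m (n ℕ.∸ m) ⟨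
  fromℕ (m ℕ.+ (n ℕ.∸ m))     ≡⟨ cong fromℕ (ℕ.m+[n∸m]≡n m≤n) ⟩
  fromℕ n                     ∎
  where open ℚ.≤-Reasoning

*-monoˡ : ∀ {p q} r → 0ℚ ≤ r → p ≤ q → r * p ≤ r * q
*-monoˡ r 0≤r = ℚ.*-monoˡ-≤-nonNeg r {{ℚ.nonNegative 0≤r}}

*-monoʳ : ∀ {p q} r → 0ℚ ≤ r → p ≤ q → p * r ≤ q * r
*-monoʳ r 0≤r = ℚ.*-monoʳ-≤-nonNeg r {{ℚ.nonNegative 0≤r}}

*-mono : ∀ {p q r s} → 0ℚ ≤ r → 0ℚ ≤ q → p ≤ q → r ≤ s → p * r ≤ q * s
*-mono {q = q} {r = r} 0≤r 0≤q p≤q r≤s = ℚ.≤-trans (*-monoʳ r 0≤r p≤q) (*-monoˡ q 0≤q r≤s)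

0≤* : ∀ {p q} → 0ℚ ≤ p → 0ℚ ≤ q → 0ℚ ≤ p * q
0≤* {p} {q} 0≤p 0≤q = subst (_≤ p * q) (ℚ.*-zeroʳ p) (*-monoˡ p 0≤p 0≤q)

0≤+ : ∀ {p q} → 0ℚ ≤ p → 0ℚ ≤ q → 0ℚ ≤ p + q
0≤+ {p} {q} 0≤p 0≤q = ℚ.+-mono-≤ 0≤p 0≤q

half>0 : ∀ {ε} → 0ℚ < ε → 0ℚ < ε * ½
half>0 {ε} 0<ε = subst (_< ε * ½) (ℚ.*-zeroˡ ½) (ℚ.*-monoˡ-<-pos ½ 0<ε)

half+half : ∀ ε → ε * ½ + ε * ½ ≡ ε
half+half ε = ring2 ε

∣p-q∣≡∣q-p∣ : ∀ p q → ∣ p - q ∣ ≡ ∣ q - p ∣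
∣p-q∣≡∣q-p∣ p q = trans (cong ∣_∣ (ring3 p q)) (ℚ.∣-p∣≡∣p∣ (q - p))

∣p-r∣≤∣p-q∣+∣q-r∣ : ∀ p q r → ∣ p - r ∣ ≤ ∣ p - q ∣ + ∣ q - r ∣
∣p-r∣≤∣p-q∣+∣q-r∣ p q r = subst (λ z → ∣ z ∣ ≤ ∣ p - q ∣ + ∣ q - r ∣)
  (ring4 p q r) (ℚ.∣p+q∣≤∣p∣+∣q∣ (p - q) (q - r))

p≤∣p∣ : ∀ p → p ≤ ∣ p ∣
p≤∣p∣ p with ℚ.≤-total 0ℚ p
... | inj₁ 0≤p = ℚ.≤-reflexive (sym (ℚ.0≤p⇒∣p∣≡p 0≤p))
... | inj₂ p≤0 = ℚ.≤-trans p≤0 (ℚ.0≤∣p∣ p)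

∣p∣≤ : ∀ {p b} → p ≤ b → - p ≤ b → ∣ p ∣ ≤ b
∣p∣≤ {p} p≤b -p≤b with ℚ.∣p∣≡p∨∣p∣≡-p p
... | inj₁ e = subst (_≤ _) (sym e) p≤b
... | inj₂ e = subst (_≤ _) (sym e) -p≤b

∣∣p∣-∣q∣∣≤∣p-q∣ : ∀ p q → ∣ ∣ p ∣ - ∣ q ∣ ∣ ≤ ∣ p - q ∣
∣∣p∣-∣q∣∣≤∣p-q∣ p q = ∣p∣≤ (half p q)
  (subst (_≤ ∣ p - q ∣) (ring5 ∣ p ∣ ∣ q ∣)
    (subst (∣ q ∣ - ∣ p ∣ ≤_) (∣p-q∣≡∣q-p∣ q p) (half q p)))
  where
  open ℚ.≤-Reasoning
  half : ∀ a b → ∣ a ∣ - ∣ b ∣ ≤ ∣ a - b ∣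
  half a b = begin
    ∣ a ∣ - ∣ b ∣                 ≡⟨ cong (λ z → ∣ z ∣ - ∣ b ∣) (ring6 a b) ⟩
    ∣ (a - b) + b ∣ - ∣ b ∣       ≤⟨ ℚ.+-monoˡ-≤ (- ∣ b ∣) (ℚ.∣p+q∣≤∣p∣+∣q∣ (a - b) b) ⟩
    (∣ a - b ∣ + ∣ b ∣) - ∣ b ∣   ≡⟨ ring7 ∣ a - b ∣ ∣ b ∣ ⟩
    ∣ a - b ∣                     ∎

≤-numerator : ∀ p → p ≤ fromℕ ℤ.∣ ↥ p ∣
≤-numerator p@(mkℚ n d-1 _) = ℚ.toℚᵘ-cancel-≤ (ℚᵘ.≤-respʳ-≃ (ℚᵘ.≃-sym (toℚᵘ-fromℚᵘ (ℚᵘ.mkℚᵘ (+ ℤ.∣ n ∣) 0)))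
  (ℚᵘ.*≤* (ℤ.≤-trans (ℤ.≤-reflexive (ℤ.*-identityʳ n)) (go n))))
  where
  go : ∀ n → n ℤ.≤ + ℤ.∣ n ∣ ℤ.* + suc d-1
  go (+ n)      = ℤ.≤-trans (ℤ.+≤+ (ℕ.m≤m*n n (suc d-1))) (ℤ.≤-reflexive (ℤ.pos-* n (suc d-1)))
  go (-[1+ n ]) = ℤ.-≤+

1≤*denominator : ∀ ε → 0ℚ < ε → 1ℚ ≤ ε * fromℕ (↧ₙ ε)
1≤*denominator ε@(mkℚ (+ suc n) d-1 _) _ = ℚ.toℚᵘ-cancel-≤ (ℚᵘ.≤-respʳ-≃
  (ℚᵘ.≃-sym (ℚᵘ.≃-trans (toℚᵘ-homo-* ε (fromℕ (suc d-1)))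
     (ℚᵘ.*-congˡ {ℚᵘ.mkℚᵘ (+ suc n) d-1} (toℚᵘ-fromℚᵘ (ℚᵘ.mkℚᵘ (+ suc d-1) 0)))))
  (ℚᵘ.*≤* (ℤ.+≤+ (ℕ.≤-trans (ℕ.≤-reflexive (trans (ℕ.*-identityˡ _) (ℕ.*-identityʳ _)))
    (ℕ.≤-trans (ℕ.m≤m+n (suc d-1) (n ℕ.* suc d-1)) (ℕ.≤-reflexive (sym (ℕ.*-identityʳ _))))))))
1≤*denominator (mkℚ (+ zero) d-1 _) (*<* (ℤ.+<+ ()))
1≤*denominator (mkℚ (-[1+ n ]) d-1 _) (*<* ())

archimedean : ∀ K ε → 0ℚ < ε → ∃[ n ] K ≤ ε * fromℕ n
archimedean K ε 0<ε = a ℕ.* f , (begin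
  K                        ≤⟨ ≤-numerator K ⟩
  fromℕ a                  ≡⟨ ℚ.*-identityʳ (fromℕ a) ⟨
  fromℕ a * 1ℚ             ≤⟨ *-monoˡ (fromℕ a) (0≤fromℕ a) (1≤*denominator ε 0<ε) ⟩
  fromℕ a * (ε * fromℕ f)  ≡⟨ ring8 (fromℕ a) ε (fromℕ f) ⟩
  ε * (fromℕ a * fromℕ f)  ≡⟨ cong (λ z → ε * z) (fromℕ-* a f) ⟨
  ε * fromℕ (a ℕ.* f)      ∎)
  where
  open ℚ.≤-Reasoning
  a = ℤ.∣ ↥ K ∣
  f = ↧ₙ ε

archimedean′ : ∀ K ε → 0ℚ < ε → ∃[ N ] ∀ n → N ℕ.≤ n → K * recip n ≤ ε
archimedean′ K ε 0<ε = let (N , K≤εN) = archimedean K ε 0<ε in N , λ n N≤n → begin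
  K * recip n                      ≤⟨ *-monoʳ (recip n) (0≤recip n) K≤εN ⟩
  ε * fromℕ N * recip n            ≤⟨ *-monoʳ (recip n) (0≤recip n) (*-monoˡ ε (ℚ.<⇒≤ 0<ε) (fromℕ-mono (ℕ.m≤n⇒m≤1+n N≤n))) ⟩
  ε * fromℕ (suc n) * recip n      ≡⟨ ring9 ε (fromℕ (suc n)) (recip n) ⟩
  ε * (recip n * fromℕ (suc n))    ≡⟨ cong (λ z → ε * z) (recip-inverse n) ⟩
  ε * 1ℚ                           ≡⟨ ℚ.*-identityʳ ε ⟩
  ε                                ∎
  where open ℚ.≤-Reasoning

fromℚʳ : ℚ → ℝ
fromℚʳ q .seq _ = q
fromℚʳ q .cauchy ε 0<ε = 0 , λ _ _ _ _ →
  subst (_≤ ε) (sym (cong ∣_∣ (ℚ.+-inverseʳ q))) (ℚ.<⇒≤ 0<ε)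

fromℕʳ : ℕ → ℝ
fromℕʳ n = fromℚʳ (fromℕ n)

0ʳ 1ʳ : ℝ
0ʳ = fromℕʳ 0
1ʳ = fromℕʳ 1

infixl 6 _+ʳ_
infixl 7 _*ʳ_

_+ʳ_ : ℝ → ℝ → ℝ
(x +ʳ y) .seq n = seq x n + seq y n
(x +ʳ y) .cauchy ε 0<ε =
  let (N₁ , p) = cauchy x (ε * ½) (half>0 0<ε)
      (N₂ , q) = cauchy y (ε * ½) (half>0 0<ε)
  in N₁ ℕ.⊔ N₂ , λ m n N≤m N≤n → begin
  ∣ (seq x m + seq y m) - (seq x n + seq y n) ∣
    ≡⟨ cong ∣_∣ (ring10 (seq x m) (seq y m) (seq x n) (seq y n)) ⟩
  ∣ (seq x m - seq x n) + (seq y m - seq y n) ∣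
    ≤⟨ ℚ.∣p+q∣≤∣p∣+∣q∣ (seq x m - seq x n) (seq y m - seq y n) ⟩
  ∣ seq x m - seq x n ∣ + ∣ seq y m - seq y n ∣
    ≤⟨ ℚ.+-mono-≤ (p m n (ℕ.m⊔n≤o⇒m≤o N₁ N₂ N≤m) (ℕ.m⊔n≤o⇒m≤o N₁ N₂ N≤n))
                  (q m n (ℕ.m⊔n≤o⇒n≤o N₁ N₂ N≤m) (ℕ.m⊔n≤o⇒n≤o N₁ N₂ N≤n)) ⟩
  ε * ½ + ε * ½
    ≡⟨ half+half ε ⟩
  ε ∎
  where open ℚ.≤-Reasoning

∣_∣ʳ : ℝ → ℝ
∣ x ∣ʳ .seq n = ∣ seq x n ∣
∣ x ∣ʳ .cauchy ε 0<ε = let (N , p) = cauchy x ε 0<ε in N , λ m n N≤m N≤n → ℚ.≤-trans (∣∣p∣-∣q∣∣≤∣p-q∣ (seq x m) (seq x n)) (p m n N≤m N≤n)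

eventuallyBounded : ∀ x → ∃[ B ] ∃[ N ] ∀ n → N ℕ.≤ n → ∣ seq x n ∣ ≤ fromℕ B
eventuallyBounded x =
  let (N , p) = cauchy x 1ℚ (ℚ.positive⁻¹ 1ℚ)
      K = 1ℚ + ∣ seq x N ∣
  in ℤ.∣ ↥ K ∣ , N , λ n N≤n → begin
  ∣ seq x n ∣                            ≡⟨ cong ∣_∣ (ring6 (seq x n) (seq x N)) ⟩
  ∣ (seq x n - seq x N) + seq x N ∣      ≤⟨ ℚ.∣p+q∣≤∣p∣+∣q∣ (seq x n - seq x N) (seq x N) ⟩
  ∣ seq x n - seq x N ∣ + ∣ seq x N ∣    ≤⟨ ℚ.+-monoˡ-≤ ∣ seq x N ∣ (p n N N≤n ℕ.≤-refl) ⟩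
  K                                      ≤⟨ ≤-numerator K ⟩
  fromℕ ℤ.∣ ↥ K ∣                        ∎
  where open ℚ.≤-Reasoning

_*ʳ_ : ℝ → ℝ → ℝ
(x *ʳ y) .seq n = seq x n * seq y n
(x *ʳ y) .cauchy ε 0<ε =
  let (B₁ , N₁ , b₁) = eventuallyBounded x
      (B₂ , N₂ , b₂) = eventuallyBounded y
      (k , r) = archimedean′ (fromℕ B₁ + fromℕ B₂) ε 0<ε
      (N₃ , p) = cauchy x (recip k) (0<recip k)
      (N₄ , q) = cauchy y (recip k) (0<recip k)
      N₁₂ = N₁ ℕ.⊔ N₂
      N₃₄ = N₃ ℕ.⊔ N₄
  in N₁₂ ℕ.⊔ N₃₄ , λ m n N≤m N≤n →
  let N₁≤m = ℕ.m⊔n≤o⇒m≤o N₁ N₂ (ℕ.m⊔n≤o⇒m≤o N₁₂ N₃₄ N≤m)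
      N₂≤n = ℕ.m⊔n≤o⇒n≤o N₁ N₂ (ℕ.m⊔n≤o⇒m≤o N₁₂ N₃₄ N≤n)
      N₃≤m = ℕ.m⊔n≤o⇒m≤o N₃ N₄ (ℕ.m⊔n≤o⇒n≤o N₁₂ N₃₄ N≤m)
      N₃≤n = ℕ.m⊔n≤o⇒m≤o N₃ N₄ (ℕ.m⊔n≤o⇒n≤o N₁₂ N₃₄ N≤n)
      N₄≤m = ℕ.m⊔n≤o⇒n≤o N₃ N₄ (ℕ.m⊔n≤o⇒n≤o N₁₂ N₃₄ N≤m)
      N₄≤n = ℕ.m⊔n≤o⇒n≤o N₃ N₄ (ℕ.m⊔n≤o⇒n≤o N₁₂ N₃₄ N≤n)
      xm = seq x m ; xn = seq x n ; ym = seq y m ; yn = seq y n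
  in begin
  ∣ xm * ym - xn * yn ∣
    ≡⟨ cong ∣_∣ (ring11 xm ym xn yn) ⟩
  ∣ xm * (ym - yn) + yn * (xm - xn) ∣
    ≤⟨ ℚ.∣p+q∣≤∣p∣+∣q∣ (xm * (ym - yn)) (yn * (xm - xn)) ⟩
  ∣ xm * (ym - yn) ∣ + ∣ yn * (xm - xn) ∣
    ≡⟨ cong₂ _+_ (ℚ.∣p*q∣≡∣p∣*∣q∣ xm (ym - yn)) (ℚ.∣p*q∣≡∣p∣*∣q∣ yn (xm - xn)) ⟩
  ∣ xm ∣ * ∣ ym - yn ∣ + ∣ yn ∣ * ∣ xm - xn ∣
    ≤⟨ ℚ.+-mono-≤
         (*-mono (ℚ.0≤∣p∣ (ym - yn)) (0≤fromℕ B₁) (b₁ m N₁≤m) (q m n N₄≤m N₄≤n))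
         (*-mono (ℚ.0≤∣p∣ (xm - xn)) (0≤fromℕ B₂) (b₂ n N₂≤n) (p m n N₃≤m N₃≤n)) ⟩
  fromℕ B₁ * recip k + fromℕ B₂ * recip k
    ≡⟨ ℚ.*-distribʳ-+ (recip k) (fromℕ B₁) (fromℕ B₂) ⟨
  (fromℕ B₁ + fromℕ B₂) * recip k
    ≤⟨ r k ℕ.≤-refl ⟩
  ε ∎
  where open ℚ.≤-Reasoning

cauchy-from-≤ : (s : ℕ → ℚ) →
  (∀ ε → 0ℚ < ε → ∃[ N ] ∀ m n → N ℕ.≤ m → m ℕ.≤ n → ∣ s n - s m ∣ ≤ ε) →
  ∀ ε → 0ℚ < ε → ∃[ N ] ∀ m n → N ℕ.≤ m → N ℕ.≤ n → ∣ s m - s n ∣ ≤ ε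
cauchy-from-≤ s h ε 0<ε = N , go
  where
  N = proj₁ (h ε 0<ε)
  p = proj₂ (h ε 0<ε)
  go : ∀ m n → N ℕ.≤ m → N ℕ.≤ n → ∣ s m - s n ∣ ≤ ε
  go m n N≤m N≤n with ℕ.≤-total m n
  ... | inj₁ m≤n = subst (_≤ ε) (∣p-q∣≡∣q-p∣ (s n) (s m)) (p m n N≤m m≤n)
  ... | inj₂ n≤m = p n m N≤n n≤m

-- x^k / k!
expTerm : ℚ → ℕ → ℚ
expTerm x zero    = 1ℚ
expTerm x (suc k) = expTerm x k * (x * recip k)

expSum : ℚ → ℕ → ℚ
expSum x zero    = 1ℚ
expSum x (suc n) = expSum x n + expTerm x (suc n)

expTerm-nonNeg : ∀ {x} → 0ℚ ≤ x → ∀ k → 0ℚ ≤ expTerm x k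
expTerm-nonNeg 0≤x zero    = ℚ.nonNegative⁻¹ 1ℚ
expTerm-nonNeg 0≤x (suc k) = 0≤* (expTerm-nonNeg 0≤x k) (0≤* 0≤x (0≤recip k))

module ExpBounds (B : ℕ) where
  open ℚ.≤-Reasoning

  b : ℚ
  b = fromℕ B

  t : ℕ → ℚ
  t = expTerm b

  0≤t : ∀ k → 0ℚ ≤ t k
  0≤t = expTerm-nonNeg (0≤fromℕ B)

  ∣recip∣ : ∀ k → ∣ recip k ∣ ≡ recip k
  ∣recip∣ k = ℚ.0≤p⇒∣p∣≡p (0≤recip k)

  ∣x*recip∣≤ : ∀ {x} → ∣ x ∣ ≤ b → ∀ k → ∣ x * recip k ∣ ≤ b * recip k
  ∣x*recip∣≤ {x} ∣x∣≤b k = begin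
    ∣ x * recip k ∣       ≡⟨ ℚ.∣p*q∣≡∣p∣*∣q∣ x (recip k) ⟩
    ∣ x ∣ * ∣ recip k ∣   ≡⟨ cong (λ z → ∣ x ∣ * z) (∣recip∣ k) ⟩
    ∣ x ∣ * recip k       ≤⟨ *-monoʳ (recip k) (0≤recip k) ∣x∣≤b ⟩
    b * recip k           ∎

  ∣term∣≤ : ∀ {x} → ∣ x ∣ ≤ b → ∀ k → ∣ expTerm x k ∣ ≤ t k
  ∣term∣≤ ∣x∣≤b zero = ℚ.≤-refl
  ∣term∣≤ {x} ∣x∣≤b (suc k) = begin
    ∣ expTerm x k * (x * recip k) ∣       ≡⟨ ℚ.∣p*q∣≡∣p∣*∣q∣ (expTerm x k) (x * recip k) ⟩
    ∣ expTerm x k ∣ * ∣ x * recip k ∣     ≤⟨ *-mono (ℚ.0≤∣p∣ (x * recip k)) (0≤t k) (∣term∣≤ ∣x∣≤b k) (∣x*recip∣≤ ∣x∣≤b k) ⟩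
    t k * (b * recip k)                   ∎

  ∣sum-diff∣≤ : ∀ {x} → ∣ x ∣ ≤ b → ∀ m j →
                ∣ expSum x (j ℕ.+ m) - expSum x m ∣ ≤ expSum b (j ℕ.+ m) - expSum b m
  ∣sum-diff∣≤ {x} ∣x∣≤b m zero = ℚ.≤-reflexive
    (trans (cong ∣_∣ (ℚ.+-inverseʳ (expSum x m))) (sym (ℚ.+-inverseʳ (expSum b m))))
  ∣sum-diff∣≤ {x} ∣x∣≤b m (suc j) = begin
    ∣ (S + u) - S₀ ∣          ≡⟨ cong ∣_∣ (ring12 S u S₀) ⟩
    ∣ (S - S₀) + u ∣          ≤⟨ ℚ.∣p+q∣≤∣p∣+∣q∣ (S - S₀) u ⟩
    ∣ S - S₀ ∣ + ∣ u ∣        ≤⟨ ℚ.+-mono-≤ (∣sum-diff∣≤ ∣x∣≤b m j) (∣term∣≤ ∣x∣≤b (suc (j ℕ.+ m))) ⟩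
    (E - E₀) + v              ≡⟨ ring13 E v E₀ ⟩
    (E + v) - E₀              ∎
    where
    S = expSum x (j ℕ.+ m) ; S₀ = expSum x m ; u = expTerm x (suc (j ℕ.+ m))
    E = expSum b (j ℕ.+ m) ; E₀ = expSum b m ; v = t (suc (j ℕ.+ m))

  term-lipschitz : ∀ {x y} → ∣ x ∣ ≤ b → ∣ y ∣ ≤ b → ∀ k →
                   ∣ expTerm x (suc k) - expTerm y (suc k) ∣ ≤ t k * ∣ x - y ∣
  term-lipschitz {x} {y} ∣x∣≤b ∣y∣≤b zero = ℚ.≤-reflexive
    (trans (cong ∣_∣ (ring14 x y))
           (sym (ℚ.*-identityˡ ∣ x - y ∣)))
  term-lipschitz {x} {y} ∣x∣≤b ∣y∣≤b (suc k) = begin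
    ∣ u * (x * r) - v * (y * r) ∣
      ≡⟨ cong ∣_∣ (ring15 u v x y r) ⟩
    ∣ r * (u * (x - y) + y * (u - v)) ∣
      ≡⟨ ℚ.∣p*q∣≡∣p∣*∣q∣ r (u * (x - y) + y * (u - v)) ⟩
    ∣ r ∣ * ∣ u * (x - y) + y * (u - v) ∣
      ≡⟨ cong (_* ∣ u * (x - y) + y * (u - v) ∣) (∣recip∣ (suc k)) ⟩
    r * ∣ u * (x - y) + y * (u - v) ∣
      ≤⟨ *-monoˡ r (0≤recip (suc k)) (ℚ.∣p+q∣≤∣p∣+∣q∣ (u * (x - y)) (y * (u - v))) ⟩
    r * (∣ u * (x - y) ∣ + ∣ y * (u - v) ∣)
      ≡⟨ cong (λ z → r * z) (cong₂ _+_ (ℚ.∣p*q∣≡∣p∣*∣q∣ u (x - y)) (ℚ.∣p*q∣≡∣p∣*∣q∣ y (u - v))) ⟩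
    r * (∣ u ∣ * D + ∣ y ∣ * ∣ u - v ∣)
      ≤⟨ *-monoˡ r (0≤recip (suc k)) (ℚ.+-mono-≤
           (*-monoʳ D (ℚ.0≤∣p∣ (x - y)) (∣term∣≤ ∣x∣≤b (suc k)))
           (*-mono (ℚ.0≤∣p∣ (u - v)) (0≤fromℕ B) ∣y∣≤b (term-lipschitz ∣x∣≤b ∣y∣≤b k))) ⟩
    r * (t (suc k) * D + b * (t k * D))
      ≡⟨ cong (λ z → r * (t (suc k) * D + z)) bt≡ ⟩
    r * (t (suc k) * D + fromℕ (suc k) * (t (suc k) * D))
      ≡⟨ ring16 r (fromℕ (suc k)) (t (suc k) * D) ⟩
    r * (1ℚ + fromℕ (suc k)) * (t (suc k) * D)
      ≡⟨ cong (λ z → r * z * (t (suc k) * D)) (fromℕ-suc (suc k)) ⟨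
    r * fromℕ (suc (suc k)) * (t (suc k) * D)
      ≡⟨ cong (_* (t (suc k) * D)) (recip-inverse (suc k)) ⟩
    1ℚ * (t (suc k) * D)
      ≡⟨ ℚ.*-identityˡ (t (suc k) * D) ⟩
    t (suc k) * D ∎
    where
    r = recip (suc k) ; u = expTerm x (suc k) ; v = expTerm y (suc k) ; D = ∣ x - y ∣
    bt≡ : b * (t k * D) ≡ fromℕ (suc k) * (t (suc k) * D)
    bt≡ = sym (trans
      (ring17 (fromℕ (suc k)) (t k) b (recip k) D)
      (trans (cong (_* (b * (t k * D))) (recip-inverse k)) (ℚ.*-identityˡ (b * (t k * D)))))

  sum-lipschitz : ∀ {x y} → ∣ x ∣ ≤ b → ∣ y ∣ ≤ b → ∀ n →
                  ∣ expSum x n - expSum y n ∣ ≤ expSum b n * ∣ x - y ∣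
  sum-lipschitz {x} {y} ∣x∣≤b ∣y∣≤b n = ℚ.≤-trans (go n) (*-monoʳ D (ℚ.0≤∣p∣ (x - y)) (pre n))
    where
    D = ∣ x - y ∣
    P : ℕ → ℚ
    P zero    = 0ℚ
    P (suc n) = P n + t n
    E≡P : ∀ n → expSum b n ≡ P (suc n)
    E≡P zero    = refl
    E≡P (suc n) = cong (_+ t (suc n)) (E≡P n)
    pre : ∀ n → P n ≤ expSum b n
    pre n = subst (P n ≤_) (sym (E≡P n)) (subst (_≤ P n + t n) (ℚ.+-identityʳ (P n)) (ℚ.+-monoʳ-≤ (P n) (0≤t n)))
    go : ∀ n → ∣ expSum x n - expSum y n ∣ ≤ P n * D
    go zero    = ℚ.≤-reflexive (sym (ℚ.*-zeroˡ D))
    go (suc n) = begin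
      ∣ (S + u) - (S′ + u′) ∣        ≡⟨ cong ∣_∣ (ring10 S u S′ u′) ⟩
      ∣ (S - S′) + (u - u′) ∣        ≤⟨ ℚ.∣p+q∣≤∣p∣+∣q∣ (S - S′) (u - u′) ⟩
      ∣ S - S′ ∣ + ∣ u - u′ ∣        ≤⟨ ℚ.+-mono-≤ (go n) (term-lipschitz ∣x∣≤b ∣y∣≤b n) ⟩
      P n * D + t n * D              ≡⟨ ℚ.*-distribʳ-+ D (P n) (t n) ⟨
      (P n + t n) * D                ∎
      where
      S = expSum x n ; S′ = expSum y n ; u = expTerm x (suc n) ; u′ = expTerm y (suc n)

  K₀ : ℕ
  K₀ = B ℕ.+ B

  halving : ∀ k → K₀ ℕ.≤ k → t (suc k) + t (suc k) ≤ t k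
  halving k K₀≤k = begin
    t k * (b * r) + t k * (b * r)     ≡⟨ ring18 (t k) b r ⟩
    t k * ((b + b) * r)               ≡⟨ cong (λ z → t k * (z * r)) (fromℕ-+ B B) ⟨
    t k * (fromℕ K₀ * r)              ≤⟨ *-monoˡ (t k) (0≤t k) (*-monoʳ r (0≤recip k) (fromℕ-mono (ℕ.m≤n⇒m≤1+n K₀≤k))) ⟩
    t k * (fromℕ (suc k) * r)         ≡⟨ cong (λ z → t k * z) (trans (ℚ.*-comm (fromℕ (suc k)) r) (recip-inverse k)) ⟩
    t k * 1ℚ                          ≡⟨ ℚ.*-identityʳ (t k) ⟩
    t k                               ∎
    where r = recip k

  tail : ∀ m → K₀ ℕ.≤ m → ∀ j → expSum b (j ℕ.+ m) + t (j ℕ.+ m) ≤ expSum b m + t m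
  tail m K₀≤m zero    = ℚ.≤-refl
  tail m K₀≤m (suc j) = begin
    (E + v) + v      ≡⟨ ℚ.+-assoc E v v ⟩
    E + (v + v)      ≤⟨ ℚ.+-monoʳ-≤ E (halving (j ℕ.+ m) (ℕ.≤-trans K₀≤m (ℕ.m≤n+m m j))) ⟩
    E + t (j ℕ.+ m)  ≤⟨ tail m K₀≤m j ⟩
    expSum b m + t m ∎
    where
    E = expSum b (j ℕ.+ m) ; v = t (suc (j ℕ.+ m))

  sum≤ : ∀ m j → expSum b (j ℕ.+ m) ≤ expSum b (j ℕ.+ m) + t (j ℕ.+ m)
  sum≤ m j = subst (_≤ E + t (j ℕ.+ m)) (ℚ.+-identityʳ E) (ℚ.+-monoʳ-≤ E (0≤t (j ℕ.+ m)))
    where E = expSum b (j ℕ.+ m)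

  sum-tail : ∀ m → K₀ ℕ.≤ m → ∀ j → expSum b (j ℕ.+ m) - expSum b m ≤ t m
  sum-tail m K₀≤m j = begin
    expSum b (j ℕ.+ m) - E₀   ≤⟨ ℚ.+-monoˡ-≤ (- E₀) (ℚ.≤-trans (sum≤ m j) (tail m K₀≤m j)) ⟩
    (E₀ + t m) - E₀           ≡⟨ ring19 E₀ (t m) ⟩
    t m                       ∎
    where E₀ = expSum b m

  sumBound : ℚ
  sumBound = expSum b K₀ + t K₀

  sum-bounded : ∀ n → K₀ ℕ.≤ n → expSum b n ≤ sumBound
  sum-bounded n K₀≤n = subst (λ z → expSum b z ≤ sumBound) (ℕ.m∸n+n≡m K₀≤n)
    (ℚ.≤-trans (sum≤ K₀ (n ℕ.∸ K₀)) (tail K₀ ℕ.≤-refl (n ℕ.∸ K₀)))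

  decay : ∀ j → t (j ℕ.+ K₀) * fromℕ (suc j) ≤ t K₀
  decay zero    = ℚ.≤-reflexive (ℚ.*-identityʳ (t K₀))
  decay (suc j) = begin
    v * fromℕ (suc (suc j))              ≡⟨ cong (λ z → v * z) (fromℕ-suc (suc j)) ⟩
    v * (1ℚ + f)                         ≤⟨ *-monoˡ v (0≤t (suc (j ℕ.+ K₀))) (ℚ.+-monoˡ-≤ f (fromℕ-mono {1} {suc j} (ℕ.s≤s ℕ.z≤n))) ⟩
    v * (f + f)                          ≡⟨ ring20 v f ⟩
    (v + v) * f                          ≤⟨ *-monoʳ f (0≤fromℕ (suc j)) (halving (j ℕ.+ K₀) (ℕ.m≤n+m K₀ j)) ⟩
    t (j ℕ.+ K₀) * f                     ≤⟨ decay j ⟩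
    t K₀                                 ∎
    where
    v = t (suc (j ℕ.+ K₀)) ; f = fromℕ (suc j)

  decay′ : ∀ j → t (j ℕ.+ K₀) ≤ t K₀ * recip j
  decay′ j = begin
    v                                   ≡⟨ ℚ.*-identityʳ v ⟨
    v * 1ℚ                              ≡⟨ cong (λ z → v * z) (recip-inverse j) ⟨
    v * (recip j * fromℕ (suc j))       ≡⟨ ring21 v (recip j) (fromℕ (suc j)) ⟩
    v * fromℕ (suc j) * recip j         ≤⟨ *-monoʳ (recip j) (0≤recip j) (decay j) ⟩
    t K₀ * recip j                      ∎
    where v = t (j ℕ.+ K₀)

  term→0 : ∀ ε → 0ℚ < ε → ∃[ N ] ∀ m → N ℕ.≤ m → K₀ ℕ.≤ m × t m ≤ ε
  term→0 ε 0<ε = let (N , p) = archimedean′ (t K₀) ε 0<ε in N ℕ.+ K₀ , λ m h →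
    let K₀≤m = ℕ.≤-trans (ℕ.m≤n+m K₀ N) h in
    K₀≤m , subst (λ z → t z ≤ ε) (ℕ.m∸n+n≡m K₀≤m)
      (ℚ.≤-trans (decay′ (m ℕ.∸ K₀)) (p (m ℕ.∸ K₀) (ℕ.m+n≤o⇒m≤o∸n N h)))

exp : ℝ → ℝ
exp x .seq n = expSum (seq x n) n
exp x .cauchy = cauchy-from-≤ (λ n → expSum (seq x n) n) main
  where
  open ℚ.≤-Reasoning
  main : ∀ ε → 0ℚ < ε → ∃[ N ] ∀ m n → N ℕ.≤ m → m ℕ.≤ n →
         ∣ expSum (seq x n) n - expSum (seq x m) m ∣ ≤ ε
  main ε 0<ε =
    let (B , N₁ , bdd) = eventuallyBounded x
        (N₂ , small) = ExpBounds.term→0 B (ε * ½) (half>0 0<ε)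
        (k , sc) = archimedean′ (ExpBounds.sumBound B) (ε * ½) (half>0 0<ε)
        (N₃ , cau) = cauchy x (recip k) (0<recip k)
    in N₁ ℕ.⊔ (N₂ ℕ.⊔ N₃) , λ m n N≤m m≤n →
    let N₁≤m  = ℕ.m⊔n≤o⇒m≤o N₁ (N₂ ℕ.⊔ N₃) N≤m
        N₂₃≤m = ℕ.m⊔n≤o⇒n≤o N₁ (N₂ ℕ.⊔ N₃) N≤m
        N₂≤m  = ℕ.m⊔n≤o⇒m≤o N₂ N₃ N₂₃≤m
        N₃≤m  = ℕ.m⊔n≤o⇒n≤o N₂ N₃ N₂₃≤m
        xm = seq x m
        xn = seq x n
        bm = bdd m N₁≤m
        bn = bdd n (ℕ.≤-trans N₁≤m m≤n)
        K₀≤m = proj₁ (small m N₂≤m)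
    in begin
    ∣ expSum xn n - expSum xm m ∣
      ≤⟨ ∣p-r∣≤∣p-q∣+∣q-r∣ (expSum xn n) (expSum xn m) (expSum xm m) ⟩
    ∣ expSum xn n - expSum xn m ∣ + ∣ expSum xn m - expSum xm m ∣
      ≤⟨ ℚ.+-mono-≤
           (subst (λ z → ∣ expSum xn z - expSum xn m ∣ ≤ ε * ½) (ℕ.m∸n+n≡m m≤n)
             (ℚ.≤-trans (ExpBounds.∣sum-diff∣≤ B bn m (n ℕ.∸ m))
             (ℚ.≤-trans (ExpBounds.sum-tail B m K₀≤m (n ℕ.∸ m)) (proj₂ (small m N₂≤m)))))
           (ℚ.≤-trans (ExpBounds.sum-lipschitz B bn bm m)
           (ℚ.≤-trans (*-monoʳ ∣ xn - xm ∣ (ℚ.0≤∣p∣ (xn - xm)) (ExpBounds.sum-bounded B m K₀≤m))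
           (ℚ.≤-trans (*-monoˡ (ExpBounds.sumBound B) (0≤sumBound B) (cau n m (ℕ.≤-trans N₃≤m m≤n) N₃≤m))
           (sc k ℕ.≤-refl)))) ⟩
    ε * ½ + ε * ½
      ≡⟨ half+half ε ⟩
    ε ∎
    where
    0≤sum : ∀ B n → 0ℚ ≤ expSum (fromℕ B) n
    0≤sum B zero    = ℚ.nonNegative⁻¹ 1ℚ
    0≤sum B (suc n) = 0≤+ (0≤sum B n) (ExpBounds.0≤t B (suc n))
    0≤sumBound : ∀ B → 0ℚ ≤ ExpBounds.sumBound B
    0≤sumBound B = 0≤+ (0≤sum B (ExpBounds.K₀ B)) (ExpBounds.0≤t B (ExpBounds.K₀ B))

-- Natural logarithm of a positive integer, by the Mercator series
--   log n = - log (1 - x) = Σ_{k ≥ 1} x^k / k,   x = 1 - 1/n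

power : ℚ → ℕ → ℚ
power x zero    = 1ℚ
power x (suc k) = x * power x k

mercatorSum : ℚ → ℕ → ℚ
mercatorSum x zero    = 0ℚ
mercatorSum x (suc N) = mercatorSum x N + power x (suc N) * recip N

module MercatorBounds (n-1 : ℕ) where
  open ℚ.≤-Reasoning

  n x : ℚ
  n = fromℕ (suc n-1)
  x = 1ℚ - recip n-1

  S : ℕ → ℚ
  S = mercatorSum x

  0≤x : 0ℚ ≤ x
  0≤x = subst (_≤ x) (ℚ.+-inverseʳ (recip n-1)) (ℚ.+-monoˡ-≤ (- recip n-1) (recip≤1 n-1))
    where
    recip≤1 : ∀ k → recip k ≤ 1ℚ
    recip≤1 k = begin
      recip k                  ≡⟨ ℚ.*-identityʳ (recip k) ⟨
      recip k * 1ℚ             ≤⟨ *-monoˡ (recip k) (0≤recip k) (fromℕ-mono {1} {suc k} (ℕ.s≤s ℕ.z≤n)) ⟩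
      recip k * fromℕ (suc k)  ≡⟨ recip-inverse k ⟩
      1ℚ                       ∎

  0≤power : ∀ k → 0ℚ ≤ power x k
  0≤power zero    = ℚ.nonNegative⁻¹ 1ℚ
  0≤power (suc k) = 0≤* 0≤x (0≤power k)

  power≤1 : ∀ k → power x k ≤ 1ℚ
  power≤1 zero    = ℚ.≤-refl
  power≤1 (suc k) = *-mono (0≤power k) (ℚ.nonNegative⁻¹ 1ℚ) x≤1 (power≤1 k)
    where
    x≤1 : x ≤ 1ℚ
    x≤1 = subst (x ≤_) (ℚ.+-identityʳ 1ℚ) (ℚ.+-monoʳ-≤ 1ℚ (ℚ.neg-antimono-≤ (0≤recip n-1)))

  recip-anti : ∀ {j k} → j ℕ.≤ k → recip k ≤ recip j
  recip-anti {j} {k} j≤k = begin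
    recip k                               ≡⟨ ℚ.*-identityʳ (recip k) ⟨
    recip k * 1ℚ                          ≡⟨ cong (λ z → recip k * z) (recip-inverse j) ⟨
    recip k * (recip j * fromℕ (suc j))   ≤⟨ *-monoˡ (recip k) (0≤recip k) (*-monoˡ (recip j) (0≤recip j) (fromℕ-mono (ℕ.s≤s j≤k))) ⟩
    recip k * (recip j * fromℕ (suc k))   ≡⟨ ring8 (recip k) (recip j) (fromℕ (suc k)) ⟩
    recip j * (recip k * fromℕ (suc k))   ≡⟨ cong (λ z → recip j * z) (recip-inverse k) ⟩
    recip j * 1ℚ                          ≡⟨ ℚ.*-identityʳ (recip j) ⟩
    recip j                               ∎

  tail : ∀ m j → S (j ℕ.+ m) + n * power x (suc (j ℕ.+ m)) * recip m ≤ S m + n * power x (suc m) * recip m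
  tail m zero    = ℚ.≤-refl
  tail m (suc j) = begin
    (s + p * recip k) + n * (x * p) * r
      ≤⟨ ℚ.+-monoˡ-≤ (n * (x * p) * r) (ℚ.+-monoʳ-≤ s (*-monoˡ p (0≤power (suc k)) (recip-anti (ℕ.m≤n+m m j)))) ⟩
    (s + p * r) + n * ((1ℚ - recip n-1) * p) * r
      ≡⟨ ring22 s p r n (recip n-1) ⟩
    (s + n * p * r) + (p * r - (recip n-1 * n) * (p * r))
      ≡⟨ cong (λ z → (s + n * p * r) + (p * r - z * (p * r))) (recip-inverse n-1) ⟩
    (s + n * p * r) + (p * r - 1ℚ * (p * r))
      ≡⟨ ring23 (s + n * p * r) (p * r) ⟩
    s + n * p * r
      ≤⟨ tail m j ⟩
    S m + n * power x (suc m) * r ∎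
    where
    k = j ℕ.+ m ; s = S k ; p = power x (suc k) ; r = recip m

  mono : ∀ m j → S m ≤ S (j ℕ.+ m)
  mono m zero    = ℚ.≤-refl
  mono m (suc j) = ℚ.≤-trans (mono m j)
    (subst (_≤ S (suc (j ℕ.+ m))) (ℚ.+-identityʳ (S (j ℕ.+ m)))
      (ℚ.+-monoʳ-≤ (S (j ℕ.+ m)) (0≤* (0≤power (suc (j ℕ.+ m))) (0≤recip (j ℕ.+ m)))))

  diff : ∀ m j → ∣ S (j ℕ.+ m) - S m ∣ ≤ n * recip m
  diff m j = begin
    ∣ s - S m ∣                                  ≡⟨ ℚ.0≤p⇒∣p∣≡p (subst (_≤ s - S m) (ℚ.+-inverseʳ (S m)) (ℚ.+-monoˡ-≤ (- S m) (mono m j))) ⟩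
    s - S m                                      ≡⟨ cong (_- S m) (ℚ.+-identityʳ s) ⟨
    (s + 0ℚ) - S m                               ≤⟨ ℚ.+-monoˡ-≤ (- S m) (ℚ.+-monoʳ-≤ s (0≤* (0≤* 0≤n (0≤power (suc (j ℕ.+ m)))) (0≤recip m))) ⟩
    (s + n * power x (suc (j ℕ.+ m)) * recip m) - S m   ≤⟨ ℚ.+-monoˡ-≤ (- S m) (tail m j) ⟩
    (S m + n * power x (suc m) * recip m) - S m  ≡⟨ ring19 (S m) (n * power x (suc m) * recip m) ⟩
    n * power x (suc m) * recip m                ≤⟨ *-monoʳ (recip m) (0≤recip m) (*-monoˡ n 0≤n (power≤1 (suc m))) ⟩
    n * 1ℚ * recip m                             ≡⟨ cong (_* recip m) (ℚ.*-identityʳ n) ⟩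
    n * recip m                                  ∎
    where
    s = S (j ℕ.+ m)
    0≤n = 0≤fromℕ (suc n-1)

log : (n : ℕ) → .{{ℕ.NonZero n}} → ℝ
log (suc n-1) .seq = mercatorSum (1ℚ - recip n-1)
log (suc n-1) .cauchy = cauchy-from-≤ S main
  where
  open MercatorBounds n-1
  main : ∀ ε → 0ℚ < ε → ∃[ N ] ∀ i k → N ℕ.≤ i → i ℕ.≤ k → ∣ S k - S i ∣ ≤ ε
  main ε 0<ε = let (N , p) = archimedean′ n ε 0<ε in N , λ i k N≤i i≤k →
    ℚ.≤-trans (subst (λ z → ∣ S z - S i ∣ ≤ n * recip i) (ℕ.m∸n+n≡m i≤k) (diff i (k ℕ.∸ i))) (p i N≤i)

infixr 8 _^ʳ_

_^ʳ_ : (n : ℕ) → .{{ℕ.NonZero n}} → ℝ → ℝ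
n ^ʳ x = exp (x *ʳ log n)

_→0 : (ℕ → ℝ) → Set
η →0 = ∀ ε → 0ʳ <ʳ ε → ∃[ N ] ∀ n → N ℕ.≤ n → ∣ η n ∣ʳ <ʳ ε

-- Non-increasing on [1, ∞); values of δ below 1 are irrelevant.
Decreasing : (ℝ → ℝ) → Set
Decreasing δ = ∀ s t → 1ʳ ≤ʳ s → s ≤ʳ t → δ t ≤ʳ δ s

-- n = ⌊ t ⌋.  The floor is not a computable function on ℝ, so the step
-- function M(t) = Σ_{1 ≤ k ≤ t} μ(k) of a real t is M n for the n with this
-- property.
IsFloor : ℝ → ℕ → Set
IsFloor t n = fromℕʳ n ≤ʳ t × t <ʳ fromℕʳ (suc n)

MertensBound : (ℝ → ℝ) → Set
MertensBound δ = ∀ t n → 1ʳ ≤ʳ t → IsFloor t n → fromℕʳ ℤ.∣ M n ∣ ≤ʳ t *ʳ δ t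

{-# OPTIONS --safe #-}
-- For ξ = a/b and x = ξ² the symmetry ζ ↦ 1 − ζ and Möbius inversion give
--   2 (x F(T) − #{ζ ∈ 𝓕(T) : ζ ≥ 1 − x}) = 1 + Σ_{m ≤ T} (2{xm} − 1) M(T/m).
-- The m ≤ T/s, with s ≍ √T, contribute O(T δ(√T) log T).  For the other m the sum is
-- Σ_{d < s} μ(d) Σ_{T/s < m ≤ T/d} (2{xm} − 1).  If |x − p/q| ≤ 1/q² with p, q coprime, then
-- 2{xm} − 1 has bounded sums over q consecutive m, so the inner sum is O(T/(dq) + q).  Dirichlet's
-- theorem provides such a q ≤ Q ≍ T^{1/4}.  For fixed b and p ≥ 1 only O(1 + b/(pQ)) numerators a
-- put a²/b² within 1/(qQ) of p/q; for p = 0 one uses 1/⌊1/x⌋ as the approximation instead.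
-- Summing over all a < b ≤ T yields O(T^{11/4} (log T)³), and the logarithms are absorbed by T^{o(1)}.
module Submission where

-- The size of `Q` is a balance. On average over the numerators of one denominator, complete blocks
-- cost about T/(d Q) and the incomplete block about Q; summed over b ≤ T, a < b and d ≤ s this
-- gives T³/Q and T^{5/2} Q up to logarithms, which agree at Q ≍ T^{1/4}. The cut is the integer `s`
-- = 2 Q² because it must provably dominate √T as given by truncated series: monotonicity of δ is
-- applied at T/m ≥ s. The second obstacle is the real numbers. Powers of T and log T are Cauchy
-- sequences of truncated series read off at a common index, and `≤ʳ` holds only up to a tolerance
-- and from some index on. Hence no identity for exp or log of reals is used: at a finite index log
-- T lies between two harmonic sums, and products of truncated exponentials are compared by
-- inequalities. Values of δ at different points settle at different indices, so one rational
-- maximum of the quotients |M u|/u is formed first and compared with δ(√T) once.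

-- Finite sums and indicators over a commutative semiring, used over ℕ for counting and over ℤ for
-- signed sums.

module FiniteSum where
  open import Algebra.Bundles using (CommutativeSemiring)
  open import Data.Nat.Base as ℕ using (ℕ; zero; suc; _≤_; z≤n; s≤s; NonZero)
  import Data.Nat.Properties as ℕ
  open import Data.Nat.Divisibility using (_∣?_; divides)
  open import Level using (0ℓ)
  open import Relation.Nullary.Decidable using (Dec; yes; no; _×-dec_)
  open import Relation.Nullary.Negation using (¬_; contradiction)
  import Relation.Binary.PropositionalEquality as ≡
  open ≡ using (_≡_)

  module Sum (R : CommutativeSemiring 0ℓ 0ℓ) where
    open CommutativeSemiring R
    open import Relation.Binary.Reasoning.Setoid setoid
    open import Algebra.Properties.CommutativeSemigroup +-commutativeSemigroup using (interchange)

    ∑ : ℕ → (ℕ → Carrier) → Carrier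
    ∑ zero    f = 0#
    ∑ (suc n) f = ∑ n f + f (suc n)

    χ : ∀ {P : Set} → Dec P → Carrier
    χ (yes _) = 1#
    χ (no  _) = 0#

    χ-yes : ∀ {P : Set} (d : Dec P) → P → χ d ≈ 1#
    χ-yes (yes _) p = refl
    χ-yes (no ¬p) p = contradiction p ¬p

    χ-no : ∀ {P : Set} (d : Dec P) → ¬ P → χ d ≈ 0#
    χ-no (yes p) ¬p = contradiction p ¬p
    χ-no (no _)  ¬p = refl

    χ-cong : ∀ {P Q : Set} (d : Dec P) (e : Dec Q) → (P → Q) → (Q → P) → χ d ≈ χ e
    χ-cong (yes p) e f g = sym (χ-yes e (f p))
    χ-cong (no ¬p) e f g = sym (χ-no e (λ q → ¬p (g q)))

    χ-× : ∀ {P Q : Set} (d : Dec P) (e : Dec Q) → χ d * χ e ≈ χ (d ×-dec e)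
    χ-× (yes _) (yes _) = *-identityˡ 1#
    χ-× (yes _) (no _)  = zeroʳ 1#
    χ-× (no _)  e       = zeroˡ (χ e)

    χ-*-cong : ∀ {P : Set} (d : Dec P) {x y} → (P → x ≈ y) → χ d * x ≈ χ d * y
    χ-*-cong (yes p) e = *-congˡ (e p)
    χ-*-cong (no _)  e = trans (zeroˡ _) (sym (zeroˡ _))

    ∑-cong : ∀ n {f g} → (∀ i → 1 ≤ i → i ≤ n → f i ≈ g i) → ∑ n f ≈ ∑ n g
    ∑-cong zero    e = refl
    ∑-cong (suc n) e = +-cong (∑-cong n (λ i 1≤i i≤n → e i 1≤i (ℕ.m≤n⇒m≤1+n i≤n))) (e (suc n) (s≤s z≤n) ℕ.≤-refl)

    ∑-cong′ : ∀ n {f g} → (∀ i → f i ≈ g i) → ∑ n f ≈ ∑ n g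
    ∑-cong′ n e = ∑-cong n (λ i _ _ → e i)

    ∑-zero : ∀ n {f} → (∀ i → 1 ≤ i → i ≤ n → f i ≈ 0#) → ∑ n f ≈ 0#
    ∑-zero zero    e = refl
    ∑-zero (suc n) e = trans (+-cong (∑-zero n (λ i 1≤i i≤n → e i 1≤i (ℕ.m≤n⇒m≤1+n i≤n))) (e (suc n) (s≤s z≤n) ℕ.≤-refl)) (+-identityˡ 0#)

    ∑-+ : ∀ n f g → ∑ n (λ i → f i + g i) ≈ ∑ n f + ∑ n g
    ∑-+ zero    f g = sym (+-identityˡ 0#)
    ∑-+ (suc n) f g = trans (+-congʳ (∑-+ n f g)) (interchange (∑ n f) (∑ n g) (f (suc n)) (g (suc n)))

    ∑-*ˡ : ∀ n c f → c * ∑ n f ≈ ∑ n (λ i → c * f i)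
    ∑-*ˡ zero    c f = zeroʳ c
    ∑-*ˡ (suc n) c f = trans (distribˡ c (∑ n f) (f (suc n))) (+-congʳ (∑-*ˡ n c f))

    ∑-*ʳ : ∀ n c f → ∑ n f * c ≈ ∑ n (λ i → f i * c)
    ∑-*ʳ zero    c f = zeroˡ c
    ∑-*ʳ (suc n) c f = trans (distribʳ c (∑ n f) (f (suc n))) (+-congʳ (∑-*ʳ n c f))

    ∑-swap : ∀ m n (f : ℕ → ℕ → Carrier) → ∑ m (λ i → ∑ n (f i)) ≈ ∑ n (λ j → ∑ m (λ i → f i j))
    ∑-swap zero    n f = sym (∑-zero n (λ _ _ _ → refl))
    ∑-swap (suc m) n f = trans (+-congʳ (∑-swap m n f)) (sym (∑-+ n (λ j → ∑ m (λ i → f i j)) (f (suc m))))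

    ∑-append : ∀ m n f → ∑ (m ℕ.+ n) f ≈ ∑ m f + ∑ n (λ i → f (m ℕ.+ i))
    ∑-append m zero    f = trans (reflexive (≡.cong (λ z → ∑ z f) (ℕ.+-identityʳ m))) (sym (+-identityʳ (∑ m f)))
    ∑-append m (suc n) f = begin
      ∑ (m ℕ.+ suc n) f ≡⟨ ≡.cong (λ z → ∑ z f) (ℕ.+-suc m n) ⟩
      ∑ (m ℕ.+ n) f + f (suc (m ℕ.+ n)) ≈⟨ +-cong (∑-append m n f) (reflexive (≡.cong f (≡.sym (ℕ.+-suc m n)))) ⟩
      ∑ m f + ∑ n (λ i → f (m ℕ.+ i)) + f (m ℕ.+ suc n) ≈⟨ +-assoc _ _ _ ⟩
      ∑ m f + ∑ (suc n) (λ i → f (m ℕ.+ i)) ∎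

    ∑-shift : ∀ n f → ∑ (suc n) f ≈ f 1 + ∑ n (λ i → f (suc i))
    ∑-shift n f = trans (∑-append 1 n f) (+-congʳ (+-identityˡ (f 1)))

    ∑-reverse : ∀ n f → ∑ n f ≈ ∑ n (λ i → f (suc n ℕ.∸ i))
    ∑-reverse zero    f = refl
    ∑-reverse (suc n) f = begin
      ∑ n f + f (suc n) ≈⟨ +-comm _ _ ⟩
      f (suc n) + ∑ n f ≈⟨ +-congˡ (∑-reverse n f) ⟩
      f (suc n) + ∑ n (λ i → f (suc n ℕ.∸ i)) ≈⟨ ∑-shift n (λ i → f (suc (suc n) ℕ.∸ i)) ⟨
      ∑ (suc n) (λ i → f (suc (suc n) ℕ.∸ i)) ∎

    ∑-≤ : ∀ {k n} (f : ℕ → Carrier) → k ≤ n → ∑ n (λ i → χ (i ℕ.≤? k) * f i) ≈ ∑ k f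
    ∑-≤ {k} {n} f k≤n = begin
      ∑ n g ≡⟨ ≡.cong (λ z → ∑ z g) (≡.sym (ℕ.m+[n∸m]≡n k≤n)) ⟩
      ∑ (k ℕ.+ (n ℕ.∸ k)) g ≈⟨ ∑-append k (n ℕ.∸ k) g ⟩
      ∑ k g + ∑ (n ℕ.∸ k) (λ i → g (k ℕ.+ i)) ≈⟨ +-cong
        (∑-cong k (λ i _ i≤k → trans (*-congʳ (χ-yes (i ℕ.≤? k) i≤k)) (*-identityˡ (f i))))
        (∑-zero (n ℕ.∸ k) (λ i 1≤i _ → trans (*-congʳ (χ-no (k ℕ.+ i ℕ.≤? k) (ℕ.<⇒≱ (ℕ.m<m+n k 1≤i)))) (zeroˡ _))) ⟩
      ∑ k f + 0# ≈⟨ +-identityʳ _ ⟩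
      ∑ k f ∎
      where g = λ i → χ (i ℕ.≤? k) * f i

    ∑-δ : ∀ {j n} (f : ℕ → Carrier) → 1 ≤ j → j ≤ n → ∑ n (λ i → χ (i ℕ.≟ j) * f i) ≈ f j
    ∑-δ {j} {suc n} f 1≤j j≤1+n with suc n ℕ.≟ j
    ... | yes ≡.refl = begin
      ∑ n (λ i → χ (i ℕ.≟ suc n) * f i) + 1# * f (suc n)
        ≈⟨ +-cong (∑-zero n (λ i _ i≤n → trans (*-congʳ (χ-no (i ℕ.≟ suc n) (ℕ.<⇒≢ (s≤s i≤n)))) (zeroˡ _))) (*-identityˡ _) ⟩
      0# + f (suc n) ≈⟨ +-identityˡ _ ⟩
      f (suc n) ∎
    ... | no 1+n≢j = begin
      ∑ n (λ i → χ (i ℕ.≟ j) * f i) + 0# * f (suc n)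
        ≈⟨ +-cong (∑-δ f 1≤j (ℕ.≤-pred (ℕ.≤∧≢⇒< j≤1+n (≡.≢-sym 1+n≢j)))) (zeroˡ _) ⟩
      f j + 0# ≈⟨ +-identityʳ _ ⟩
      f j ∎
    ∑-δ {suc j} {zero} f 1≤j ()

    -- The indicator of d ∣ k is itself the sum over m of the indicator of k = d m, since at most
    -- one m fits; exchanging the two sums then collapses k.
    ∑-∣ : ∀ d .{{_ : NonZero d}} K (f : ℕ → Carrier) →
          ∑ K (λ k → χ (d ∣? k) * f k) ≈ ∑ K (λ m → χ (d ℕ.* m ℕ.≤? K) * f (d ℕ.* m))
    ∑-∣ d K f = begin
      ∑ K (λ k → χ (d ∣? k) * f k)
        ≈⟨ ∑-cong K (λ k 1≤k k≤K → *-congʳ (split k 1≤k k≤K)) ⟩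
      ∑ K (λ k → ∑ K (λ m → χ (k ℕ.≟ d ℕ.* m)) * f k)
        ≈⟨ ∑-cong′ K (λ k → ∑-*ʳ K (f k) (λ m → χ (k ℕ.≟ d ℕ.* m))) ⟩
      ∑ K (λ k → ∑ K (λ m → χ (k ℕ.≟ d ℕ.* m) * f k))
        ≈⟨ ∑-swap K K (λ k m → χ (k ℕ.≟ d ℕ.* m) * f k) ⟩
      ∑ K (λ m → ∑ K (λ k → χ (k ℕ.≟ d ℕ.* m) * f k))
        ≈⟨ ∑-cong K (λ m 1≤m _ → collapse m 1≤m) ⟩
      ∑ K (λ m → χ (d ℕ.* m ℕ.≤? K) * f (d ℕ.* m)) ∎
      where
      split : ∀ k → 1 ≤ k → k ≤ K → χ (d ∣? k) ≈ ∑ K (λ m → χ (k ℕ.≟ d ℕ.* m))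
      split k 1≤k k≤K with d ∣? k
      ... | no d∤k = sym (∑-zero K (λ m _ _ → χ-no (k ℕ.≟ d ℕ.* m) (λ e → d∤k (divides m (≡.trans e (ℕ.*-comm d m))))))
      ... | yes (divides m₀ e) = begin
        1#
          ≈⟨ ∑-δ (λ _ → 1#) 1≤m₀ m₀≤K ⟨
        ∑ K (λ m → χ (m ℕ.≟ m₀) * 1#)
          ≈⟨ ∑-cong′ K (λ m → trans (*-identityʳ _) (χ-cong (m ℕ.≟ m₀) (k ℕ.≟ d ℕ.* m)
               (λ { ≡.refl → ≡.trans e (ℕ.*-comm m d) })
               (λ k≡dm → ℕ.*-cancelˡ-≡ m m₀ d (≡.trans (≡.sym k≡dm) (≡.trans e (ℕ.*-comm m₀ d)))))) ⟩
        ∑ K (λ m → χ (k ℕ.≟ d ℕ.* m)) ∎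
        where
        1≤m₀ : 1 ≤ m₀
        1≤m₀ = ℕ.n≢0⇒n>0 (λ { ≡.refl → contradiction (≡.subst (1 ≤_) e 1≤k) λ () })
        m₀≤K : m₀ ≤ K
        m₀≤K = ℕ.≤-trans (≡.subst (m₀ ≤_) (≡.sym e) (ℕ.m≤m*n m₀ d)) k≤K
      collapse : ∀ m → 1 ≤ m → ∑ K (λ k → χ (k ℕ.≟ d ℕ.* m) * f k) ≈ χ (d ℕ.* m ℕ.≤? K) * f (d ℕ.* m)
      collapse m 1≤m with d ℕ.* m ℕ.≤? K
      ... | yes dm≤K = trans (∑-δ f (ℕ.*-mono-≤ (ℕ.>-nonZero⁻¹ d) 1≤m) dm≤K) (sym (*-identityˡ _))
      ... | no  dm≰K = trans (∑-zero K (λ k _ k≤K → trans (*-congʳ (χ-no (k ℕ.≟ d ℕ.* m) (λ { ≡.refl → dm≰K k≤K }))) (zeroˡ _))) (sym (zeroˡ _))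

  module Σℕ = Sum ℕ.+-*-commutativeSemiring

open import Defs
open import Data.Nat.Base as ℕ using (ℕ; zero; suc; z≤n; s≤s; pred)
import Data.Nat.Properties as ℕ
open import Data.Nat.Coprimality using (Coprime; coprime?)
import Data.Integer.Base as ℤ
import Data.Integer.Properties as ℤ
open import Data.Product.Base using (∃-syntax; _×_; _,_; proj₁; proj₂)
open import Data.Sum.Base using (_⊎_; inj₁; inj₂)
open import Function.Base using (it)
open import Level using (0ℓ)
open import Relation.Nullary.Decidable using (Dec; yes; no; ¬?; _×-dec_; toWitness)
open import Relation.Nullary.Negation using (¬_; contradiction)
open import Relation.Unary using (Pred; Decidable)
open import Relation.Binary.PropositionalEquality using (_≡_; _≢_; refl; sym; trans; cong; cong₂; subst; subst₂; setoid; module ≡-Reasoning)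
open FiniteSum

-- Floor division on the natural numbers.

module Division where
  open import Data.Nat.Base using (_+_; _*_; _≤_; _<_; s≤s⁻¹)
  open import Data.Nat.Properties
  open import Data.Nat.DivMod using (_/_; _%_; m/n*n≤m; m≡m%n+[m/n]*n; m%n<n; m/n≤m; /-monoˡ-≤; n/1≡n)

  infixl 7 _÷_

  -- Made total, so that quotients by a summation index need no proof that the index is nonzero.
  _÷_ : ℕ → ℕ → ℕ
  n ÷ zero  = 0
  n ÷ suc m = n / suc m

  ÷-*-≤ : ∀ n m → n ÷ m * m ≤ n
  ÷-*-≤ n zero    = z≤n
  ÷-*-≤ n (suc m) = m/n*n≤m n (suc m)

  <-÷-suc : ∀ n {m} → 1 ≤ m → n < suc (n ÷ m) * m
  <-÷-suc n {suc m} _ = begin-strict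
    n ≡⟨ m≡m%n+[m/n]*n n (suc m) ⟩
    n % suc m + n / suc m * suc m <⟨ +-monoˡ-< (n / suc m * suc m) (m%n<n n (suc m)) ⟩
    suc m + n / suc m * suc m ∎
    where open ≤-Reasoning

  ≤÷⇒*≤ : ∀ {k n} m → k ≤ n ÷ m → k * m ≤ n
  ≤÷⇒*≤ {k} {n} m k≤ = ≤-trans (*-monoˡ-≤ m k≤) (÷-*-≤ n m)

  *≤⇒≤÷ : ∀ {k n m} → 1 ≤ m → k * m ≤ n → k ≤ n ÷ m
  *≤⇒≤÷ {k} {n} {m} 1≤m km≤n = s≤s⁻¹ (*-cancelʳ-< m k (suc (n ÷ m)) (≤-<-trans km≤n (<-÷-suc n 1≤m)))

  ÷-upper : ∀ {k n m} → n < suc k * m → n ÷ m ≤ k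
  ÷-upper {k} {n} {m} n< = s≤s⁻¹ (*-cancelʳ-< m (n ÷ m) (suc k) (≤-<-trans (÷-*-≤ n m) n<))

  ÷≤ : ∀ n m → n ÷ m ≤ n
  ÷≤ n zero    = z≤n
  ÷≤ n (suc m) = m/n≤m n (suc m)

  ÷-mono-≤ : ∀ {m n} k → m ≤ n → m ÷ k ≤ n ÷ k
  ÷-mono-≤ zero    m≤n = z≤n
  ÷-mono-≤ (suc k) m≤n = /-monoˡ-≤ (suc k) m≤n

  ÷-anti-≤ : ∀ n {k l} → 1 ≤ k → k ≤ l → n ÷ l ≤ n ÷ k
  ÷-anti-≤ n {k} {l} 1≤k k≤l = *≤⇒≤÷ 1≤k (≤-trans (*-monoʳ-≤ (n ÷ l) k≤l) (÷-*-≤ n l))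

  ÷-1 : ∀ n → n ÷ 1 ≡ n
  ÷-1 n = n/1≡n n

  -- A Farkas certificate: an inequality together with a semiring identity.
  ≤-from : ∀ {l r x y} k → l ≤ r → x + r + k ≡ y + l → x ≤ y
  ≤-from {l} {r} {x} {y} k l≤r e = +-cancelʳ-≤ l x y (begin
    x + l ≤⟨ +-monoʳ-≤ x l≤r ⟩
    x + r ≤⟨ m≤m+n (x + r) k ⟩
    x + r + k ≡⟨ e ⟩
    y + l ∎)
    where open ≤-Reasoning

open Division

-- Möbius inversion and the count of coprime pairs below a given slope.

module MoebiusInversion where
  open import Data.Nat.Base using (_≤_; _<_; NonZero)
  open import Data.Nat.Coprimality using (coprime⇒gcd≡1; gcd≡1⇒coprime)
  open import Data.Nat.Divisibility using (_∣_; _∣?_; divides; ∣⇒≤; ∣-trans; m∣m*n; n∣m*n)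
  open import Data.Nat.GCD using (gcd; gcd[m,n]∣m; gcd[m,n]∣n; gcd-greatest; gcd[m,n]≢0)
  open import Data.Nat.Primality using (Prime; euclidsLemma; prime⇒nonZero)
  open import Data.Nat.Primality.Factorisation using (PrimeFactorisation; factorise; factors; factorisationUnique; factorisationHasAllPrimeFactors)
  open import Data.Nat.ListAction using (product)
  open import Data.Integer.Base using (ℤ; +_; 0ℤ; 1ℤ; -1ℤ; _+_; _*_; -_; _^_)
  open import Data.List.Base using (List; []; _∷_; length)
  open import Data.List.Membership.Propositional using (_∈_)
  open import Data.List.Relation.Unary.All as All using (All; []; _∷_)
  open import Data.List.Relation.Unary.All.Properties using (¬Any⇒All¬)
  open import Data.List.Relation.Unary.Any using (here; there)
  open import Data.List.Relation.Unary.AllPairs using (_∷_)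
  open import Data.List.Relation.Unary.Unique.Propositional using (Unique)
  open import Data.List.Relation.Unary.Unique.DecPropositional ℕ._≟_ using (unique?)
  open import Data.List.Relation.Binary.Permutation.Propositional using (_↭_; ↭-sym; ↭⇒↭ₛ)
  open import Data.List.Relation.Binary.Permutation.Propositional.Properties using (↭-length)
  import Data.List.Relation.Binary.Permutation.Setoid.Properties as PermutationSetoid
  open import Algebra.Properties.CommutativeSemigroup ℤ.*-commutativeSemigroup using (xy∙z≈y∙xz)

  module Σℤ = Sum ℤ.+-*-commutativeSemiring
  open Σℤ

  μ₀ : ℕ → ℤ
  μ₀ zero    = 0ℤ
  μ₀ (suc n) = μ (suc n)

  M≡∑μ₀ : ∀ n → M n ≡ ∑ n μ₀
  M≡∑μ₀ zero    = refl
  M≡∑μ₀ (suc n) = cong (_+ μ (suc n)) (M≡∑μ₀ n)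

  -- Reading the Möbius value off a list frees it from the particular list that `factorise` returns,
  -- so that a factorisation of p n may be built by consing p.
  μ-list : List ℕ → ℤ
  μ-list l with unique? l
  ... | yes _ = -1ℤ ^ length l
  ... | no  _ = 0ℤ

  μ-list-unique : ∀ {l} → Unique l → μ-list l ≡ -1ℤ ^ length l
  μ-list-unique {l} u with unique? l
  ... | yes _ = refl
  ... | no ¬u = contradiction u ¬u

  μ-list-repeated : ∀ {l} → ¬ Unique l → μ-list l ≡ 0ℤ
  μ-list-repeated {l} ¬u with unique? l
  ... | yes u = contradiction u ¬u
  ... | no _  = refl

  Unique-resp-↭ : ∀ {l l′ : List ℕ} → l ↭ l′ → Unique l → Unique l′
  Unique-resp-↭ p = PermutationSetoid.Unique-resp-↭ (setoid ℕ) (↭⇒↭ₛ p)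

  μ-list-↭ : ∀ {l l′} → l ↭ l′ → μ-list l ≡ μ-list l′
  μ-list-↭ {l} {l′} p with unique? l
  ... | yes u = trans (cong (-1ℤ ^_) (↭-length p)) (sym (μ-list-unique (Unique-resp-↭ p u)))
  ... | no ¬u = sym (μ-list-repeated (λ u → ¬u (Unique-resp-↭ (↭-sym p) u)))

  μ-list-∷ : ∀ {p l} → All (p ≢_) l → μ-list (p ∷ l) ≡ - μ-list l
  μ-list-∷ {p} {l} p∉ = go (unique? l)
    where
    go : Dec (Unique l) → μ-list (p ∷ l) ≡ - μ-list l
    go (yes u) = trans (μ-list-unique (p∉ ∷ u)) (trans (ℤ.-1*i≡-i _) (cong -_ (sym (μ-list-unique u))))
    go (no ¬u) = trans (μ-list-repeated {p ∷ l} (λ { (_ ∷ u) → ¬u u })) (cong -_ (sym (μ-list-repeated ¬u)))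

  -- Two factorisations are permutations of each other, and both the length and the absence of
  -- repetitions are invariant under permutation.
  μ₀-factors : ∀ n .{{_ : NonZero n}} (f : PrimeFactorisation n) → μ₀ n ≡ μ-list (factors f)
  μ₀-factors (suc n) f = trans unfold (μ-list-↭ (factorisationUnique (factorise (suc n)) f))
    where
    unfold : μ (suc n) ≡ μ-list (factors (factorise (suc n)))
    unfold with unique? (factors (factorise (suc n)))
    ... | yes _ = refl
    ... | no  _ = refl

  consFactorisation : ∀ {p n} → Prime p → PrimeFactorisation n → PrimeFactorisation (p ℕ.* n)
  consFactorisation {p} pp f = record
    { factors         = p ∷ factors f
    ; isFactorisation = cong (p ℕ.*_) (PrimeFactorisation.isFactorisation f)
    ; factorsPrime    = pp ∷ PrimeFactorisation.factorsPrime f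
    }

  ∈⇒∣product : ∀ {p l} → p ∈ l → p ∣ product l
  ∈⇒∣product {p} {_ ∷ l} (here refl) = m∣m*n (product l)
  ∈⇒∣product {p} {q ∷ l} (there p∈l) = ∣-trans (∈⇒∣product p∈l) (n∣m*n q)

  module _ {p n} (pp : Prime p) .{{_ : NonZero n}} where
    private
      instance
        p≢0 = prime⇒nonZero pp
        pn≢0 = ℕ.m*n≢0 p n
      f = factorise n
      n≡∏ = PrimeFactorisation.isFactorisation f

    -- The prime p occurs twice in `p ∷ factors f`.
    μ₀-prime-∣ : p ∣ n → μ₀ (p ℕ.* n) ≡ 0ℤ
    μ₀-prime-∣ p∣n = trans (μ₀-factors (p ℕ.* n) (consFactorisation pp f)) (μ-list-repeated {p ∷ factors f} λ where
      (p∉ ∷ _) → All.lookup p∉ (factorisationHasAllPrimeFactors pp (subst (p ∣_) n≡∏ p∣n) (PrimeFactorisation.factorsPrime f)) refl)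

    μ₀-prime-∤ : ¬ p ∣ n → μ₀ (p ℕ.* n) ≡ - μ₀ n
    μ₀-prime-∤ p∤n = trans (μ₀-factors (p ℕ.* n) (consFactorisation pp f)) (trans (μ-list-∷ p∉) (cong -_ (sym (μ₀-factors n f))))
      where
      p∉ : All (p ≢_) (factors f)
      p∉ = ¬Any⇒All¬ _ (λ p∈ → p∤n (subst (p ∣_) (sym n≡∏) (∈⇒∣product p∈)))

  primeDivisor : ∀ n → 2 ≤ n → ∃[ p ] Prime p × p ∣ n
  primeDivisor n@(suc _) 2≤n = go (factors f) n≡∏ (PrimeFactorisation.factorsPrime f)
    where
    f = factorise n
    n≡∏ = PrimeFactorisation.isFactorisation f
    go : ∀ l → n ≡ product l → All Prime l → ∃[ p ] Prime p × p ∣ n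
    go []      n≡1 []       = contradiction (subst (2 ≤_) n≡1 2≤n) (λ { (s≤s ()) })
    go (p ∷ l) n≡  (pp ∷ _) = p , pp , subst (p ∣_) (sym n≡) (m∣m*n (product l))

  χ-complement : ∀ {P : Set} (d : Dec P) → χ d + χ (¬? d) ≡ 1ℤ
  χ-complement (yes _) = refl
  χ-complement (no  _) = refl

  -- The divisors divisible by p cancel against those that are not, via d ↦ p d.
  ∑μ₀-∣-2≤ : ∀ n → 2 ≤ n → ∑ n (λ d → χ (d ∣? n) * μ₀ d) ≡ 0ℤ
  ∑μ₀-∣-2≤ n 2≤n with primeDivisor n 2≤n
  ... | p , pp , divides n′ n≡n′p = begin
    ∑ n h ≡⟨ ∑-cong′ n split ⟩
    ∑ n (λ d → χ (p ∣? d) * h d + χ (¬? (p ∣? d)) * h d) ≡⟨ ∑-+ n _ _ ⟩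
    ∑ n (λ d → χ (p ∣? d) * h d) + rest ≡⟨ cong (_+ rest) (trans (∑-∣ p n h) (trans (∑-cong n pair) (sym (∑-*ˡ n -1ℤ _)))) ⟩
    -1ℤ * rest + rest ≡⟨ cong (_+ rest) (ℤ.-1*i≡-i rest) ⟩
    - rest + rest ≡⟨ ℤ.+-inverseˡ rest ⟩
    0ℤ ∎
    where
    open ≡-Reasoning
    instance
      p≢0 = prime⇒nonZero pp
      n≢0 : NonZero n
      n≢0 = ℕ.>-nonZero (ℕ.≤-trans (s≤s z≤n) 2≤n)
    h : ℕ → ℤ
    h d = χ (d ∣? n) * μ₀ d
    rest : ℤ
    rest = ∑ n (λ d → χ (¬? (p ∣? d)) * h d)
    split : ∀ d → h d ≡ χ (p ∣? d) * h d + χ (¬? (p ∣? d)) * h d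
    split d = trans (sym (ℤ.*-identityˡ (h d))) (trans (cong (_* h d) (sym (χ-complement (p ∣? d)))) (ℤ.*-distribʳ-+ (h d) (χ (p ∣? d)) (χ (¬? (p ∣? d)))))
    -- Write n = k m. As p divides n but not m, Euclid's lemma puts p into k.
    pm∣n : ∀ m → ¬ p ∣ m → m ∣ n → p ℕ.* m ∣ n
    pm∣n m p∤m (divides k n≡km) with euclidsLemma k m pp (subst (p ∣_) n≡km (divides n′ n≡n′p))
    ... | inj₂ p∣m = contradiction p∣m p∤m
    ... | inj₁ (divides j k≡jp) = divides j (trans n≡km (trans (cong (ℕ._* m) k≡jp) (ℕ.*-assoc j p m)))
    pair : ∀ m → 1 ≤ m → m ≤ n → χ (p ℕ.* m ℕ.≤? n) * (χ (p ℕ.* m ∣? n) * μ₀ (p ℕ.* m)) ≡ -1ℤ * (χ (¬? (p ∣? m)) * h m)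
    pair m 1≤m _ with p ∣? m
    ... | yes p∣m = trans (cong (λ z → χ (p ℕ.* m ℕ.≤? n) * (χ (p ℕ.* m ∣? n) * z)) (μ₀-prime-∣ pp {{ℕ.>-nonZero 1≤m}} p∣m))
                    (trans (cong (χ (p ℕ.* m ℕ.≤? n) *_) (ℤ.*-zeroʳ (χ (p ℕ.* m ∣? n)))) (ℤ.*-zeroʳ (χ (p ℕ.* m ℕ.≤? n))))
    ... | no p∤m with m ∣? n
    ...   | yes m∣n = trans (cong₂ _*_ (χ-yes (p ℕ.* m ℕ.≤? n) (∣⇒≤ (pm∣n m p∤m m∣n)))
                        (cong₂ _*_ (χ-yes (p ℕ.* m ∣? n) (pm∣n m p∤m m∣n)) (μ₀-prime-∤ pp {{ℕ.>-nonZero 1≤m}} p∤m)))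
                      (trans (ℤ.*-identityˡ _) (trans (ℤ.*-identityˡ _) (sym (trans (ℤ.-1*i≡-i _) (cong -_ (trans (ℤ.*-identityˡ _) (ℤ.*-identityˡ _)))))))
    ...   | no m∤n = trans (cong (λ z → χ (p ℕ.* m ℕ.≤? n) * (z * μ₀ (p ℕ.* m))) (χ-no (p ℕ.* m ∣? n) (λ pm∣n → m∤n (∣-trans (n∣m*n p) pm∣n))))
                     (ℤ.*-zeroʳ (χ (p ℕ.* m ℕ.≤? n)))

  -- The range K does not depend on n, so that divisor sums of different n can be exchanged with an
  -- outer sum; the terms with d > n vanish.
  ∑μ₀-∣ : ∀ n K → 1 ≤ n → n ≤ K → ∑ K (λ d → χ (d ∣? n) * μ₀ d) ≡ χ (n ℕ.≟ 1)
  ∑μ₀-∣ n K 1≤n n≤K = trans (trans (∑-cong K drop) (∑-≤ (λ d → χ (d ∣? n) * μ₀ d) n≤K)) (go n 1≤n)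
    where
    instance
      n≢0 : NonZero n
      n≢0 = ℕ.>-nonZero 1≤n
    drop : ∀ d → 1 ≤ d → d ≤ K → χ (d ∣? n) * μ₀ d ≡ χ (d ℕ.≤? n) * (χ (d ∣? n) * μ₀ d)
    drop d _ _ with d ∣? n
    ... | yes d∣n = trans (sym (ℤ.*-identityˡ _)) (cong (_* (1ℤ * μ₀ d)) (sym (χ-yes (d ℕ.≤? n) (∣⇒≤ d∣n))))
    ... | no _    = sym (ℤ.*-zeroʳ (χ (d ℕ.≤? n)))
    go : ∀ n → 1 ≤ n → ∑ n (λ d → χ (d ∣? n) * μ₀ d) ≡ χ (n ℕ.≟ 1)
    go 1 _ = refl
    go n@(suc (suc _)) _ = ∑μ₀-∣-2≤ n (s≤s (s≤s z≤n))

  ∑-*≤ : ∀ {m} T (g : ℕ → ℤ) → 1 ≤ m → ∑ T (λ d → χ (d ℕ.* m ℕ.≤? T) * g d) ≡ ∑ (T ÷ m) g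
  ∑-*≤ {m} T g 1≤m = trans
    (∑-cong′ T (λ d → cong (_* g d) (χ-cong (d ℕ.* m ℕ.≤? T) (d ℕ.≤? T ÷ m) (*≤⇒≤÷ 1≤m) (≤÷⇒*≤ m))))
    (∑-≤ g (÷≤ T m))

  -- Two arrangements of one sum over the pairs with d m ≤ T. It is read from left to right to
  -- produce M(T/m), and from right to left in `tail-bound` to open M(T/m) again.
  ∑-*≤-∑ : ∀ T (f g : ℕ → ℤ) →
           ∑ T (λ d → g d * ∑ T (λ m → χ (d ℕ.* m ℕ.≤? T) * f m)) ≡ ∑ T (λ m → f m * ∑ (T ÷ m) g)
  ∑-*≤-∑ T f g = begin
    ∑ T (λ d → g d * ∑ T (λ m → χ (d ℕ.* m ℕ.≤? T) * f m))
      ≡⟨ ∑-cong′ T (λ d → ∑-*ˡ T (g d) _) ⟩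
    ∑ T (λ d → ∑ T (λ m → g d * (χ (d ℕ.* m ℕ.≤? T) * f m)))
      ≡⟨ ∑-swap T T _ ⟩
    ∑ T (λ m → ∑ T (λ d → g d * (χ (d ℕ.* m ℕ.≤? T) * f m)))
      ≡⟨ ∑-cong T (λ m 1≤m _ → trans
           (∑-cong′ T (λ d → reorder (g d) (χ (d ℕ.* m ℕ.≤? T)) (f m)))
           (trans (sym (∑-*ˡ T (f m) (λ d → χ (d ℕ.* m ℕ.≤? T) * g d))) (cong (f m *_) (∑-*≤ T g 1≤m)))) ⟩
    ∑ T (λ m → f m * ∑ (T ÷ m) g) ∎
    where
    open ≡-Reasoning
    reorder : ∀ x y z → x * (y * z) ≡ z * (y * x)
    reorder x y z = trans (ℤ.*-comm x (y * z)) (trans (cong (_* x) (ℤ.*-comm y z)) (ℤ.*-assoc z y x))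

  -- Grouping the pairs d m ≤ T by k = d m gives the sum over k of Σ_{d ∣ k} μ(d), where only k = 1
  -- survives.
  ∑-M : ∀ T → 1 ≤ T → ∑ T (λ m → M (T ÷ m)) ≡ 1ℤ
  ∑-M T 1≤T = begin
    ∑ T (λ m → M (T ÷ m))
      ≡⟨ ∑-cong′ T (λ m → trans (M≡∑μ₀ (T ÷ m)) (sym (ℤ.*-identityˡ _))) ⟩
    ∑ T (λ m → 1ℤ * ∑ (T ÷ m) μ₀)
      ≡⟨ ∑-*≤-∑ T (λ _ → 1ℤ) μ₀ ⟨
    ∑ T (λ d → μ₀ d * ∑ T (λ m → χ (d ℕ.* m ℕ.≤? T) * 1ℤ))
      ≡⟨ ∑-cong T (λ d 1≤d _ → cong (μ₀ d *_) (sym (∑-∣ d {{ℕ.>-nonZero 1≤d}} T (λ _ → 1ℤ)))) ⟩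
    ∑ T (λ d → μ₀ d * ∑ T (λ k → χ (d ∣? k) * 1ℤ))
      ≡⟨ ∑-cong′ T (λ d → trans (∑-*ˡ T (μ₀ d) (λ k → χ (d ∣? k) * 1ℤ)) (∑-cong′ T (λ k → trans (cong (μ₀ d *_) (ℤ.*-identityʳ (χ (d ∣? k)))) (ℤ.*-comm (μ₀ d) (χ (d ∣? k)))))) ⟩
    ∑ T (λ d → ∑ T (λ k → χ (d ∣? k) * μ₀ d))
      ≡⟨ ∑-swap T T _ ⟩
    ∑ T (λ k → ∑ T (λ d → χ (d ∣? k) * μ₀ d))
      ≡⟨ ∑-cong T (λ k 1≤k k≤T → trans (∑μ₀-∣ k T 1≤k k≤T) (sym (ℤ.*-identityʳ _))) ⟩
    ∑ T (λ k → χ (k ℕ.≟ 1) * 1ℤ)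
      ≡⟨ ∑-δ (λ _ → 1ℤ) ℕ.≤-refl 1≤T ⟩
    1ℤ ∎
    where open ≡-Reasoning

  χ-coprime : ∀ c e T → 1 ≤ c → c ≤ T → χ (coprime? c e) ≡ ∑ T (λ d → χ (d ∣? c) * χ (d ∣? e) * μ₀ d)
  χ-coprime c e T 1≤c c≤T = begin
    χ (coprime? c e) ≡⟨ χ-cong (coprime? c e) (gcd c e ℕ.≟ 1) coprime⇒gcd≡1 gcd≡1⇒coprime ⟩
    χ (gcd c e ℕ.≟ 1) ≡⟨ ∑μ₀-∣ (gcd c e) T 1≤gcd gcd≤T ⟨
    ∑ T (λ d → χ (d ∣? gcd c e) * μ₀ d) ≡⟨ ∑-cong′ T (λ d → cong (_* μ₀ d) (sym (trans (χ-× (d ∣? c) (d ∣? e))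
      (χ-cong (d ∣? c ×-dec d ∣? e) (d ∣? gcd c e) (λ (p , q) → gcd-greatest p q)
        (λ p → ∣-trans p (gcd[m,n]∣m c e) , ∣-trans p (gcd[m,n]∣n c e)))))) ⟩
    ∑ T (λ d → χ (d ∣? c) * χ (d ∣? e) * μ₀ d) ∎
    where
    open ≡-Reasoning
    instance
      c≢0 : NonZero c
      c≢0 = ℕ.>-nonZero 1≤c
    1≤gcd : 1 ≤ gcd c e
    1≤gcd = ℕ.n≢0⇒n>0 (gcd[m,n]≢0 c e (inj₁ (ℕ.≢-nonZero⁻¹ c)))
    gcd≤T : gcd c e ≤ T
    gcd≤T = ℕ.≤-trans (∣⇒≤ (gcd[m,n]∣m c e)) c≤T

  -- The number of fractions c/e in lowest terms with denominator e ≤ T and 0 < c/e ≤ A/B ≤ 1.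
  coprimeCount : ℕ → ℕ → ℕ → ℤ
  coprimeCount A B T = ∑ T (λ e → ∑ T (λ c → χ (coprime? c e) * χ (c ℕ.* B ℕ.≤? A ℕ.* e)))

  module _ (A B T : ℕ) (1≤B : 1 ≤ B) (A≤B : A ≤ B) where
    open ≡-Reasoning

    private
      w : ℕ → ℕ → ℤ
      w c e = χ (c ℕ.* B ℕ.≤? A ℕ.* e)

      f : ℕ → ℤ
      f m = + (A ℕ.* m ÷ B)

      ∑1 : ∀ n → ∑ n (λ _ → 1ℤ) ≡ + n
      ∑1 zero    = refl
      ∑1 (suc n) = trans (cong (_+ 1ℤ) (∑1 n)) (cong +_ (ℕ.+-comm n 1))

      count : ∀ m → m ≤ T → ∑ T (λ n → w n m) ≡ f m
      count m m≤T = begin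
        ∑ T (λ n → w n m)
          ≡⟨ ∑-cong′ T (λ n → trans (χ-cong (n ℕ.* B ℕ.≤? A ℕ.* m) (n ℕ.≤? A ℕ.* m ÷ B) (*≤⇒≤÷ 1≤B) (≤÷⇒*≤ B)) (sym (ℤ.*-identityʳ _))) ⟩
        ∑ T (λ n → χ (n ℕ.≤? A ℕ.* m ÷ B) * 1ℤ)
          ≡⟨ ∑-≤ (λ _ → 1ℤ) (ℕ.≤-trans (÷-upper bound) m≤T) ⟩
        ∑ (A ℕ.* m ÷ B) (λ _ → 1ℤ)
          ≡⟨ ∑1 (A ℕ.* m ÷ B) ⟩
        f m ∎
        where
        bound : A ℕ.* m < suc m ℕ.* B
        bound = ℕ.≤-<-trans (ℕ.≤-trans (ℕ.*-monoˡ-≤ m A≤B) (ℕ.≤-reflexive (ℕ.*-comm B m))) (ℕ.*-monoˡ-< B {{ℕ.>-nonZero 1≤B}} (ℕ.n<1+n m))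

      -- With c = d n the factor d cancels from the slope condition. The cut-off d n ≤ T is
      -- automatic: A ≤ B forces n ≤ m, and d m ≤ T.
      dilate : ∀ d → 1 ≤ d → ∀ m → d ℕ.* m ≤ T → ∑ T (λ c → χ (d ∣? c) * w c (d ℕ.* m)) ≡ f m
      dilate d 1≤d m dm≤T = begin
        ∑ T (λ c → χ (d ∣? c) * w c (d ℕ.* m))
          ≡⟨ ∑-∣ d T (λ c → w c (d ℕ.* m)) ⟩
        ∑ T (λ n → χ (d ℕ.* n ℕ.≤? T) * w (d ℕ.* n) (d ℕ.* m))
          ≡⟨ ∑-cong′ T (λ n → trans (χ-× (d ℕ.* n ℕ.≤? T) (d ℕ.* n ℕ.* B ℕ.≤? A ℕ.* (d ℕ.* m)))
               (χ-cong (d ℕ.* n ℕ.≤? T ×-dec d ℕ.* n ℕ.* B ℕ.≤? A ℕ.* (d ℕ.* m)) (n ℕ.* B ℕ.≤? A ℕ.* m)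
                 (λ (_ , h) → ℕ.*-cancelˡ-≤ d (subst₂ _≤_ (ℕ.*-assoc d n B) (swap m) h))
                 (λ h → ℕ.≤-trans (ℕ.*-monoʳ-≤ d (n≤m n h)) dm≤T , subst₂ _≤_ (sym (ℕ.*-assoc d n B)) (sym (swap m)) (ℕ.*-monoʳ-≤ d h)))) ⟩
        ∑ T (λ n → w n m)
          ≡⟨ count m (ℕ.≤-trans (ℕ.m≤n*m m d) dm≤T) ⟩
        f m ∎
        where
        instance
          d≢0 : NonZero d
          d≢0 = ℕ.>-nonZero 1≤d
        swap : ∀ m → A ℕ.* (d ℕ.* m) ≡ d ℕ.* (A ℕ.* m)
        swap m = trans (sym (ℕ.*-assoc A d m)) (trans (cong (ℕ._* m) (ℕ.*-comm A d)) (ℕ.*-assoc d A m))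
        n≤m : ∀ n → n ℕ.* B ≤ A ℕ.* m → n ≤ m
        n≤m n h = ℕ.*-cancelʳ-≤ n m B {{ℕ.>-nonZero 1≤B}} (ℕ.≤-trans h (ℕ.≤-trans (ℕ.*-monoˡ-≤ m A≤B) (ℕ.≤-reflexive (ℕ.*-comm B m))))

    -- Coprimality is replaced by the sum of μ(d) over common divisors d. With e = d m the count of
    -- the c = d n is ⌊A m / B⌋, independent of d, so for fixed m the values μ(d) with d ≤ T/m add
    -- up to M(T/m).
    coprimeCount≡∑M : coprimeCount A B T ≡ ∑ T (λ m → + (A ℕ.* m ÷ B) * M (T ÷ m))
    coprimeCount≡∑M = begin
      ∑ T (λ e → ∑ T (λ c → χ (coprime? c e) * w c e))
        ≡⟨ ∑-cong′ T (λ e → ∑-cong T (λ c 1≤c c≤T → trans (cong (_* w c e) (χ-coprime c e T 1≤c c≤T)) (∑-*ʳ T (w c e) _))) ⟩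
      ∑ T (λ e → ∑ T (λ c → ∑ T (λ d → χ (d ∣? c) * χ (d ∣? e) * μ₀ d * w c e)))
        ≡⟨ ∑-cong′ T (λ e → ∑-swap T T _) ⟩
      ∑ T (λ e → ∑ T (λ d → ∑ T (λ c → χ (d ∣? c) * χ (d ∣? e) * μ₀ d * w c e)))
        ≡⟨ ∑-swap T T _ ⟩
      ∑ T (λ d → ∑ T (λ e → ∑ T (λ c → χ (d ∣? c) * χ (d ∣? e) * μ₀ d * w c e)))
        ≡⟨ ∑-cong′ T (λ d → trans (∑-cong′ T (λ e → trans (∑-cong′ T (λ c → regroup (χ (d ∣? c)) (χ (d ∣? e)) (μ₀ d) (w c e)))
             (trans (sym (∑-*ˡ T (μ₀ d) _)) (cong (μ₀ d *_) (sym (∑-*ˡ T (χ (d ∣? e)) _)))))) (sym (∑-*ˡ T (μ₀ d) _))) ⟩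
      ∑ T (λ d → μ₀ d * ∑ T (λ e → χ (d ∣? e) * ∑ T (λ c → χ (d ∣? c) * w c e)))
        ≡⟨ ∑-cong T (λ d 1≤d _ → cong (μ₀ d *_) (trans (∑-∣ d {{ℕ.>-nonZero 1≤d}} T _)
             (∑-cong′ T (λ m → χ-*-cong (d ℕ.* m ℕ.≤? T) (dilate d 1≤d m))))) ⟩
      ∑ T (λ d → μ₀ d * ∑ T (λ m → χ (d ℕ.* m ℕ.≤? T) * f m))
        ≡⟨ ∑-*≤-∑ T f μ₀ ⟩
      ∑ T (λ m → f m * ∑ (T ÷ m) μ₀)
        ≡⟨ ∑-cong′ T (λ m → cong (f m *_) (sym (M≡∑μ₀ (T ÷ m)))) ⟩
      ∑ T (λ m → f m * M (T ÷ m)) ∎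
      where
      regroup : ∀ x y z v → x * y * z * v ≡ z * (y * (x * v))
      regroup x y z v = trans (cong (_* v) (ℤ.*-comm (x * y) z)) (trans (ℤ.*-assoc z (x * y) v) (cong (z *_) (xy∙z≈y∙xz x y v)))

-- Sums of fractional parts along a rational approximation.

module ResidueSums where
  open import Data.Nat.Base hiding (ℕ; zero; suc; z≤n; s≤s; pred; _/_)
  open import Data.Nat.Properties
  open import Data.Nat.Coprimality using (coprime-divisor; coprime-/gcd; 1-coprimeTo) renaming (sym to coprime-sym)
  open import Data.Nat.Divisibility using (_∣_; _∣?_; divides; ∣⇒≤; ∣m+n∣m⇒∣n)
  open import Data.Nat.DivMod using (_/_; m/n*n≡m)
  open import Data.Nat.GCD using (gcd; gcd[m,n]∣m; gcd[m,n]∣n; gcd[m,n]≢0)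
  open import Data.Nat.Tactic.RingSolver using (solve-∀)
  open import Data.Fin.Base using (toℕ; fromℕ<)
  open import Data.Fin.Properties using (pigeonhole; toℕ<n; toℕ-fromℕ<)
  open Σℕ

  ∑-mono : ∀ n {f g} → (∀ i → 1 ≤ i → i ≤ n → f i ≤ g i) → ∑ n f ≤ ∑ n g
  ∑-mono zero    h = z≤n
  ∑-mono (suc n) h = +-mono-≤ (∑-mono n (λ i 1≤i i≤n → h i 1≤i (m≤n⇒m≤1+n i≤n))) (h (suc n) (s≤s z≤n) ≤-refl)

  ∑-≤-const : ∀ n {f} c → (∀ i → 1 ≤ i → i ≤ n → f i ≤ c) → ∑ n f ≤ n * c
  ∑-≤-const zero    c h = z≤n
  ∑-≤-const (suc n) c h = ≤-trans (+-mono-≤ (∑-≤-const n c (λ i 1≤i i≤n → h i 1≤i (m≤n⇒m≤1+n i≤n))) (h (suc n) (s≤s z≤n) ≤-refl)) (≤-reflexive (+-comm (n * c) c))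

  χ≤1 : ∀ {P : Set} (d : Dec P) → χ d ≤ 1
  χ≤1 (yes _) = ≤-refl
  χ≤1 (no  _) = z≤n

  ∑-window : ∀ n w {f} → (∀ i → f i ≤ 1) → (∀ i → 1 ≤ i → i + w ≤ n → f i ≡ 0) → ∑ n f ≤ w
  ∑-window n w {f} f≤1 f≡0 = begin
    ∑ n f ≡⟨ cong (λ z → ∑ z f) (m+[n∸m]≡n (m∸n≤m n w)) ⟨
    ∑ (n ∸ w + (n ∸ (n ∸ w))) f ≡⟨ ∑-append (n ∸ w) (n ∸ (n ∸ w)) f ⟩
    ∑ (n ∸ w) f + ∑ (n ∸ (n ∸ w)) (λ i → f (n ∸ w + i)) ≡⟨ cong (_+ ∑ (n ∸ (n ∸ w)) (λ i → f (n ∸ w + i))) (∑-zero (n ∸ w) (λ i 1≤i i≤n∸w → f≡0 i 1≤i (small i 1≤i i≤n∸w))) ⟩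
    ∑ (n ∸ (n ∸ w)) (λ i → f (n ∸ w + i)) ≤⟨ ∑-≤-const (n ∸ (n ∸ w)) 1 (λ i _ _ → f≤1 _) ⟩
    (n ∸ (n ∸ w)) * 1 ≡⟨ *-identityʳ _ ⟩
    n ∸ (n ∸ w) ≤⟨ m≤n+o⇒m∸n≤o n (n ∸ w) n≤n∸w+w ⟩
    w ∎
    where
    open ≤-Reasoning
    n≤n∸w+w : n ≤ n ∸ w + w
    n≤n∸w+w = ≤-trans (m≤n+m∸n n w) (≤-reflexive (+-comm w (n ∸ w)))
    small : ∀ i → 1 ≤ i → i ≤ n ∸ w → i + w ≤ n
    small i 1≤i i≤ with ≤-total w n
    ... | inj₁ w≤n = m≤o∸n⇒m+n≤o i w≤n i≤
    ... | inj₂ n≤w = contradiction (≤-trans 1≤i (≤-trans i≤ (≤-reflexive (m≤n⇒m∸n≡0 n≤w)))) λ ()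

  -- If the last index is a hit, all earlier hits lie among the w indices before it. Used with w = 0
  -- for the uniqueness of a residue and with a positive width to count numerators near p/q.
  ∑-χ-spread : ∀ {P : ℕ → Set} (P? : Decidable P) n w →
               (∀ i j → 1 ≤ i → i ≤ j → j ≤ n → P i → P j → j ≤ i + w) →
               ∑ n (λ i → χ (P? i)) ≤ suc w
  ∑-χ-spread P? zero    w h = z≤n
  ∑-χ-spread P? (suc n) w h with P? (suc n)
  ... | no _  = subst (_≤ suc w) (sym (+-identityʳ _)) (∑-χ-spread P? n w (λ i j 1≤i i≤j j≤n → h i j 1≤i i≤j (m≤n⇒m≤1+n j≤n)))
  ... | yes p = subst (_≤ suc w) (+-comm 1 _) (s≤s (∑-window n w (λ i → χ≤1 (P? i))
      (λ i 1≤i i+w≤n → χ-no (P? i) (λ pi → <⇒≱ (s≤s i+w≤n) (h i (suc n) 1≤i (m≤n⇒m≤1+n (≤-trans (m≤m+n i w) i+w≤n)) ≤-refl pi p)))))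

  2∑id : ∀ n → 2 * ∑ n (λ i → i) ≡ n * suc n
  2∑id zero    = refl
  2∑id (suc n) = trans (*-distribˡ-+ 2 (∑ n (λ i → i)) (suc n)) (trans (cong (_+ 2 * suc n) (2∑id n)) (lemma n))
    where
    lemma : ∀ n → n * suc n + 2 * suc n ≡ suc n * suc (suc n)
    lemma = solve-∀

  suc-÷ : ∀ n {q} → 1 ≤ q → suc n ÷ q ≤ n ÷ q + χ (q ∣? suc n)
  suc-÷ n {q} 1≤q with q ∣? suc n
  ... | yes _ = ÷-upper (begin-strict
    suc n ≤⟨ <-÷-suc n 1≤q ⟩
    suc (n ÷ q) * q <⟨ *-monoˡ-< q {{>-nonZero 1≤q}} (n<1+n (suc (n ÷ q))) ⟩
    suc (suc (n ÷ q)) * q ≡⟨ cong (λ z → suc z * q) (+-comm 1 (n ÷ q)) ⟩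
    suc (n ÷ q + 1) * q ∎)
    where open ≤-Reasoning
  ... | no q∤ = ÷-upper (subst (λ z → suc n < suc z * q) (sym (+-identityʳ (n ÷ q)))
    (≤∧≢⇒< (<-÷-suc n 1≤q) (λ e → q∤ (divides (suc (n ÷ q)) e))))

  +q-÷ : ∀ n {q} → 1 ≤ q → (q + n) ÷ q ≡ suc (n ÷ q)
  +q-÷ n {q} 1≤q = ≤-antisym
    (÷-upper {suc (n ÷ q)} {q + n} {q} (+-monoʳ-< q (<-÷-suc n 1≤q)))
    (*≤⇒≤÷ 1≤q (+-monoʳ-≤ q (÷-*-≤ n q)))

  ∑-const : ∀ n c → ∑ n (λ _ → c) ≡ n * c
  ∑-const zero    c = refl
  ∑-const (suc n) c = trans (cong (_+ c) (∑-const n c)) (+-comm (n * c) c)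

  -- Hermite's identity, with g running over 1, ..., q instead of 0, ..., q - 1. Passing from n to n
  -- + 1 drops the first floor of the window and appends one that is larger by exactly 1.
  hermite : ∀ q n → 1 ≤ q → ∑ q (λ g → (g + n) ÷ q) ≡ suc n
  hermite (suc q) zero 1≤q = cong₂ _+_
    (∑-zero q (λ g _ g≤q → n≤0⇒n≡0 (÷-upper {0} (subst₂ _<_ (sym (+-identityʳ g)) (sym (+-identityʳ (suc q))) (s≤s g≤q)))))
    (+q-÷ 0 1≤q)
  hermite q@(suc q-1) (suc n) 1≤q = +-cancelˡ-≡ ((1 + n) ÷ q) _ _ (begin
    (1 + n) ÷ q + ∑ q (λ g → (g + suc n) ÷ q) ≡⟨ cong ((1 + n) ÷ q +_) (∑-cong′ q (λ g → cong (_÷ q) (+-suc g n))) ⟩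
    (1 + n) ÷ q + ∑ q (λ g → (suc g + n) ÷ q) ≡⟨ ∑-shift q (λ g → (g + n) ÷ q) ⟨
    ∑ q (λ g → (g + n) ÷ q) + (suc q + n) ÷ q ≡⟨ cong₂ _+_ (hermite q n 1≤q) (trans (cong (_÷ q) (sym (+-suc q n))) (+q-÷ (suc n) 1≤q)) ⟩
    suc n + suc ((1 + n) ÷ q) ≡⟨ +-suc (suc n) _ ⟩
    suc (suc n + (1 + n) ÷ q) ≡⟨ cong suc (+-comm (suc n) ((1 + n) ÷ q)) ⟩
    suc ((1 + n) ÷ q + suc n) ≡⟨ +-suc _ _ ⟨
    (1 + n) ÷ q + suc (suc n) ∎)
    where open ≡-Reasoning

  module FloorSum (p q : ℕ) (1≤q : 1 ≤ q) (p⊥q : Coprime p q) where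
    open ≤-Reasoning

    S : ℕ → ℕ
    S g = ∑ q (λ j → (g + j * p) ÷ q)

    -- The j-th floor increases only if q divides g + 1 + j p, and since p is invertible modulo q
    -- this happens for at most one j among 1, ..., q.
    S-suc : ∀ g → S (suc g) ≤ S g + 1
    S-suc g = begin
      S (suc g)
        ≤⟨ ∑-mono q (λ j _ _ → suc-÷ (g + j * p) 1≤q) ⟩
      ∑ q (λ j → (g + j * p) ÷ q + χ (q ∣? suc (g + j * p)))
        ≡⟨ ∑-+ q _ _ ⟩
      S g + ∑ q (λ j → χ (q ∣? suc (g + j * p)))
        ≤⟨ +-monoʳ-≤ (S g) (∑-χ-spread (λ j → q ∣? suc (g + j * p)) q 0 unique) ⟩
      S g + 1 ∎
      where
      unique : ∀ i j → 1 ≤ i → i ≤ j → j ≤ q → q ∣ suc (g + i * p) → q ∣ suc (g + j * p) → j ≤ i + 0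
      unique i j 1≤i i≤j j≤q q∣i q∣j with j ∸ i in eq
      ... | zero  = subst (j ≤_) (sym (+-identityʳ i)) (m∸n≡0⇒m≤n eq)
      ... | suc k = contradiction (≤-trans k<q (∣⇒≤ q∣k)) (<-irrefl refl)
        where
        j≡ : j ≡ i + suc k
        j≡ = trans (sym (m+[n∸m]≡n i≤j)) (cong (i +_) eq)
        expand : ∀ g i p k → suc (g + (i + k) * p) ≡ suc (g + i * p) + p * k
        expand = solve-∀
        q∣k : q ∣ suc k
        q∣k = coprime-divisor (coprime-sym p⊥q) (∣m+n∣m⇒∣n (subst (q ∣_) (trans (cong (λ z → suc (g + z * p)) j≡) (expand g i p (suc k))) q∣j) q∣i)
        k<q : suc (suc k) ≤ q
        k<q = ≤-trans (≤-trans (+-monoˡ-≤ (suc k) 1≤i) (≤-reflexive (sym j≡))) j≤q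

    S-+ : ∀ g k → S (g + k) ≤ S g + k
    S-+ g zero    = ≤-reflexive (trans (cong S (+-identityʳ g)) (sym (+-identityʳ (S g))))
    S-+ g (suc k) = begin
      S (g + suc k) ≡⟨ cong S (+-suc g k) ⟩
      S (suc (g + k)) ≤⟨ S-suc (g + k) ⟩
      S (g + k) + 1 ≤⟨ +-monoˡ-≤ 1 (S-+ g k) ⟩
      S g + k + 1 ≡⟨ trans (+-assoc (S g) k 1) (cong (S g +_) (+-comm k 1)) ⟩
      S g + suc k ∎

    S-period : ∀ t → S (t * q) ≡ S 0 + t * q
    S-period zero    = sym (+-identityʳ (S 0))
    S-period (suc t) = trans
      (∑-cong′ q (λ j → trans (cong (_÷ q) (+-assoc q (t * q) (j * p))) (trans (+q-÷ (t * q + j * p) 1≤q) (+-comm 1 _))))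
      (trans (∑-+ q _ _) (trans (cong₂ _+_ (S-period t) (trans (∑-const q 1) (*-identityʳ q)))
        (trans (+-assoc (S 0) (t * q) q) (cong (S 0 +_) (+-comm (t * q) q)))))

    -- Growth by at most 1 in each step, together with growth by exactly g q over the first g q
    -- steps, leaves no slack in any step.
    S-linear : ∀ g → S g ≡ S 0 + g
    S-linear g = ≤-antisym (S-+ 0 g) (+-cancelʳ-≤ k _ _ (begin
      S 0 + g + k ≡⟨ +-assoc (S 0) g k ⟩
      S 0 + (g + k) ≡⟨ cong (S 0 +_) g+k ⟩
      S 0 + g * q ≡⟨ S-period g ⟨
      S (g * q) ≡⟨ cong S g+k ⟨
      S (g + k) ≤⟨ S-+ g k ⟩
      S g + k ∎))
      where
      k = g * q ∸ g
      g+k : g + k ≡ g * q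
      g+k = m+[n∸m]≡n (m≤m*n g q {{>-nonZero 1≤q}})

    -- Sum `S-linear` over g = 1, ..., q. On the left the order of summation is exchanged, and
    -- Hermite's identity evaluates the inner sum over g.
    2S₀ : 2 * S 0 + q ≡ p * suc q + 1
    2S₀ = *-cancelʳ-≡ _ _ q {{>-nonZero 1≤q}} (+-cancelʳ-≡ q _ _ (Eq.begin
      (2 * S 0 + q) * q + q Eq.≡⟨ e1 (S 0) q ⟩
      2 * (q * S 0) + q * suc q Eq.≡⟨ cong (2 * (q * S 0) +_) (2∑id q) ⟨
      2 * (q * S 0) + 2 * ∑ q (λ g → g) Eq.≡⟨ *-distribˡ-+ 2 (q * S 0) _ ⟨
      2 * (q * S 0 + ∑ q (λ g → g)) Eq.≡⟨ cong (λ z → 2 * (z + ∑ q (λ g → g))) (∑-const q (S 0)) ⟨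
      2 * (∑ q (λ _ → S 0) + ∑ q (λ g → g)) Eq.≡⟨ cong (2 *_) (∑-+ q _ _) ⟨
      2 * ∑ q (λ g → S 0 + g) Eq.≡⟨ cong (2 *_) (∑-cong′ q (λ g → sym (S-linear g))) ⟩
      2 * ∑ q S Eq.≡⟨ cong (2 *_) (∑-swap q q _) ⟩
      2 * ∑ q (λ j → ∑ q (λ g → (g + j * p) ÷ q)) Eq.≡⟨ cong (2 *_) (∑-cong′ q (λ j → trans (hermite q (j * p) 1≤q) (+-comm 1 (j * p)))) ⟩
      2 * ∑ q (λ j → j * p + 1) Eq.≡⟨ cong (2 *_) (trans (∑-+ q _ _) (cong₂ _+_ (sym (∑-*ʳ q p (λ j → j))) (trans (∑-const q 1) (*-identityʳ q)))) ⟩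
      2 * (∑ q (λ j → j) * p + q) Eq.≡⟨ e2 (∑ q (λ j → j)) p q ⟩
      2 * ∑ q (λ j → j) * p + 2 * q Eq.≡⟨ cong (λ z → z * p + 2 * q) (2∑id q) ⟩
      q * suc q * p + 2 * q Eq.≡⟨ e3 p q ⟩
      (p * suc q + 1) * q + q Eq.∎))
      where
      module Eq = ≡-Reasoning
      e1 : ∀ s q → (2 * s + q) * q + q ≡ 2 * (q * s) + q * suc q
      e1 = solve-∀
      e2 : ∀ s p q → 2 * (s * p + q) ≡ 2 * s * p + 2 * q
      e2 = solve-∀
      e3 : ∀ p q → q * suc q * p + 2 * q ≡ (p * suc q + 1) * q + q
      e3 = solve-∀

  -- Lets one approximation inequality at the largest multiplier serve for all smaller ones: if x >
  -- y, then (x - y) j ≤ (x - y) q ≤ b.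
  *≤*+-weaken : ∀ {x y b j q} → j ≤ q → x * q ≤ y * q + b → x * j ≤ y * j + b
  *≤*+-weaken {x} {y} {b} {j} {q} j≤q h with ≤-total x y
  ... | inj₁ x≤y = ≤-trans (*-monoˡ-≤ j x≤y) (m≤m+n (y * j) b)
  ... | inj₂ y≤x = begin
    x * j ≡⟨ cong (_* j) (m+[n∸m]≡n y≤x) ⟨
    (y + (x ∸ y)) * j ≡⟨ *-distribʳ-+ j y (x ∸ y) ⟩
    y * j + (x ∸ y) * j ≤⟨ +-monoʳ-≤ (y * j) (*-monoʳ-≤ (x ∸ y) j≤q) ⟩
    y * j + (x ∸ y) * q ≤⟨ +-monoʳ-≤ (y * j) (+-cancelˡ-≤ (y * q) _ _ (≤-trans (≤-reflexive (trans (sym (*-distribʳ-+ q y (x ∸ y))) (cong (_* q) (m+[n∸m]≡n y≤x)))) h)) ⟩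
    y * j + b ∎
    where open ≤-Reasoning

  module Residue (A B : ℕ) where
    -- ρ m / B is the fractional part of A m / B.
    ρ : ℕ → ℕ
    ρ m = A * m ∸ A * m ÷ B * B

    ρ+ : ∀ m → ρ m + A * m ÷ B * B ≡ A * m
    ρ+ m = m∸n+n≡m (÷-*-≤ (A * m) B)

    ρ≤ : 1 ≤ B → ∀ m → ρ m ≤ B
    ρ≤ 1≤B m = ≤-trans (∸-monoˡ-≤ (A * m ÷ B * B) (<⇒≤ (<-÷-suc (A * m) 1≤B))) (≤-reflexive (m+n∸n≡m B (A * m ÷ B * B)))

  module Block (A B p q : ℕ) (1≤q : 1 ≤ q) (1≤B : 1 ≤ B) (p⊥q : Coprime p q)
               (qA≤pB : q * A * q ≤ p * B * q + B) (pB≤qA : p * B * q ≤ q * A * q + B) (s : ℕ) where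
    open Residue A B
    open FloorSum p q 1≤q p⊥q
    open ≤-Reasoning
    private
      instance
        B≢0 : NonZero B
        B≢0 = >-nonZero 1≤B
      g = q * A * s ÷ B
      v : ℕ → ℕ
      v j = A * (s + j) ÷ B
      φ = ∑ q v
      σ = ∑ q (λ j → ρ (s + j))

      -- What `lower` and `upper` express is ⌊(g - 1 + j p)/q⌋ ≤ v j ≤ ⌊(g + 1 + j p)/q⌋. Adding q
      -- to the numerators keeps the argument of `S` a natural number.
      lower : ∀ j → 1 ≤ j → j ≤ q → (g + pred q + j * p) ÷ q ≤ v j + 1
      lower j _ j≤q = ÷-upper (begin-strict
        g + pred q + j * p <⟨ n<1+n _ ⟩
        suc (g + pred q + j * p) ≡⟨ e1 g (pred q) (j * p) ⟩
        g + j * p + suc (pred q) ≡⟨ cong (g + j * p +_) (suc-pred q {{>-nonZero 1≤q}}) ⟩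
        g + j * p + q ≤⟨ +-monoˡ-≤ q (s≤s⁻¹ (*-cancelʳ-< B (g + j * p) (suc (suc (v j) * q)) bound)) ⟩
        suc (v j) * q + q ≡⟨ e2 (v j) q ⟩
        suc (v j + 1) * q ∎)
        where
        e1 : ∀ g p j → suc (g + p + j) ≡ g + j + suc p
        e1 = solve-∀
        e2 : ∀ v q → suc v * q + q ≡ suc (v + 1) * q
        e2 = solve-∀
        e3 : ∀ g B p j → (g + j * p) * B ≡ g * B + p * B * j
        e3 = solve-∀
        e4 : ∀ q A s j B → q * A * s + (q * A * j + B) ≡ q * (A * (s + j)) + B
        e4 = solve-∀
        e5 : ∀ q v B → q * (suc v * B) + B ≡ suc (suc v * q) * B
        e5 = solve-∀
        bound : (g + j * p) * B < suc (suc (v j) * q) * B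
        bound = begin-strict
          (g + j * p) * B ≡⟨ e3 g B p j ⟩
          g * B + p * B * j ≤⟨ +-mono-≤ (÷-*-≤ (q * A * s) B) (*≤*+-weaken {p * B} {q * A} j≤q pB≤qA) ⟩
          q * A * s + (q * A * j + B) ≡⟨ e4 q A s j B ⟩
          q * (A * (s + j)) + B <⟨ +-monoˡ-< B (*-monoʳ-< q {{>-nonZero 1≤q}} (<-÷-suc (A * (s + j)) 1≤B)) ⟩
          q * (suc (v j) * B) + B ≡⟨ e5 q (v j) B ⟩
          suc (suc (v j) * q) * B ∎

      upper : ∀ j → 1 ≤ j → j ≤ q → v j + 1 ≤ (g + suc q + j * p) ÷ q
      upper j _ j≤q = *≤⇒≤÷ 1≤q (begin
        (v j + 1) * q ≡⟨ e1 (v j) q ⟩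
        v j * q + q ≤⟨ +-monoˡ-≤ q (s≤s⁻¹ (*-cancelʳ-< B (v j * q) (suc (suc (g + j * p))) bound)) ⟩
        suc (g + j * p) + q ≡⟨ e2 g (j * p) q ⟩
        g + suc q + j * p ∎)
        where
        e1 : ∀ v q → (v + 1) * q ≡ v * q + q
        e1 = solve-∀
        e2 : ∀ g j q → suc (g + j) + q ≡ g + suc q + j
        e2 = solve-∀
        e3 : ∀ v q B → v * q * B ≡ q * (v * B)
        e3 = solve-∀
        e4 : ∀ q A s j → q * (A * (s + j)) ≡ q * A * s + q * A * j
        e4 = solve-∀
        e5 : ∀ g p B j → suc g * B + (p * B * j + B) ≡ suc (suc (g + j * p)) * B
        e5 = solve-∀
        bound : v j * q * B < suc (suc (g + j * p)) * B
        bound = begin-strict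
          v j * q * B ≡⟨ e3 (v j) q B ⟩
          q * (v j * B) ≤⟨ *-monoʳ-≤ q (÷-*-≤ (A * (s + j)) B) ⟩
          q * (A * (s + j)) ≡⟨ e4 q A s j ⟩
          q * A * s + q * A * j <⟨ +-mono-<-≤ (<-÷-suc (q * A * s) 1≤B) (*≤*+-weaken {q * A} {p * B} j≤q qA≤pB) ⟩
          suc g * B + (p * B * j + B) ≡⟨ e5 g p B j ⟩
          suc (suc (g + j * p)) * B ∎

      φ+q : ∑ q (λ j → v j + 1) ≡ φ + q
      φ+q = trans (∑-+ q v (λ _ → 1)) (cong (φ +_) (trans (∑-const q 1) (*-identityʳ q)))

      φ-lower : S 0 + g ≤ φ + 1
      φ-lower = +-cancelʳ-≤ (pred q) _ _ (begin
        S 0 + g + pred q ≡⟨ +-assoc (S 0) g (pred q) ⟩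
        S 0 + (g + pred q) ≡⟨ S-linear (g + pred q) ⟨
        S (g + pred q) ≤⟨ ∑-mono q lower ⟩
        ∑ q (λ j → v j + 1) ≡⟨ φ+q ⟩
        φ + q ≡⟨ cong (φ +_) (suc-pred q {{>-nonZero 1≤q}}) ⟨
        φ + (1 + pred q) ≡⟨ +-assoc φ 1 (pred q) ⟨
        φ + 1 + pred q ∎)

      φ-upper : φ ≤ S 0 + g + 1
      φ-upper = +-cancelʳ-≤ q _ _ (begin
        φ + q ≡⟨ φ+q ⟨
        ∑ q (λ j → v j + 1) ≤⟨ ∑-mono q upper ⟩
        S (g + suc q) ≡⟨ S-linear (g + suc q) ⟩
        S 0 + (g + suc q) ≡⟨ e (S 0) g q ⟩
        S 0 + g + 1 + q ∎)
        where
        e : ∀ a b c → a + (b + suc c) ≡ a + b + 1 + c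
        e = solve-∀

      total : 2 * σ + 2 * (B * φ) ≡ 2 * (q * A * s) + q * A * suc q
      total = Eq.begin
        2 * σ + 2 * (B * φ) Eq.≡⟨ *-distribˡ-+ 2 σ (B * φ) ⟨
        2 * (σ + B * φ) Eq.≡⟨ cong (λ z → 2 * (σ + z)) (trans (*-comm B φ) (∑-*ʳ q B v)) ⟩
        2 * (σ + ∑ q (λ j → v j * B)) Eq.≡⟨ cong (2 *_) (trans (sym (∑-+ q _ _)) (∑-cong′ q (λ j → trans (ρ+ (s + j)) (*-distribˡ-+ A s j)))) ⟩
        2 * ∑ q (λ j → A * s + A * j) Eq.≡⟨ cong (2 *_) (trans (∑-+ q _ _) (cong₂ _+_ (∑-const q (A * s)) (sym (∑-*ˡ q A (λ j → j))))) ⟩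
        2 * (q * (A * s) + A * ∑ q (λ j → j)) Eq.≡⟨ e1 q A s (∑ q (λ j → j)) ⟩
        2 * (q * A * s) + A * (2 * ∑ q (λ j → j)) Eq.≡⟨ cong (λ z → 2 * (q * A * s) + A * z) (2∑id q) ⟩
        2 * (q * A * s) + A * (q * suc q) Eq.≡⟨ cong (2 * (q * A * s) +_) (e2 A q) ⟩
        2 * (q * A * s) + q * A * suc q Eq.∎
        where
        module Eq = ≡-Reasoning
        e1 : ∀ q A s t → 2 * (q * (A * s) + A * t) ≡ 2 * (q * A * s) + A * (2 * t)
        e1 = solve-∀
        e2 : ∀ A q → A * (q * suc q) ≡ q * A * suc q
        e2 = solve-∀

      extend : ∀ x y → x * q ≤ y * q + B → x * suc q ≤ y * suc q + 2 * B
      extend x y h = begin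
        x * suc q ≡⟨ *-suc x q ⟩
        x + x * q ≡⟨ cong (_+ x * q) (*-identityʳ x) ⟨
        x * 1 + x * q ≤⟨ +-mono-≤ (*≤*+-weaken {x} {y} 1≤q h) h ⟩
        (y * 1 + B) + (y * q + B) ≡⟨ e y B q ⟩
        y * suc q + 2 * B ∎
        where
        e : ∀ y B q → (y * 1 + B) + (y * q + B) ≡ y * suc q + 2 * B
        e = solve-∀

    -- In units of B the error 5 is 2 + 2 + 2 - 1: twice the error 1 of φ, twice the rounding of g,
    -- the replacement of A/B by p/q over the factor q + 1 in `extend`, less the 1 in `2S₀`. In
    -- `block-lower` the rounding of g costs nothing and the 1 has the opposite sign.
    block-upper : 2 * ∑ q (λ j → ρ (s + j)) ≤ q * B + 5 * B
    block-upper = ≤-from 0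
      (+-mono-≤ (*-monoʳ-≤ (2 * B) φ-lower) (+-mono-≤ (*-monoʳ-≤ 2 (<⇒≤ (<-÷-suc (q * A * s) 1≤B)))
        (+-mono-≤ (extend (q * A) (p * B) qA≤pB) (+-mono-≤ (≤-reflexive total) (*-monoʳ-≤ B (≤-reflexive (sym 2S₀)))))))
      (e σ B (S 0) g φ (q * A * s) (q * A * suc q) p q)
      where
      e : ∀ σ B S g φ x y p q →
          2 * σ + (2 * B * (φ + 1) + (2 * (suc g * B) + (p * B * suc q + 2 * B + (2 * x + y + B * (2 * S + q))))) + 0
          ≡ q * B + 5 * B + (2 * B * (S + g) + (2 * x + (y + (2 * σ + 2 * (B * φ) + B * (p * suc q + 1)))))
      e = solve-∀

    block-lower : q * B ≤ 2 * ∑ q (λ j → ρ (s + j)) + 5 * B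
    block-lower = ≤-from 0
      (+-mono-≤ (*-monoʳ-≤ (2 * B) φ-upper) (+-mono-≤ (*-monoʳ-≤ 2 (÷-*-≤ (q * A * s) B))
        (+-mono-≤ (extend (p * B) (q * A) pB≤qA) (+-mono-≤ (≤-reflexive (sym total)) (*-monoʳ-≤ B (≤-reflexive 2S₀))))))
      (e σ B (S 0) g φ (q * A * s) (q * A * suc q) p q)
      where
      e : ∀ σ B S g φ x y p q →
          q * B + (2 * B * (S + g + 1) + (2 * x + (y + 2 * B + (2 * σ + 2 * (B * φ) + B * (p * suc q + 1))))) + 0
          ≡ 2 * σ + 5 * B + (2 * B * φ + (2 * (g * B) + (p * B * suc q + (2 * x + y + B * (2 * S + q)))))
      e = solve-∀

  -- The bound |a - b| ≤ k without subtraction.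
  Near : ℕ → ℕ → ℕ → Set
  Near k a b = a ≤ b + k × b ≤ a + k

  Near-+ : ∀ {k k′ a a′ b b′} → Near k a b → Near k′ a′ b′ → Near (k + k′) (a + a′) (b + b′)
  Near-+ {k} {k′} {a} {a′} {b} {b′} (p , q) (p′ , q′) =
    ≤-trans (+-mono-≤ p p′) (≤-reflexive (e b k b′ k′)) , ≤-trans (+-mono-≤ q q′) (≤-reflexive (e a k a′ k′))
    where
    e : ∀ b k b′ k′ → b + k + (b′ + k′) ≡ b + b′ + (k + k′)
    e = solve-∀

  Near-≤ : ∀ {k k′ a b} → k ≤ k′ → Near k a b → Near k′ a b
  Near-≤ {a = a} {b} k≤ (p , q) = ≤-trans p (+-monoʳ-≤ b k≤) , ≤-trans q (+-monoʳ-≤ a k≤)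

  ∑-term-≤ : ∀ {n f} i → 1 ≤ i → i ≤ n → f i ≤ ∑ n f
  ∑-term-≤ {suc n} {f} i 1≤i i≤1+n with i ≟ suc n
  ... | yes refl = m≤n+m (f i) (∑ n f)
  ... | no  i≢   = ≤-trans (∑-term-≤ {n} {f} i 1≤i (s≤s⁻¹ (≤∧≢⇒< i≤1+n i≢))) (m≤m+n (∑ n f) (f (suc n)))
  ∑-term-≤ {zero} i 1≤i i≤0 = contradiction (≤-trans 1≤i i≤0) λ ()

  -- Dyadic decomposition: a block of indices from 2^i to below 2^(i+1) has at most 2^i terms of
  -- size at most K/2^i, hence contributes at most K.
  ∑-÷ : ∀ L n K → n < 2 ^ L → ∑ n (λ d → K ÷ d) ≤ K * L
  ∑-÷ zero    zero    K n< = z≤n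
  ∑-÷ zero    (suc n) K (s≤s ())
  ∑-÷ (suc L) n K n< with n <? 2 ^ L
  ... | yes n<2^L = ≤-trans (∑-÷ L n K n<2^L) (*-monoʳ-≤ K (n≤1+n L))
  ... | no  n≮    = begin
    ∑ n (λ d → K ÷ d) ≡⟨ cong (λ z → ∑ z (λ d → K ÷ d)) (m+[n∸m]≡n m≤n) ⟨
    ∑ (m + (n ∸ m)) (λ d → K ÷ d) ≡⟨ ∑-append m (n ∸ m) _ ⟩
    ∑ m (λ d → K ÷ d) + ∑ (n ∸ m) (λ d → K ÷ (m + d)) ≤⟨ +-mono-≤ (∑-÷ L m K (≤-reflexive 1+m)) (∑-≤-const (n ∸ m) (K ÷ 2 ^ L)
        (λ d 1≤d _ → ÷-anti-≤ K 1≤2^L (subst (_≤ m + d) 1+m (≤-trans (≤-reflexive (+-comm 1 m)) (+-monoʳ-≤ m 1≤d))))) ⟩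
    K * L + (n ∸ m) * (K ÷ 2 ^ L) ≤⟨ +-monoʳ-≤ (K * L) (≤-trans (≤-trans (*-monoˡ-≤ (K ÷ 2 ^ L) n∸m≤) (≤-reflexive (*-comm (2 ^ L) _))) (÷-*-≤ K (2 ^ L))) ⟩
    K * L + K ≡⟨ trans (+-comm (K * L) K) (sym (*-suc K L)) ⟩
    K * suc L ∎
    where
    open ≤-Reasoning
    1≤2^L : 1 ≤ 2 ^ L
    1≤2^L = m^n>0 2 L
    m = pred (2 ^ L)
    1+m : suc m ≡ 2 ^ L
    1+m = suc-pred (2 ^ L) {{>-nonZero 1≤2^L}}
    m≤n : m ≤ n
    m≤n = ≤-trans (n≤1+n m) (≤-trans (≤-reflexive 1+m) (≮⇒≥ n≮))
    n∸m≤ : n ∸ m ≤ 2 ^ L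
    n∸m≤ = m≤n+o⇒m∸n≤o n m (s≤s⁻¹ (≤-trans n< (≤-reflexive (trans (cong (2 ^ L +_) (+-identityʳ (2 ^ L))) (cong (_+ 2 ^ L) (sym 1+m))))))

  module Deviation (A B : ℕ) (1≤B : 1 ≤ B) where
    open Residue A B

    -- After division by B this is |Σ_{m ≤ n} (2{m A/B} - 1)| ≤ w.
    Dev : ℕ → ℕ → Set
    Dev n w = Near (B * w) (2 * ∑ n ρ) (n * B)

    Dev-trivial : ∀ n → Dev n n
    Dev-trivial n =
      ≤-trans (*-monoʳ-≤ 2 (∑-≤-const n B (λ i _ _ → ρ≤ 1≤B i))) (≤-reflexive (e n B)) ,
      ≤-trans (≤-reflexive (*-comm n B)) (m≤n+m (B * n) _)
      where
      e : ∀ n B → 2 * (n * B) ≡ n * B + B * n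
      e = solve-∀

    module _ (p q : ℕ) (1≤q : 1 ≤ q) (p⊥q : Coprime p q)
             (qA≤pB : q * A * q ≤ p * B * q + B) (pB≤qA : p * B * q ≤ q * A * q + B) where

      private
        blocks : ∀ t → Near (B * (5 * t)) (2 * ∑ (t * q) ρ) (t * q * B)
        blocks zero    = z≤n , z≤n
        blocks (suc t) = subst₂ (λ x y → Near (B * (5 * suc t)) x y)
            (sym (trans (cong (λ z → 2 * ∑ z ρ) (+-comm q (t * q))) (trans (cong (2 *_) (∑-append (t * q) q ρ)) (*-distribˡ-+ 2 (∑ (t * q) ρ) _))))
            (sym (trans (cong (_* B) (+-comm q (t * q))) (*-distribʳ-+ B (t * q) q)))
            (Near-≤ (≤-reflexive (e B t)) (Near-+ (blocks t) (block-upper , block-lower)))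
          where
          open Block A B p q 1≤q 1≤B p⊥q qA≤pB pB≤qA (t * q)
          e : ∀ B t → B * (5 * t) + 5 * B ≡ B * (5 * suc t)
          e = solve-∀

      -- Each of the ⌊n/q⌋ complete blocks costs 5; the incomplete one has at most q terms and is
      -- estimated trivially.
      Dev-approx : ∀ n → Dev n (5 * (n ÷ q) + q)
      Dev-approx n = subst (λ z → Near (B * (5 * t + q)) (2 * ∑ z ρ) (z * B)) n≡
        (subst₂ (λ x y → Near (B * (5 * t + q)) x y)
          (sym (trans (cong (2 *_) (∑-append (t * q) u ρ)) (*-distribˡ-+ 2 (∑ (t * q) ρ) _)))
          (sym (*-distribʳ-+ B (t * q) u))
          (Near-≤ (≤-reflexive (sym (*-distribˡ-+ B (5 * t) q))) (Near-+ (blocks t) rest)))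
        where
        t = n ÷ q
        u = n ∸ t * q
        n≡ : t * q + u ≡ n
        n≡ = m+[n∸m]≡n (÷-*-≤ n q)
        u≤q : u ≤ q
        u≤q = ≤-trans (∸-monoˡ-≤ (t * q) (<⇒≤ (<-÷-suc n 1≤q))) (≤-reflexive (m+n∸n≡m q (t * q)))
        e : ∀ u B → 2 * (u * B) ≡ u * B + B * u
        e = solve-∀
        rest : Near (B * q) (2 * ∑ u (λ i → ρ (t * q + i))) (u * B)
        rest = ≤-trans (*-monoʳ-≤ 2 (∑-≤-const u B (λ i _ _ → ρ≤ 1≤B (t * q + i)))) (≤-trans (≤-reflexive (e u B)) (+-monoʳ-≤ (u * B) (*-monoʳ-≤ B u≤q))) ,
               ≤-trans (≤-trans (≤-reflexive (*-comm u B)) (*-monoʳ-≤ B u≤q)) (m≤n+m (B * q) _)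

  -- |A/B - p/q| ≤ 1/(qQ)
  Approx : ℕ → ℕ → ℕ → ℕ → ℕ → Set
  Approx A B Q p q = q * A * Q ≤ p * B * Q + B × p * B * Q ≤ q * A * Q + B

  approx? : ∀ A B Q p q → Dec (Approx A B Q p q)
  approx? A B Q p q = (q * A * Q ≤? p * B * Q + B) ×-dec (p * B * Q ≤? q * A * Q + B)

  -- Dirichlet's approximation theorem by the pigeonhole principle.

  module Dirichlet (A B Q : ℕ) (1≤B : 1 ≤ B) (A≤B : A ≤ B) (1≤Q : 1 ≤ Q) where
    open Residue A B
    open ≤-Reasoning

    private
      ρ< : ∀ m → ρ m < B
      ρ< m = +-cancelʳ-< (A * m ÷ B * B) (ρ m) B (subst (_< B + A * m ÷ B * B) (sym (ρ+ m)) (<-÷-suc (A * m) 1≤B))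

      box : ℕ → ℕ
      box i = ρ i * Q ÷ B

      box< : ∀ i → box i < Q
      box< i = *-cancelʳ-< B (box i) Q (≤-<-trans (÷-*-≤ (ρ i * Q) B) (subst (ρ i * Q <_) (*-comm B Q) (*-monoˡ-< Q {{>-nonZero 1≤Q}} (ρ< i))))

      close : ∀ i j → box i ≡ box j → ρ i * Q < ρ j * Q + B
      close i j e = begin-strict
        ρ i * Q <⟨ <-÷-suc (ρ i * Q) 1≤B ⟩
        B + box i * B ≡⟨ cong (λ z → B + z * B) e ⟩
        B + box j * B ≤⟨ +-monoʳ-≤ B (÷-*-≤ (ρ j * Q) B) ⟩
        B + ρ j * Q ≡⟨ +-comm B _ ⟩
        ρ j * Q + B ∎

      -- The strict form of `Approx`, as the boxes produce it. Strictness lets `small` pass from p Q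
      -- < q Q + 1 to p ≤ q.
      Good : ℕ → ℕ → Set
      Good p q = q * A * Q < p * B * Q + B × p * B * Q < q * A * Q + B

      difference : ∀ i j → i ≤ j → box i ≡ box j → Good (A * j ÷ B ∸ A * i ÷ B) (j ∸ i)
      difference i j i≤j e =
        +-cancelʳ-< (ρ i * Q) _ _ (begin-strict
          q * A * Q + ρ i * Q ≡⟨ *-distribʳ-+ Q (q * A) (ρ i) ⟨
          (q * A + ρ i) * Q ≡⟨ cong (_* Q) key ⟩
          (p * B + ρ j) * Q ≡⟨ *-distribʳ-+ Q (p * B) (ρ j) ⟩
          p * B * Q + ρ j * Q <⟨ +-monoʳ-< (p * B * Q) (close j i (sym e)) ⟩
          p * B * Q + (ρ i * Q + B) ≡⟨ c (p * B * Q) (ρ i * Q) B ⟩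
          p * B * Q + B + ρ i * Q ∎) ,
        +-cancelʳ-< (ρ j * Q) _ _ (begin-strict
          p * B * Q + ρ j * Q ≡⟨ *-distribʳ-+ Q (p * B) (ρ j) ⟨
          (p * B + ρ j) * Q ≡⟨ cong (_* Q) key ⟨
          (q * A + ρ i) * Q ≡⟨ *-distribʳ-+ Q (q * A) (ρ i) ⟩
          q * A * Q + ρ i * Q <⟨ +-monoʳ-< (q * A * Q) (close i j e) ⟩
          q * A * Q + (ρ j * Q + B) ≡⟨ c (q * A * Q) (ρ j * Q) B ⟩
          q * A * Q + B + ρ j * Q ∎)
        where
        fi = A * i ÷ B
        fj = A * j ÷ B
        p = fj ∸ fi
        q = j ∸ i
        c : ∀ x y z → x + (y + z) ≡ x + z + y
        c = solve-∀
        c′ : ∀ q A i B r s → r + i * B ≡ A * s → q * A + r + i * B ≡ A * (q + s)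
        c′ q A i B r s h = trans (+-assoc (q * A) r (i * B)) (trans (cong (q * A +_) h) (trans (cong (_+ A * s) (*-comm q A)) (sym (*-distribˡ-+ A q s))))
        key : q * A + ρ i ≡ p * B + ρ j
        key = +-cancelʳ-≡ (fi * B) _ _ (Eq.begin
          q * A + ρ i + fi * B Eq.≡⟨ c′ q A fi B (ρ i) i (ρ+ i) ⟩
          A * (q + i) Eq.≡⟨ cong (A *_) (m∸n+n≡m i≤j) ⟩
          A * j Eq.≡⟨ ρ+ j ⟨
          ρ j + fj * B Eq.≡⟨ cong (λ z → ρ j + z * B) (m∸n+n≡m (÷-mono-≤ B (*-monoʳ-≤ A i≤j))) ⟨
          ρ j + (p + fi) * B Eq.≡⟨ d (ρ j) p fi B ⟩
          p * B + ρ j + fi * B Eq.∎)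
          where
          module Eq = ≡-Reasoning
          d : ∀ r p f B → r + (p + f) * B ≡ p * B + r + f * B
          d = solve-∀

      cancel : ∀ g {x y} → 1 ≤ g → g * x < g * y + B → x < y + B
      cancel g {x} {y} 1≤g h = *-cancelˡ-< g x (y + B) (<-≤-trans h (≤-trans (+-monoʳ-≤ (g * y) (m≤n*m B g {{>-nonZero 1≤g}})) (≤-reflexive (sym (*-distribˡ-+ g y B)))))

      reduce : ∀ p q → 1 ≤ q → q ≤ Q → Good p q → ∃[ p′ ] ∃[ q′ ] 1 ≤ q′ × q′ ≤ Q × Coprime p′ q′ × Good p′ q′
      reduce p q 1≤q q≤Q (h₁ , h₂) = p / g , q / g , 1≤q′ , ≤-trans q′≤q q≤Q , coprime-/gcd p q ,
        cancel g 1≤g (subst₂ (λ u v → u < v + B) (expand (q / g) A q≡) (expand (p / g) B p≡) h₁) ,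
        cancel g 1≤g (subst₂ (λ u v → u < v + B) (expand (p / g) B p≡) (expand (q / g) A q≡) h₂)
        where
        g = gcd p q
        instance
          g≢0 : NonZero g
          g≢0 = ≢-nonZero (gcd[m,n]≢0 p q (inj₂ (m<n⇒n≢0 1≤q)))
        1≤g : 1 ≤ g
        1≤g = >-nonZero⁻¹ g
        p≡ : p / g * g ≡ p
        p≡ = m/n*n≡m (gcd[m,n]∣m p q)
        q≡ : q / g * g ≡ q
        q≡ = m/n*n≡m (gcd[m,n]∣n p q)
        e : ∀ x g y Q → x * g * y * Q ≡ g * (x * y * Q)
        e = solve-∀
        expand : ∀ x y {z} → x * g ≡ z → z * y * Q ≡ g * (x * y * Q)
        expand x y refl = e x g y Q
        1≤q′ : 1 ≤ q / g
        1≤q′ = n≢0⇒n>0 (λ z → m<n⇒n≢0 1≤q (trans (sym q≡) (cong (_* g) z)))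
        q′≤q : q / g ≤ q
        q′≤q = subst (q / g ≤_) q≡ (m≤m*n (q / g) g)

      small : ∀ p q → Good p q → p ≤ q
      small p q (_ , h) = *-cancelʳ-≤ p q Q {{>-nonZero 1≤Q}} (s≤s⁻¹ (*-cancelʳ-< B (p * Q) (suc (q * Q)) (begin-strict
        p * Q * B ≡⟨ c p Q B ⟩
        p * B * Q <⟨ h ⟩
        q * A * Q + B ≤⟨ +-monoˡ-≤ B (*-monoˡ-≤ Q (*-monoʳ-≤ q A≤B)) ⟩
        q * B * Q + B ≡⟨ d q B Q ⟩
        suc (q * Q) * B ∎)))
        where
        c : ∀ p Q B → p * Q * B ≡ p * B * Q
        c = solve-∀
        d : ∀ q B Q → q * B * Q + B ≡ suc (q * Q) * B
        d = solve-∀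

    dirichlet : ∃[ p ] ∃[ q ] 1 ≤ q × q ≤ Q × p ≤ q × Coprime p q × Approx A B Q p q
    -- The Q + 1 points 0, ..., Q fall into Q boxes; starting at 0 keeps the difference of two
    -- indices at most Q.
    dirichlet with pigeonhole (n<1+n Q) (λ i → fromℕ< (box< (toℕ i)))
    ... | i , j , i<j , e =
      let m = toℕ i ; n = toℕ j
          e′ : box m ≡ box n
          e′ = trans (sym (toℕ-fromℕ< (box< m))) (trans (cong toℕ e) (toℕ-fromℕ< (box< n)))
          (p , q , 1≤q , q≤Q , p⊥q , good) = reduce (A * n ÷ B ∸ A * m ÷ B) (n ∸ m) (m<n⇒0<n∸m i<j)
            (≤-trans (m∸n≤m n m) (s≤s⁻¹ (toℕ<n j))) (difference m n (<⇒≤ i<j) e′)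
      in p , q , 1≤q , q≤Q , small p q good , p⊥q , <⇒≤ (proj₁ good) , <⇒≤ (proj₂ good)

  -- Error weights of single fractions and their sums over numerators.

  module Weight (Q : ℕ) (2≤Q : 2 ≤ Q) where
    private
      1≤Q : 1 ≤ Q
      1≤Q = ≤-trans (s≤s z≤n) 2≤Q

    near? : ∀ a b p q → Dec (Approx (a * a) (b * b) Q p q)
    near? a b = approx? (a * a) (b * b) Q

    -- Instead of the cost of the one approximation that Dirichlet's theorem selects, the costs of
    -- all nearby p/q with p ≥ 1 are added. This overestimate no longer depends on a choice, so it
    -- can be summed over a with p and q fixed.
    approxWeight : ℕ → ℕ → ℕ → ℕ
    approxWeight a b n = ∑ Q (λ q → ∑ q (λ p → χ (near? a b p q) * (5 * (n ÷ q) + q)))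

    -- Bounds |∑_{m ≤ n} (2 {m ξ²} - 1)| for ξ = a/b.  The summands cover the cases ξ ≤ 1/Q, ξ² ≤ 1/Q
    -- and ξ² near some p/q with p ≥ 1.
    weight : ℕ → ℕ → ℕ → ℕ
    weight a b n = χ (a * Q ≤? b) * n + (5 * (n ÷ Q) + b * Q ÷ a) + approxWeight a b n

    module _ (a b : ℕ) (1≤a : 1 ≤ a) (a≤b : a ≤ b) where
      private
        A = a * a
        B = b * b
        1≤A : 1 ≤ A
        1≤A = *-mono-≤ 1≤a 1≤a
        A≤B : A ≤ B
        A≤B = *-mono-≤ a≤b a≤b
        1≤B : 1 ≤ B
        1≤B = ≤-trans 1≤A A≤B
      open Deviation A B 1≤B
      open Dirichlet A B Q 1≤B A≤B 1≤Q

      private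
        -- Here ξ² ≤ 1/Q, and 1/⌊ξ⁻²⌋ is a better approximation to ξ² than 0/1.
        reciprocal : A * Q ≤ B → ∀ n → Dev n (5 * (n ÷ (B ÷ A)) + B ÷ A)
        reciprocal AQ≤B = Dev-approx 1 q (≤-trans 1≤Q Q≤q) (1-coprimeTo q)
            (≤-trans (*-monoˡ-≤ q (≤-trans (÷-*-≤ B A) (≤-reflexive (sym (*-identityˡ B))))) (m≤m+n (1 * B * q) B))
            (begin
              1 * B * q ≡⟨ cong (_* q) (*-identityˡ B) ⟩
              B * q ≤⟨ *-monoˡ-≤ q (<⇒≤ (<-÷-suc B 1≤A)) ⟩
              (A + q * A) * q ≡⟨ e A q ⟩
              q * A * q + q * A ≤⟨ +-monoʳ-≤ (q * A * q) (÷-*-≤ B A) ⟩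
              q * A * q + B ∎)
          where
          open ≤-Reasoning
          q = B ÷ A
          Q≤q : Q ≤ q
          Q≤q = *≤⇒≤÷ 1≤A (subst (_≤ B) (*-comm A Q) AQ≤B)
          e : ∀ A q → (A + q * A) * q ≡ q * A * q + q * A
          e = solve-∀

        -- Since ξ > 1/Q, one factor of ξ⁻² is traded for Q. Over the numerators b Q/a sums to about
        -- b Q log b, whereas b²/a² would sum to order b².
        reciprocal-weight : A * Q ≤ B → ¬ a * Q ≤ b → ∀ n → 5 * (n ÷ (B ÷ A)) + B ÷ A ≤ 5 * (n ÷ Q) + b * Q ÷ a
        reciprocal-weight AQ≤B aQ≰b n = +-mono-≤
          (*-monoʳ-≤ 5 (÷-anti-≤ n 1≤Q (*≤⇒≤÷ 1≤A (subst (_≤ B) (*-comm A Q) AQ≤B))))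
          (*≤⇒≤÷ 1≤a (*-cancelʳ-≤ (B ÷ A * a) (b * Q) a {{>-nonZero 1≤a}} (begin
            B ÷ A * a * a ≡⟨ *-assoc (B ÷ A) a a ⟩
            B ÷ A * A ≤⟨ ÷-*-≤ B A ⟩
            b * b ≤⟨ *-monoʳ-≤ b (<⇒≤ (≰⇒> aQ≰b)) ⟩
            b * (a * Q) ≡⟨ cong (b *_) (*-comm a Q) ⟩
            b * (Q * a) ≡⟨ *-assoc b Q a ⟨
            b * Q * a ∎)))
          where open ≤-Reasoning

      Dev-weight : ∀ n → Dev n (weight a b n)
      Dev-weight n = go dirichlet
        where
        open ≤-Reasoning
        term : ∀ p q → 1 ≤ p → p ≤ q → 1 ≤ q → q ≤ Q → Approx A B Q p q → 5 * (n ÷ q) + q ≤ approxWeight a b n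
        term p q 1≤p p≤q 1≤q q≤Q ap = begin
          v ≡⟨ *-identityˡ v ⟨
          1 * v ≡⟨ cong (_* v) (χ-yes (near? a b p q) ap) ⟨
          χ (near? a b p q) * v ≤⟨ ∑-term-≤ {q} {λ p → χ (near? a b p q) * v} p 1≤p p≤q ⟩
          ∑ q (λ p → χ (near? a b p q) * v) ≤⟨ ∑-term-≤ {Q} {λ q → ∑ q (λ p → χ (near? a b p q) * (5 * (n ÷ q) + q))} q 1≤q q≤Q ⟩
          approxWeight a b n ∎
          where v = 5 * (n ÷ q) + q
        small : A * Q ≤ B → Dec (a * Q ≤ b) → Dev n (weight a b n)
        small AQ≤B (yes aQ≤b) = Near-≤ (*-monoʳ-≤ B (begin
          n ≡⟨ *-identityˡ n ⟨
          1 * n ≡⟨ cong (_* n) (χ-yes (a * Q ≤? b) aQ≤b) ⟨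
          χ (a * Q ≤? b) * n ≤⟨ m≤m+n _ _ ⟩
          χ (a * Q ≤? b) * n + (5 * (n ÷ Q) + b * Q ÷ a) ≤⟨ m≤m+n _ (approxWeight a b n) ⟩
          weight a b n ∎)) (Dev-trivial n)
        small AQ≤B (no aQ≰b) = Near-≤ (*-monoʳ-≤ B (begin
          5 * (n ÷ (B ÷ A)) + B ÷ A ≤⟨ reciprocal-weight AQ≤B aQ≰b n ⟩
          5 * (n ÷ Q) + b * Q ÷ a ≤⟨ m≤n+m _ (χ (a * Q ≤? b) * n) ⟩
          χ (a * Q ≤? b) * n + (5 * (n ÷ Q) + b * Q ÷ a) ≤⟨ m≤m+n _ (approxWeight a b n) ⟩
          weight a b n ∎)) (reciprocal AQ≤B n)
        go : (∃[ p ] ∃[ q ] 1 ≤ q × q ≤ Q × p ≤ q × Coprime p q × Approx A B Q p q) → Dev n (weight a b n)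
        go (p@(suc _) , q , 1≤q , q≤Q , p≤q , p⊥q , ap@(ap₁ , ap₂)) =
          Near-≤ (*-monoʳ-≤ B (≤-trans (term p q (s≤s z≤n) p≤q 1≤q q≤Q ap) (m≤n+m (approxWeight a b n) _)))
            (Dev-approx p q 1≤q p⊥q (*≤*+-weaken {q * A} {p * B} q≤Q ap₁) (*≤*+-weaken {p * B} {q * A} q≤Q ap₂) n)
        -- With p = 0 the approximation reads q A Q ≤ B, which forces ξ² ≤ 1/Q.
        go (zero , q , 1≤q , _ , _ , _ , ap₁ , _) =
          small (≤-trans (*-monoˡ-≤ Q (m≤n*m A q {{>-nonZero 1≤q}})) ap₁) (a * Q ≤? b)

    -- With j = i + k, two squares near the same p/q differ by at most 2b²/(qQ), while j² - i² ≥ k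
    -- j. Since Q ≥ 2 and p ≥ 1, the lower bound for j²/b² is at least p/(2q), so that p b ≤ 2 q j.
    -- Multiplying the two estimates eliminates q and j.
    near-spread : ∀ b p q → 1 ≤ p → ∀ i k → 1 ≤ i → i + k ≤ b →
                  Approx (i * i) (b * b) Q p q → Approx ((i + k) * (i + k)) (b * b) Q p q → k * p * Q ≤ 4 * b
    near-spread b p q 1≤p i k 1≤i j≤b (_ , lo) (up , lo′) = *-cancelʳ-≤ (k * p * Q) (4 * b) b {{>-nonZero (≤-trans 1≤i (≤-trans (m≤m+n i k) j≤b))}} (begin
      k * p * Q * b ≡⟨ e1 k p Q b ⟩
      k * Q * (p * b) ≤⟨ *-monoʳ-≤ (k * Q) pb≤ ⟩
      k * Q * (2 * q * j) ≡⟨ e2 k Q q j ⟩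
      2 * (q * Q * k * j) ≤⟨ *-monoʳ-≤ 2 qQkj≤ ⟩
      2 * (2 * (b * b)) ≡⟨ e3 b ⟩
      4 * b * b ∎)
      where
      open ≤-Reasoning
      j = i + k
      1≤b : 1 ≤ b
      1≤b = ≤-trans 1≤i (≤-trans (m≤m+n i k) j≤b)
      e1 : ∀ k p Q b → k * p * Q * b ≡ k * Q * (p * b)
      e1 = solve-∀
      e2 : ∀ k Q q j → k * Q * (2 * q * j) ≡ 2 * (q * Q * k * j)
      e2 = solve-∀
      e3 : ∀ b → 2 * (2 * (b * b)) ≡ 4 * b * b
      e3 = solve-∀
      e4 : ∀ q Q i k P B → q * Q * k * (i + k) + (P * Q + B + (q * (i * i) * Q + B)) + q * Q * k * i ≡ 2 * B + (q * ((i + k) * (i + k)) * Q + P * Q)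
      e4 = solve-∀
      qQkj≤ : q * Q * k * j ≤ 2 * (b * b)
      qQkj≤ = ≤-from (q * Q * k * i) (+-mono-≤ up lo) (e4 q Q i k (p * (b * b)) (b * b))
      e5 : ∀ p B Q → p * B * Q + p * B * Q ≡ 2 * (p * B) * Q
      e5 = solve-∀
      2B≤ : 2 * (b * b) ≤ p * (b * b) * Q
      2B≤ = begin
        2 * (b * b) ≤⟨ *-monoˡ-≤ (b * b) 2≤Q ⟩
        Q * (b * b) ≡⟨ *-comm Q (b * b) ⟩
        b * b * Q ≤⟨ *-monoˡ-≤ Q (m≤n*m (b * b) p {{>-nonZero 1≤p}}) ⟩
        p * (b * b) * Q ∎
      e6 : ∀ x y B → x + (2 * y + 2 * B + x) + 0 ≡ 2 * y + (2 * x + 2 * B)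
      e6 = solve-∀
      pBQ≤ : p * (b * b) * Q ≤ 2 * (q * (j * j) * Q)
      pBQ≤ = ≤-from 0 (+-mono-≤ (≤-trans (*-monoʳ-≤ 2 lo′) (≤-reflexive (*-distribˡ-+ 2 (q * (j * j) * Q) (b * b)))) 2B≤) (e6 (p * (b * b) * Q) (q * (j * j) * Q) (b * b))
      e7 : ∀ q j → 2 * (q * (j * j)) ≡ 2 * q * j * j
      e7 = solve-∀
      pb≤ : p * b ≤ 2 * q * j
      pb≤ = *-cancelʳ-≤ (p * b) (2 * q * j) b {{>-nonZero 1≤b}} (begin
        p * b * b ≡⟨ *-assoc p b b ⟩
        p * (b * b) ≤⟨ *-cancelʳ-≤ (p * (b * b)) (2 * (q * (j * j))) Q {{>-nonZero 1≤Q}} (≤-trans pBQ≤ (≤-reflexive (sym (*-assoc 2 (q * (j * j)) Q)))) ⟩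
        2 * (q * (j * j)) ≡⟨ e7 q j ⟩
        2 * q * j * j ≤⟨ *-monoʳ-≤ (2 * q * j) j≤b ⟩
        2 * q * j * b ∎)

    near-count : ∀ b p q → 1 ≤ p → ∑ b (λ a → χ (near? a b p q)) ≤ suc (4 * b ÷ Q ÷ p)
    near-count b p q 1≤p = ∑-χ-spread (λ a → near? a b p q) b (4 * b ÷ Q ÷ p) λ i j 1≤i i≤j j≤b ni nj →
      let k = j ∸ i ; i+k≡j = m+[n∸m]≡n i≤j in
      subst (_≤ i + 4 * b ÷ Q ÷ p) i+k≡j (+-monoʳ-≤ i (*≤⇒≤÷ 1≤p (*≤⇒≤÷ 1≤Q
        (near-spread b p q 1≤p i k 1≤i (≤-trans (≤-reflexive i+k≡j) j≤b) ni
          (subst (λ z → Approx (z * z) (b * b) Q p q) (sym i+k≡j) nj)))))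

    module _ (L b : ℕ) (b<2^L : b < 2 ^ L) (Q<2^L : Q < 2 ^ L) where
      open ≤-Reasoning
      private
        g = 4 * b ÷ Q

        near-total : ∀ q → q ≤ Q → ∑ q (λ p → ∑ b (λ a → χ (near? a b p q))) ≤ q + g * L
        near-total q q≤Q = begin
          ∑ q (λ p → ∑ b (λ a → χ (near? a b p q))) ≤⟨ ∑-mono q (λ p 1≤p _ → near-count b p q 1≤p) ⟩
          ∑ q (λ p → 1 + g ÷ p) ≡⟨ ∑-+ q (λ _ → 1) (λ p → g ÷ p) ⟩
          ∑ q (λ _ → 1) + ∑ q (λ p → g ÷ p) ≤⟨ +-mono-≤ (≤-reflexive (trans (∑-const q 1) (*-identityʳ q))) (∑-÷ L q g (≤-<-trans q≤Q Q<2^L)) ⟩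
          q + g * L ∎

        swap₃ : ∀ n → ∑ b (λ a → approxWeight a b n) ≡ ∑ Q (λ q → ∑ q (λ p → ∑ b (λ a → χ (near? a b p q))) * (5 * (n ÷ q) + q))
        swap₃ n = trans (∑-swap b Q _) (∑-cong′ Q (λ q → trans (∑-swap b q _)
          (trans (∑-cong′ q (λ p → sym (∑-*ʳ b (5 * (n ÷ q) + q) (λ a → χ (near? a b p q)))))
                 (sym (∑-*ʳ q (5 * (n ÷ q) + q) (λ p → ∑ b (λ a → χ (near? a b p q))))))))

      -- For each q at most q + g L pairs (p, a) are close. When this is multiplied by the cost 5
      -- n/q + q, the part q cancels the division by q, and only the part g L needs the harmonic sum
      -- over q.
      ∑-approxWeight : ∀ n → ∑ b (λ a → approxWeight a b n) ≤ 5 * Q * n + Q * (Q * Q) + g * L * (5 * (n * L) + Q * Q)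
      ∑-approxWeight n = begin
        ∑ b (λ a → approxWeight a b n)
          ≡⟨ swap₃ n ⟩
        ∑ Q (λ q → ∑ q (λ p → ∑ b (λ a → χ (near? a b p q))) * (5 * (n ÷ q) + q))
          ≤⟨ ∑-mono Q (λ q _ q≤Q → *-monoˡ-≤ (5 * (n ÷ q) + q) (near-total q q≤Q)) ⟩
        ∑ Q (λ q → (q + g * L) * (5 * (n ÷ q) + q))
          ≤⟨ ∑-mono Q (λ q _ q≤Q → pointwise q q≤Q) ⟩
        ∑ Q (λ q → 5 * n + Q * Q + g * L * (5 * (n ÷ q) + Q))
          ≡⟨ trans (∑-+ Q (λ _ → 5 * n + Q * Q) (λ q → g * L * (5 * (n ÷ q) + Q))) (cong₂ _+_ (∑-const Q _)
               (trans (sym (∑-*ˡ Q (g * L) (λ q → 5 * (n ÷ q) + Q))) (cong (g * L *_) (trans (∑-+ Q (λ q → 5 * (n ÷ q)) (λ _ → Q)) (cong₂ _+_ (sym (∑-*ˡ Q 5 (λ q → n ÷ q))) (∑-const Q Q)))))) ⟩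
        Q * (5 * n + Q * Q) + g * L * (5 * ∑ Q (λ q → n ÷ q) + Q * Q)
          ≤⟨ +-monoʳ-≤ (Q * (5 * n + Q * Q)) (*-monoʳ-≤ (g * L) (+-monoˡ-≤ (Q * Q) (*-monoʳ-≤ 5 (∑-÷ L Q n Q<2^L)))) ⟩
        Q * (5 * n + Q * Q) + g * L * (5 * (n * L) + Q * Q)
          ≡⟨ cong (_+ g * L * (5 * (n * L) + Q * Q)) (e Q n) ⟩
        5 * Q * n + Q * (Q * Q) + g * L * (5 * (n * L) + Q * Q) ∎
        where
        e : ∀ Q n → Q * (5 * n + Q * Q) ≡ 5 * Q * n + Q * (Q * Q)
        e = solve-∀
        e1 : ∀ q h d → (q + h) * (5 * d + q) ≡ 5 * (d * q) + q * q + h * (5 * d + q)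
        e1 = solve-∀
        pointwise : ∀ q → q ≤ Q → (q + g * L) * (5 * (n ÷ q) + q) ≤ 5 * n + Q * Q + g * L * (5 * (n ÷ q) + Q)
        pointwise q q≤Q = begin
          (q + g * L) * (5 * (n ÷ q) + q) ≡⟨ e1 q (g * L) (n ÷ q) ⟩
          5 * (n ÷ q * q) + q * q + g * L * (5 * (n ÷ q) + q) ≤⟨ +-mono-≤ (+-mono-≤ (*-monoʳ-≤ 5 (÷-*-≤ n q)) (*-mono-≤ q≤Q q≤Q)) (*-monoʳ-≤ (g * L) (+-monoʳ-≤ (5 * (n ÷ q)) q≤Q)) ⟩
          5 * n + Q * Q + g * L * (5 * (n ÷ q) + Q) ∎

      -- The factor Q clears the quotients b/Q, n/Q and 4b/Q; it is cancelled only after all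
      -- summations, in `∑-tailWeight`.
      ∑-weight : ∀ n → ∑ b (λ a → weight a b n) * Q ≤
                 n * (6 * b + 5 * (Q * Q) + 20 * (b * (L * L))) + (5 * (b * L * (Q * Q)) + Q * Q * (Q * Q))
      ∑-weight n = begin
        ∑ b (λ a → weight a b n) * Q
          ≡⟨ cong (_* Q) (trans (∑-+ b _ _) (cong₂ _+_ (trans (∑-+ b _ _) (cong₂ _+_ (sym (∑-*ʳ b n (λ a → χ (a * Q ≤? b)))) (trans (∑-+ b _ _) (cong (_+ ∑ b (λ a → b * Q ÷ a)) (∑-const b _))))) refl)) ⟩
        (∑ b (λ a → χ (a * Q ≤? b)) * n + (b * (5 * (n ÷ Q)) + ∑ b (λ a → b * Q ÷ a)) + ∑ b (λ a → approxWeight a b n)) * Q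
          ≤⟨ *-monoˡ-≤ Q (+-mono-≤ (+-mono-≤ (*-monoˡ-≤ n small) (+-monoʳ-≤ (b * (5 * (n ÷ Q))) (∑-÷ L b (b * Q) b<2^L))) (∑-approxWeight n)) ⟩
        (b ÷ Q * n + (b * (5 * (n ÷ Q)) + b * Q * L) + (5 * Q * n + Q * (Q * Q) + g * L * (5 * (n * L) + Q * Q))) * Q
          ≡⟨ e1 (b ÷ Q) n b (n ÷ Q) Q L g ⟩
        n * (b ÷ Q * Q) + 5 * b * (n ÷ Q * Q) + b * L * (Q * Q) + 5 * n * (Q * Q) + Q * Q * (Q * Q) + g * Q * (L * (5 * (n * L) + Q * Q))
          ≤⟨ +-mono-≤ (+-monoˡ-≤ (Q * Q * (Q * Q)) (+-monoˡ-≤ (5 * n * (Q * Q)) (+-monoˡ-≤ (b * L * (Q * Q)) (+-mono-≤ (*-monoʳ-≤ n (÷-*-≤ b Q)) (*-monoʳ-≤ (5 * b) (÷-*-≤ n Q)))))) (*-monoˡ-≤ (L * (5 * (n * L) + Q * Q)) (÷-*-≤ (4 * b) Q)) ⟩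
        n * b + 5 * b * n + b * L * (Q * Q) + 5 * n * (Q * Q) + Q * Q * (Q * Q) + 4 * b * (L * (5 * (n * L) + Q * Q))
          ≡⟨ e2 n b L Q ⟩
        n * (6 * b + 5 * (Q * Q) + 20 * (b * (L * L))) + (5 * (b * L * (Q * Q)) + Q * Q * (Q * Q)) ∎
        where
        e1 : ∀ c n b d Q L g → (c * n + (b * (5 * d) + b * Q * L) + (5 * Q * n + Q * (Q * Q) + g * L * (5 * (n * L) + Q * Q))) * Q
             ≡ n * (c * Q) + 5 * b * (d * Q) + b * L * (Q * Q) + 5 * n * (Q * Q) + Q * Q * (Q * Q) + g * Q * (L * (5 * (n * L) + Q * Q))
        e1 = solve-∀
        e2 : ∀ n b L Q → n * b + 5 * b * n + b * L * (Q * Q) + 5 * n * (Q * Q) + Q * Q * (Q * Q) + 4 * b * (L * (5 * (n * L) + Q * Q))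
             ≡ n * (6 * b + 5 * (Q * Q) + 20 * (b * (L * L))) + (5 * (b * L * (Q * Q)) + Q * Q * (Q * Q))
        e2 = solve-∀
        small : ∑ b (λ a → χ (a * Q ≤? b)) ≤ b ÷ Q
        small = ≤-reflexive (trans (∑-cong′ b (λ a → trans (χ-cong (a * Q ≤? b) (a ≤? b ÷ Q) (*≤⇒≤÷ 1≤Q) (≤÷⇒*≤ Q)) (sym (*-identityʳ _))))
          (trans (∑-≤ (λ _ → 1) (÷≤ b Q)) (trans (∑-const (b ÷ Q) 1) (*-identityʳ (b ÷ Q)))))

  ∑-χ-≤ : ∀ n k → ∑ n (λ i → χ (i ≤? k)) ≤ k
  ∑-χ-≤ n k with ≤-total k n
  ... | inj₁ k≤n = ≤-reflexive (trans (∑-cong′ n (λ i → sym (*-identityʳ (χ (i ≤? k))))) (trans (∑-≤ (λ _ → 1) k≤n) (trans (∑-const k 1) (*-identityʳ k))))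
  ... | inj₂ n≤k = ≤-trans (∑-≤-const n 1 (λ i _ _ → χ≤1 (i ≤? k))) (≤-trans (≤-reflexive (*-identityʳ n)) n≤k)

  -- Of the relation Q ≍ T^{1/4} the counting needs the sharp lower bound `T≤Q⁴`, but from above
  -- only the weak `Q²≤4T`, for secondary terms. The sharp upper bound enters when Q³ is converted
  -- into a power of T.
  record Scale (T Q L : ℕ) : Set where
    field
      1≤T   : 1 ≤ T
      2≤Q   : 2 ≤ Q
      1≤L   : 1 ≤ L
      T≤Q⁴  : T ≤ Q * Q * (Q * Q)
      Q²≤4T : Q * Q ≤ 4 * T
      T<2^L : T < 2 ^ L
      Q<2^L : Q < 2 ^ L

  module Total {T Q L : ℕ} (scale : Scale T Q L) where
    open Scale scale
    open Weight Q 2≤Q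
    open ≤-Reasoning

    -- The factor 2 makes s dominate √T: the truncated series for √T are bounded in `expSum-½-upper`
    -- by 2 Q², not by Q².
    s Y : ℕ
    s = 2 * (Q * Q)
    Y = T ÷ s

    -- A sum over Y < m ≤ T/d is a difference of two initial sums, whence the two weights. For d > s
    -- the range is empty.
    tailWeight : ℕ → ℕ → ℕ
    tailWeight a b = ∑ T (λ d → χ (d ≤? s) * (weight a b (T ÷ d) + weight a b Y))

    private
      U = Q * Q
      P = 6 * T + 5 * U + 20 * (T * (L * L))
      K = 5 * (T * L * U) + U * U

      sY≤T : s * Y ≤ T
      sY≤T = ≤-trans (≤-reflexive (*-comm s Y)) (÷-*-≤ T s)

      slice : ∀ b → b ≤ T → ∀ n → ∑ b (λ a → weight a b n) * Q ≤ n * P + K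
      slice b b≤T n = ≤-trans (∑-weight L b (≤-<-trans b≤T T<2^L) Q<2^L n) (+-mono-≤
        (*-monoʳ-≤ n (+-mono-≤ (+-monoˡ-≤ (5 * U) (*-monoʳ-≤ 6 b≤T)) (*-monoʳ-≤ 20 (*-monoˡ-≤ (L * L) b≤T))))
        (+-monoˡ-≤ (U * U) (*-monoʳ-≤ 5 (*-monoˡ-≤ U (*-monoˡ-≤ L b≤T)))))

      layer : ∀ b → b ≤ T → ∑ b (λ a → tailWeight a b) * Q ≤ T * L * P + (T * P + 2 * (s * K))
      layer b b≤T = begin
        ∑ b (λ a → tailWeight a b) * Q
          ≡⟨ cong (_* Q) (trans (∑-swap b T _) (∑-cong′ T (λ d → trans (sym (∑-*ˡ b (χ (d ≤? s)) (λ a → weight a b (T ÷ d) + weight a b Y))) (cong (χ (d ≤? s) *_) (∑-+ b _ _))))) ⟩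
        ∑ T (λ d → χ (d ≤? s) * (V (T ÷ d) + V Y)) * Q
          ≡⟨ trans (∑-*ʳ T Q _) (∑-cong′ T (λ d → e1 (χ (d ≤? s)) (V (T ÷ d)) (V Y) Q)) ⟩
        ∑ T (λ d → χ (d ≤? s) * (V (T ÷ d) * Q + V Y * Q))
          ≤⟨ ∑-mono T (λ d _ _ → *-monoʳ-≤ (χ (d ≤? s)) (+-mono-≤ (slice b b≤T (T ÷ d)) (slice b b≤T Y))) ⟩
        ∑ T (λ d → χ (d ≤? s) * ((T ÷ d) * P + K + (Y * P + K)))
          ≡⟨ ∑-cong′ T (λ d → e2 (χ (d ≤? s)) (T ÷ d) P K (Y * P)) ⟩
        ∑ T (λ d → χ (d ≤? s) * ((T ÷ d) * P) + χ (d ≤? s) * (Y * P + 2 * K))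
          ≤⟨ ∑-mono T (λ d _ _ → +-monoˡ-≤ (χ (d ≤? s) * (Y * P + 2 * K)) (≤-trans (*-monoˡ-≤ ((T ÷ d) * P) (χ≤1 (d ≤? s))) (≤-reflexive (*-identityˡ _)))) ⟩
        ∑ T (λ d → (T ÷ d) * P + χ (d ≤? s) * (Y * P + 2 * K))
          ≡⟨ trans (∑-+ T (λ d → (T ÷ d) * P) (λ d → χ (d ≤? s) * (Y * P + 2 * K))) (cong₂ _+_ (sym (∑-*ʳ T P (λ d → T ÷ d))) (sym (∑-*ʳ T (Y * P + 2 * K) (λ d → χ (d ≤? s))))) ⟩
        ∑ T (λ d → T ÷ d) * P + ∑ T (λ d → χ (d ≤? s)) * (Y * P + 2 * K)
          ≤⟨ +-mono-≤ (*-monoˡ-≤ P (∑-÷ L T T T<2^L)) (*-monoˡ-≤ (Y * P + 2 * K) (∑-χ-≤ T s)) ⟩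
        T * L * P + s * (Y * P + 2 * K)
          ≡⟨ cong (T * L * P +_) (e3 s Y P K) ⟩
        T * L * P + (s * Y * P + 2 * (s * K))
          ≤⟨ +-monoʳ-≤ (T * L * P) (+-monoˡ-≤ (2 * (s * K)) (*-monoˡ-≤ P sY≤T)) ⟩
        T * L * P + (T * P + 2 * (s * K)) ∎
        where
        V : ℕ → ℕ
        V n = ∑ b (λ a → weight a b n)
        e1 : ∀ x v w Q → x * (v + w) * Q ≡ x * (v * Q + w * Q)
        e1 = solve-∀
        e2 : ∀ x t P K z → x * (t * P + K + (z + K)) ≡ x * (t * P) + x * (z + 2 * K)
        e2 = solve-∀
        e3 : ∀ s Y P K → s * (Y * P + 2 * K) ≡ s * Y * P + 2 * (s * K)
        e3 = solve-∀

      1≤L² : 1 ≤ L * L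
      1≤L² = *-mono-≤ 1≤L 1≤L
      1≤L³ : 1 ≤ L * (L * L)
      1≤L³ = *-mono-≤ 1≤L 1≤L²

      P≤ : P ≤ 46 * (T * (L * L))
      P≤ = begin
        6 * T + 5 * U + 20 * (T * (L * L)) ≤⟨ +-monoˡ-≤ (20 * (T * (L * L))) (+-monoʳ-≤ (6 * T) (*-monoʳ-≤ 5 Q²≤4T)) ⟩
        6 * T + 5 * (4 * T) + 20 * (T * (L * L)) ≡⟨ e1 T (T * (L * L)) ⟩
        26 * (T * 1) + 20 * (T * (L * L)) ≤⟨ +-monoˡ-≤ (20 * (T * (L * L))) (*-monoʳ-≤ 26 (*-monoʳ-≤ T 1≤L²)) ⟩
        26 * (T * (L * L)) + 20 * (T * (L * L)) ≡⟨ e2 (T * (L * L)) ⟩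
        46 * (T * (L * L)) ∎
        where
        e1 : ∀ T x → 6 * T + 5 * (4 * T) + 20 * x ≡ 26 * (T * 1) + 20 * x
        e1 = solve-∀
        e2 : ∀ x → 26 * x + 20 * x ≡ 46 * x
        e2 = solve-∀

      -- One factor T is given up for U U = Q⁴, so that the common factor Q can be cancelled later,
      -- leaving T² Q³.
      main : T * L * P + T * P ≤ 92 * (L * (L * L) * T * (U * U))
      main = begin
        T * L * P + T * P ≡⟨ e1 T L P ⟩
        (L + 1) * (T * P) ≤⟨ *-mono-≤ (+-monoʳ-≤ L 1≤L) (*-monoʳ-≤ T P≤) ⟩
        (L + L) * (T * (46 * (T * (L * L)))) ≤⟨ *-monoʳ-≤ (L + L) (*-monoˡ-≤ (46 * (T * (L * L))) T≤Q⁴) ⟩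
        (L + L) * (U * U * (46 * (T * (L * L)))) ≡⟨ e2 L U T ⟩
        92 * (L * (L * L) * T * (U * U)) ∎
        where
        e1 : ∀ T L P → T * L * P + T * P ≡ (L + 1) * (T * P)
        e1 = solve-∀
        e2 : ∀ L U T → (L + L) * (U * U * (46 * (T * (L * L)))) ≡ 92 * (L * (L * L) * T * (U * U))
        e2 = solve-∀

      rest : 2 * (s * K) ≤ 36 * (L * (L * L) * T * (U * U))
      rest = begin
        2 * (2 * U * (5 * (T * L * U) + U * U)) ≡⟨ e1 U T L ⟩
        20 * (L * 1 * T * (U * U)) + 4 * (1 * U * (U * U)) ≤⟨ +-mono-≤ (*-monoʳ-≤ 20 (*-monoˡ-≤ (U * U) (*-monoˡ-≤ T (*-monoʳ-≤ L 1≤L²)))) (*-monoʳ-≤ 4 (*-monoˡ-≤ (U * U) (*-mono-≤ 1≤L³ Q²≤4T))) ⟩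
        20 * (L * (L * L) * T * (U * U)) + 4 * (L * (L * L) * (4 * T) * (U * U)) ≡⟨ e2 (L * (L * L)) T (U * U) ⟩
        36 * (L * (L * L) * T * (U * U)) ∎
        where
        e1 : ∀ U T L → 2 * (2 * U * (5 * (T * L * U) + U * U)) ≡ 20 * (L * 1 * T * (U * U)) + 4 * (1 * U * (U * U))
        e1 = solve-∀
        e2 : ∀ x T V → 20 * (x * T * V) + 4 * (x * (4 * T) * V) ≡ 36 * (x * T * V)
        e2 = solve-∀

    -- The right side has order T^{11/4} (log T)³; the constant is 92 + 36 from `main` and `rest`.
    ∑-tailWeight : ∑ T (λ b → ∑ b (λ a → tailWeight a b)) ≤ 128 * (L * (L * L) * (T * T) * (Q * (Q * Q)))
    ∑-tailWeight = *-cancelʳ-≤ _ _ Q {{>-nonZero (≤-trans (s≤s z≤n) 2≤Q)}} (begin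
      ∑ T (λ b → ∑ b (λ a → tailWeight a b)) * Q ≡⟨ ∑-*ʳ T Q (λ b → ∑ b (λ a → tailWeight a b)) ⟩
      ∑ T (λ b → ∑ b (λ a → tailWeight a b) * Q) ≤⟨ ∑-≤-const T _ (λ b _ → layer b) ⟩
      T * (T * L * P + (T * P + 2 * (s * K))) ≡⟨ cong (T *_) (sym (+-assoc (T * L * P) (T * P) (2 * (s * K)))) ⟩
      T * (T * L * P + T * P + 2 * (s * K)) ≤⟨ *-monoʳ-≤ T (+-mono-≤ main rest) ⟩
      T * (92 * (L * (L * L) * T * (U * U)) + 36 * (L * (L * L) * T * (U * U))) ≡⟨ e (L * (L * L)) T Q ⟩
      128 * (L * (L * L) * (T * T) * (Q * (Q * Q))) * Q ∎)
      where
      e : ∀ x T Q → T * (92 * (x * T * (Q * Q * (Q * Q))) + 36 * (x * T * (Q * Q * (Q * Q)))) ≡ 128 * (x * (T * T) * (Q * (Q * Q))) * Q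
      e = solve-∀

-- The discrepancy of a single fraction: splitting the sum over m at Y.

module HyperbolaMethod where
  open import Data.Nat.Base using (_≤_; _<_)
  open import Data.Integer.Base using (ℤ; +_; 0ℤ; -1ℤ; _+_; _*_; -_; _-_; ∣_∣; _^_; _⊖_)
  open import Data.Integer.Tactic.RingSolver using (solve-∀)
  open import Data.List.Base using (length)
  open import Data.List.Relation.Unary.Unique.DecPropositional ℕ._≟_ using (unique?)
  open import Data.Nat.Primality.Factorisation using (factorise; factors)
  open MoebiusInversion
  open ResidueSums using (module Residue; ∑-mono; Near; module Weight; Scale; module Scale; module Total)
  open Σℤ

  ∣∑∣≤ : ∀ n f → ∣ ∑ n f ∣ ≤ Σℕ.∑ n (λ i → ∣ f i ∣)
  ∣∑∣≤ zero    f = z≤n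
  ∣∑∣≤ (suc n) f = ℕ.≤-trans (ℤ.∣i+j∣≤∣i∣+∣j∣ (∑ n f) (f (suc n))) (ℕ.+-monoˡ-≤ ∣ f (suc n) ∣ (∣∑∣≤ n f))

  ∑-pos : ∀ n f → ∑ n (λ i → + f i) ≡ + Σℕ.∑ n f
  ∑-pos zero    f = refl
  ∑-pos (suc n) f = cong (_+ + f (suc n)) (∑-pos n f)

  ∣μ₀∣≤1 : ∀ n → ∣ μ₀ n ∣ ≤ 1
  ∣μ₀∣≤1 zero    = z≤n
  ∣μ₀∣≤1 (suc n) = subst (λ z → ∣ z ∣ ≤ 1) (sym (μ₀-factors (suc n) (factorise (suc n)))) (go (factors (factorise (suc n))))
    where
    pow : ∀ k → ∣ -1ℤ ^ k ∣ ≤ 1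
    pow zero    = ℕ.≤-refl
    pow (suc k) = ℕ.≤-trans (ℕ.≤-reflexive (trans (ℤ.∣i*j∣≡∣i∣*∣j∣ -1ℤ (-1ℤ ^ k)) (ℕ.*-identityˡ _))) (pow k)
    go : ∀ l → ∣ μ-list l ∣ ≤ 1
    go l with unique? l
    ... | yes _ = pow (length l)
    ... | no  _ = z≤n

  ∣⊖∣≤ : ∀ {k} m n → Near k m n → ∣ + m - + n ∣ ≤ k
  ∣⊖∣≤ {k} m n (p , q) = subst (λ z → ∣ z ∣ ≤ k) (sym (ℤ.[+m]-[+n]≡m⊖n m n)) bound
    where
    bound : ∣ m ⊖ n ∣ ≤ k
    bound with ℕ.≤-total m n
    ... | inj₁ m≤n = ℕ.≤-trans (ℕ.≤-reflexive (ℤ.∣⊖∣-≤ m≤n)) (ℕ.m≤n+o⇒m∸n≤o n m q)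
    ... | inj₂ n≤m = ℕ.≤-trans (ℕ.≤-reflexive (trans (cong ∣_∣ (ℤ.⊖-≥ n≤m)) refl)) (ℕ.m≤n+o⇒m∸n≤o m n p)

  module Hyperbola {T Q L : ℕ} (scale : Scale T Q L) where
    open Scale scale
    open Total scale
    open Weight Q 2≤Q

    mertensSum : ℕ
    mertensSum = Σℕ.∑ Y (λ m → ∣ M (T ÷ m) ∣)

    module _ (a b : ℕ) (1≤a : 1 ≤ a) (a≤b : a ≤ b) where
      private
        A = a ℕ.* a
        B = b ℕ.* b
        1≤B : 1 ≤ B
        1≤B = ℕ.*-mono-≤ (ℕ.≤-trans 1≤a a≤b) (ℕ.≤-trans 1≤a a≤b)
        A≤B : A ≤ B
        A≤B = ℕ.*-mono-≤ a≤b a≤b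
        N Φ : ℤ
        N = coprimeCount A B T
        Φ = coprimeCount 1 1 T
      open Residue A B

      private
        -- This is 2{A m/B} - 1 with the denominator B cleared.
        σ : ℕ → ℤ
        σ m = + (2 ℕ.* ρ m) - + B

        R : ℕ → ℤ
        R n = ∑ n σ

        R≡ : ∀ n → R n ≡ + (2 ℕ.* Σℕ.∑ n ρ) - + (n ℕ.* B)
        R≡ zero    = refl
        R≡ (suc n) = begin
          R n + σ (suc n) ≡⟨ cong (_+ σ (suc n)) (R≡ n) ⟩
          (+ (2 ℕ.* x) - + (n ℕ.* B)) + (+ (2 ℕ.* y) - + B) ≡⟨ e (+ (2 ℕ.* x)) (+ (n ℕ.* B)) (+ (2 ℕ.* y)) (+ B) ⟩
          (+ (2 ℕ.* x) + + (2 ℕ.* y)) - (+ B + + (n ℕ.* B)) ≡⟨ cong (λ u → + u - + (suc n ℕ.* B)) (ℕ.*-distribˡ-+ 2 x y) ⟨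
          + (2 ℕ.* (x ℕ.+ y)) - + (suc n ℕ.* B) ∎
          where
          open ≡-Reasoning
          x = Σℕ.∑ n ρ
          y = ρ (suc n)
          e : ∀ x y z w → (x - y) + (z - w) ≡ (x + z) - (w + y)
          e = solve-∀

        ∣R∣≤ : ∀ n → ∣ R n ∣ ≤ B ℕ.* weight a b n
        ∣R∣≤ n = subst (λ z → ∣ z ∣ ≤ B ℕ.* weight a b n) (sym (R≡ n)) (∣⊖∣≤ _ _ (Dev-weight a b 1≤a a≤b n))

        ∣σ∣≤ : ∀ m → ∣ σ m ∣ ≤ B
        ∣σ∣≤ m = ∣⊖∣≤ (2 ℕ.* ρ m) B
          (ℕ.≤-trans (ℕ.*-monoʳ-≤ 2 (ρ≤ 1≤B m)) (ℕ.≤-reflexive (cong (B ℕ.+_) (ℕ.+-identityʳ B))) , ℕ.m≤n+m B (2 ℕ.* ρ m))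

        -- Both counts are expanded in the M(T/m), with coefficients m and ⌊A m/B⌋. The combination
        -- A m - B ⌊A m/B⌋ is ρ m, and 2 ρ m = σ m + B; the terms with B add up to B by `∑-M`.
        identity : + 2 * (+ A * Φ - + B * N) ≡ + B + ∑ T (λ m → σ m * M (T ÷ m))
        identity = begin
          + 2 * (+ A * Φ - + B * N)
            ≡⟨ cong₂ (λ u v → + 2 * (+ A * u - + B * v)) (coprimeCount≡∑M 1 1 T ℕ.≤-refl ℕ.≤-refl) (coprimeCount≡∑M A B T 1≤B A≤B) ⟩
          + 2 * (+ A * ∑ T (λ m → + (1 ℕ.* m ÷ 1) * mm m) - + B * ∑ T (λ m → + f m * mm m))
            ≡⟨ e1 (+ A) (∑ T (λ m → + (1 ℕ.* m ÷ 1) * mm m)) (+ B) (∑ T (λ m → + f m * mm m)) ⟩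
          (+ 2 * + A) * ∑ T (λ m → + (1 ℕ.* m ÷ 1) * mm m) + (- (+ 2 * + B)) * ∑ T (λ m → + f m * mm m)
            ≡⟨ trans (cong₂ _+_ (∑-*ˡ T (+ 2 * + A) _) (∑-*ˡ T (- (+ 2 * + B)) _)) (sym (∑-+ T _ _)) ⟩
          ∑ T (λ m → (+ 2 * + A) * (+ (1 ℕ.* m ÷ 1) * mm m) + (- (+ 2 * + B)) * (+ f m * mm m))
            ≡⟨ ∑-cong′ T term ⟩
          ∑ T (λ m → + B * mm m + σ m * mm m)
            ≡⟨ trans (∑-+ T _ _) (cong (_+ ∑ T (λ m → σ m * mm m)) (trans (sym (∑-*ˡ T (+ B) mm)) (trans (cong (λ u → + B * u) (∑-M T 1≤T)) (ℤ.*-identityʳ (+ B))))) ⟩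
          + B + ∑ T (λ m → σ m * mm m) ∎
          where
          open ≡-Reasoning
          mm : ℕ → ℤ
          mm m = M (T ÷ m)
          f : ℕ → ℕ
          f m = A ℕ.* m ÷ B
          e1 : ∀ a x b y → + 2 * (a * x - b * y) ≡ (+ 2 * a) * x + (- (+ 2 * b)) * y
          e1 = solve-∀
          e2 : ∀ a m b f r z → a * m ≡ r + f * b → (+ 2 * a) * (m * z) + (- (+ 2 * b)) * (f * z) ≡ b * z + (+ 2 * r - b) * z
          e2 a m b f r z h = trans (e3 a m b f z) (trans (cong (λ u → (+ 2 * u - + 2 * (f * b)) * z) h) (e4 b f r z))
            where
            e3 : ∀ a m b f z → (+ 2 * a) * (m * z) + (- (+ 2 * b)) * (f * z) ≡ (+ 2 * (a * m) - + 2 * (f * b)) * z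
            e3 = solve-∀
            e4 : ∀ b f r z → (+ 2 * (r + f * b) - + 2 * (f * b)) * z ≡ b * z + (+ 2 * r - b) * z
            e4 = solve-∀
          term : ∀ m → (+ 2 * + A) * (+ (1 ℕ.* m ÷ 1) * mm m) + (- (+ 2 * + B)) * (+ f m * mm m) ≡ + B * mm m + σ m * mm m
          term m = trans (cong (λ u → (+ 2 * + A) * (+ u * mm m) + (- (+ 2 * + B)) * (+ f m * mm m)) (trans (÷-1 (1 ℕ.* m)) (ℕ.*-identityˡ m)))
            (trans (e2 (+ A) (+ m) (+ B) (+ f m) (+ ρ m) (mm m) (trans (sym (ℤ.pos-* A m)) (trans (cong +_ (sym (ρ+ m))) (cong (λ u → + ρ m + u) (ℤ.pos-* (f m) B)))))
              (cong (λ u → + B * mm m + (u - + B) * mm m) (sym (ℤ.pos-* 2 (ρ m)))))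

        σ> : ℕ → ℤ
        σ> m = χ (¬? (m ℕ.≤? Y)) * σ m

        R>-small : ∀ n → n ≤ Y → ∑ n σ> ≡ 0ℤ
        R>-small n n≤Y = ∑-zero n (λ m _ m≤n → cong (_* σ m) (χ-no (¬? (m ℕ.≤? Y)) (λ m≰Y → m≰Y (ℕ.≤-trans m≤n n≤Y))))

        σ-split : ∀ m → σ m ≡ χ (m ℕ.≤? Y) * σ m + σ> m
        σ-split m = trans (sym (ℤ.*-identityˡ (σ m))) (trans (cong (_* σ m) (sym (χ-complement (m ℕ.≤? Y)))) (ℤ.*-distribʳ-+ (σ m) (χ (m ℕ.≤? Y)) (χ (¬? (m ℕ.≤? Y)))))

        R>-large : ∀ n → Y ≤ n → ∣ ∑ n σ> ∣ ≤ B ℕ.* (weight a b n ℕ.+ weight a b Y)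
        R>-large n Y≤n = begin
          ∣ ∑ n σ> ∣ ≡⟨ cong ∣_∣ (trans (e (R Y) (∑ n σ>)) (cong (_- R Y) (sym R-split))) ⟩
          ∣ R n - R Y ∣ ≤⟨ ℤ.∣i-j∣≤∣i∣+∣j∣ (R n) (R Y) ⟩
          ∣ R n ∣ ℕ.+ ∣ R Y ∣ ≤⟨ ℕ.+-mono-≤ (∣R∣≤ n) (∣R∣≤ Y) ⟩
          B ℕ.* weight a b n ℕ.+ B ℕ.* weight a b Y ≡⟨ ℕ.*-distribˡ-+ B (weight a b n) (weight a b Y) ⟨
          B ℕ.* (weight a b n ℕ.+ weight a b Y) ∎
          where
          open ℕ.≤-Reasoning
          e : ∀ x y → y ≡ (x + y) - x
          e = solve-∀
          R-split : R n ≡ R Y + ∑ n σ>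
          R-split = trans (∑-cong′ n σ-split) (trans (∑-+ n _ _) (cong (_+ ∑ n σ>) (∑-≤ σ Y≤n)))

        1≤s : 1 ≤ s
        1≤s = ℕ.≤-trans (s≤s z≤n) (ℕ.*-monoʳ-≤ 2 (ℕ.*-mono-≤ 2≤Q 2≤Q))

        -- For d > s no m with Y < m ≤ T/d exists, since T/d ≤ T/s; this confines the Möbius sum to
        -- d ≤ s.
        R>≤ : ∀ d → 1 ≤ d → ∣ ∑ (T ÷ d) σ> ∣ ≤ B ℕ.* (Σℕ.χ (d ℕ.≤? s) ℕ.* (weight a b (T ÷ d) ℕ.+ weight a b Y))
        R>≤ d 1≤d with ℕ.≤-total (T ÷ d) Y
        ... | inj₁ small = ℕ.≤-trans (ℕ.≤-reflexive (cong ∣_∣ (R>-small (T ÷ d) small))) z≤n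
        ... | inj₂ large = go (d ℕ.≤? s)
          where
          go : (dec : Dec (d ≤ s)) → ∣ ∑ (T ÷ d) σ> ∣ ≤ B ℕ.* (Σℕ.χ dec ℕ.* (weight a b (T ÷ d) ℕ.+ weight a b Y))
          go (yes _)  = subst (λ z → ∣ ∑ (T ÷ d) σ> ∣ ≤ B ℕ.* z) (sym (ℕ.*-identityˡ _)) (R>-large (T ÷ d) large)
          go (no d≰s) = ℕ.≤-trans (ℕ.≤-reflexive (cong ∣_∣ (R>-small (T ÷ d) (÷-anti-≤ T 1≤s (ℕ.<⇒≤ (ℕ.≰⇒> d≰s)))))) z≤n

        -- For small m the residues are bounded trivially and the whole saving is left to M(T/m).
        head-bound : ∣ ∑ Y (λ m → σ m * M (T ÷ m)) ∣ ≤ B ℕ.* mertensSum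
        head-bound = begin
          ∣ ∑ Y (λ m → σ m * M (T ÷ m)) ∣ ≤⟨ ∣∑∣≤ Y _ ⟩
          Σℕ.∑ Y (λ m → ∣ σ m * M (T ÷ m) ∣) ≤⟨ ∑-mono Y (λ m _ _ → ℕ.≤-trans (ℕ.≤-reflexive (ℤ.∣i*j∣≡∣i∣*∣j∣ (σ m) (M (T ÷ m)))) (ℕ.*-monoˡ-≤ ∣ M (T ÷ m) ∣ (∣σ∣≤ m))) ⟩
          Σℕ.∑ Y (λ m → B ℕ.* ∣ M (T ÷ m) ∣) ≡⟨ Σℕ.∑-*ˡ Y B (λ m → ∣ M (T ÷ m) ∣) ⟨
          B ℕ.* mertensSum ∎
          where open ℕ.≤-Reasoning

        -- For large m the roles are exchanged: M(T/m) is opened into its Möbius sum, where |μ| ≤ 1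
        -- suffices, and the saving comes from the inner sum of residues.
        tail-bound : ∣ ∑ T (λ m → σ> m * M (T ÷ m)) ∣ ≤ B ℕ.* tailWeight a b
        tail-bound = begin
          ∣ ∑ T (λ m → σ> m * M (T ÷ m)) ∣
            ≡⟨ cong ∣_∣ (trans (∑-cong′ T (λ m → cong (σ> m *_) (M≡∑μ₀ (T ÷ m)))) (trans (sym (∑-*≤-∑ T σ> μ₀)) (∑-cong T (λ d 1≤d _ → cong (μ₀ d *_) (inner d 1≤d))))) ⟩
          ∣ ∑ T (λ d → μ₀ d * ∑ (T ÷ d) σ>) ∣
            ≤⟨ ∣∑∣≤ T _ ⟩
          Σℕ.∑ T (λ d → ∣ μ₀ d * ∑ (T ÷ d) σ> ∣)
            ≤⟨ ∑-mono T (λ d 1≤d _ → ℕ.≤-trans (ℕ.≤-reflexive (ℤ.∣i*j∣≡∣i∣*∣j∣ (μ₀ d) (∑ (T ÷ d) σ>))) (ℕ.≤-trans (ℕ.*-mono-≤ (∣μ₀∣≤1 d) (R>≤ d 1≤d)) (ℕ.≤-reflexive (ℕ.*-identityˡ _)))) ⟩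
          Σℕ.∑ T (λ d → B ℕ.* (Σℕ.χ (d ℕ.≤? s) ℕ.* (weight a b (T ÷ d) ℕ.+ weight a b Y)))
            ≡⟨ Σℕ.∑-*ˡ T B (λ d → Σℕ.χ (d ℕ.≤? s) ℕ.* (weight a b (T ÷ d) ℕ.+ weight a b Y)) ⟨
          B ℕ.* tailWeight a b ∎
          where
          open ℕ.≤-Reasoning
          inner : ∀ d → 1 ≤ d → ∑ T (λ m → χ (d ℕ.* m ℕ.≤? T) * σ> m) ≡ ∑ (T ÷ d) σ>
          inner d 1≤d = trans (∑-cong′ T (λ m → cong (λ z → χ (z ℕ.≤? T) * σ> m) (ℕ.*-comm d m))) (∑-*≤ T σ> 1≤d)

      discrepancy : ∣ + 2 * (+ (a ℕ.* a) * coprimeCount 1 1 T - + (b ℕ.* b) * coprimeCount (a ℕ.* a) (b ℕ.* b) T) ∣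
                    ≤ b ℕ.* b ℕ.* (1 ℕ.+ mertensSum ℕ.+ tailWeight a b)
      discrepancy = begin
        ∣ + 2 * (+ A * Φ - + B * N) ∣
          ≡⟨ cong ∣_∣ (trans identity (cong (λ u → + B + u) split)) ⟩
        ∣ + B + (head + tail) ∣
          ≤⟨ ℕ.≤-trans (ℤ.∣i+j∣≤∣i∣+∣j∣ (+ B) (head + tail)) (ℕ.+-monoʳ-≤ B (ℤ.∣i+j∣≤∣i∣+∣j∣ head tail)) ⟩
        B ℕ.+ (∣ head ∣ ℕ.+ ∣ tail ∣)
          ≤⟨ ℕ.+-monoʳ-≤ B (ℕ.+-mono-≤ head-bound tail-bound) ⟩
        B ℕ.+ (B ℕ.* mertensSum ℕ.+ B ℕ.* tailWeight a b)
          ≡⟨ cong (B ℕ.+_) (sym (ℕ.*-distribˡ-+ B mertensSum (tailWeight a b))) ⟩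
        B ℕ.+ B ℕ.* (mertensSum ℕ.+ tailWeight a b)
          ≡⟨ ℕ.*-suc B (mertensSum ℕ.+ tailWeight a b) ⟨
        B ℕ.* (1 ℕ.+ mertensSum ℕ.+ tailWeight a b) ∎
        where
        open ℕ.≤-Reasoning
        head = ∑ Y (λ m → σ m * M (T ÷ m))
        tail = ∑ T (λ m → σ> m * M (T ÷ m))
        split : ∑ T (λ m → σ m * M (T ÷ m)) ≡ head + tail
        split = trans (∑-cong′ T (λ m → trans (cong (_* M (T ÷ m)) (σ-split m)) (ℤ.*-distribʳ-+ (M (T ÷ m)) (χ (m ℕ.≤? Y) * σ m) (σ> m))))
          (trans (∑-+ T _ _) (cong (_+ tail) (trans (∑-cong′ T (λ m → ℤ.*-assoc (χ (m ℕ.≤? Y)) (σ m) (M (T ÷ m)))) (∑-≤ (λ m → σ m * M (T ÷ m)) (÷≤ T s)))))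

open import Data.Rational.Base using (ℚ; 0ℚ; 1ℚ; ½; _/_; _+_; _*_; _-_; -_; _≤_; _<_; ∣_∣; positive)
import Data.Rational.Properties as ℚ
open import Data.Rational.Solver using (module +-*-Solver)
open +-*-Solver using (solve; _:=_; _:+_; _:*_; _:-_; :-_; con)

-- From lists of Farey fractions to coprime counts, and the error summed over all fractions.

module FareySum where
  open import Data.Nat.Base using (_∸_)
  open import Data.Integer.Base using (ℤ; +_)
  open import Data.Nat.Divisibility using (_∣_; ∣m+n∣m⇒∣n)
  open import Data.Nat.ListAction using (sum)
  open import Data.Nat.ListAction.Properties using (sum-++)
  open import Data.Rational.Properties using (_≤?_)
  import Data.Rational.Unnormalised.Base as ℚᵘ
  import Data.Rational.Unnormalised.Properties as ℚᵘ
  open import Data.List.Base using (List; []; _∷_; _++_; [_]; map; filter; concatMap; concat; upTo; length)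
  open import Data.List.Properties using (applyUpTo-∷ʳ; map-++; concat-++; ++-identityʳ; filter-++; length-++)
  open MoebiusInversion using (module Σℤ; coprimeCount)
  open ResidueSums using (∑-mono; ∑-≤-const; Near; Scale; module Total)
  open HyperbolaMethod

  /≡*recip : ∀ a d → + a / suc d ≡ fromℕ a * recip d
  /≡*recip a d = ℚ.toℚᵘ-injective (ℚᵘ.≃-trans (ℚ.toℚᵘ-fromℚᵘ (ℚᵘ.mkℚᵘ (+ a) d)) (ℚᵘ.≃-sym (ℚᵘ.≃-trans (ℚ.toℚᵘ-homo-* (fromℕ a) (recip d))
    (ℚᵘ.≃-trans (ℚᵘ.*-cong (ℚ.toℚᵘ-fromℚᵘ (ℚᵘ.mkℚᵘ (+ a) 0)) (ℚ.toℚᵘ-fromℚᵘ (ℚᵘ.mkℚᵘ (+ 1) d)))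
    (ℚᵘ.*≡* (trans (cong (ℤ._* + suc d) (ℤ.*-identityʳ (+ a))) (cong (λ z → + a ℤ.* + z) (sym (ℕ.+-identityʳ (suc d))))))))))

  fromℕ-cancel-≤ : ∀ {m n} → fromℕ m ≤ fromℕ n → m ℕ.≤ n
  fromℕ-cancel-≤ {m} {n} h with m ℕ.≤? n
  ... | yes m≤n = m≤n
  ... | no  m≰n = contradiction
    (ℚ.<-≤-trans (subst (_< 1ℚ + fromℕ n) (ℚ.+-identityˡ (fromℕ n)) (ℚ.+-monoˡ-< (fromℕ n) (ℚ.positive⁻¹ 1ℚ)))
      (ℚ.≤-trans (subst (_≤ fromℕ m) (fromℕ-suc n) (fromℕ-mono (ℕ.≰⇒> m≰n))) h))
    (ℚ.<-irrefl refl)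

  layerPrefix : ℕ → ℕ → List ℚ
  layerPrefix d n = map (λ a → + a / suc d) (filter (λ a → coprime? a (suc d)) (upTo n))

  fareyLayer : ℕ → List ℚ
  fareyLayer d = layerPrefix d (suc d)

  layerPiece : ℕ → ℕ → List ℚ
  layerPiece d n = map (λ a → + a / suc d) (filter (λ a → coprime? a (suc d)) [ n ])

  farey-suc : ∀ T → farey (suc T) ≡ farey T ++ fareyLayer T
  farey-suc T = trans (cong (concatMap fareyLayer) (sym (applyUpTo-∷ʳ (λ i → i) T)))
    (trans (cong concat (map-++ fareyLayer (upTo T) [ T ]))
    (trans (sym (concat-++ (map fareyLayer (upTo T)) [ fareyLayer T ])) (cong (farey T ++_) (++-identityʳ (fareyLayer T)))))

  layerPrefix-suc : ∀ d n → layerPrefix d (suc n) ≡ layerPrefix d n ++ layerPiece d n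
  layerPrefix-suc d n = trans (cong (λ l → map h (filter q? l)) (sym (applyUpTo-∷ʳ (λ i → i) n)))
    (trans (cong (map h) (filter-++ q? (upTo n) [ n ])) (map-++ h (filter q? (upTo n)) (filter q? [ n ])))
    where
    h = λ a → + a / suc d
    q? = λ a → coprime? a (suc d)

  module _ {P : Pred ℚ 0ℓ} (P? : Decidable P) where
    private
      count : List ℚ → ℕ
      count l = length (filter P? l)

      count-++ : ∀ xs ys → count (xs ++ ys) ≡ count xs ℕ.+ count ys
      count-++ xs ys = trans (cong length (filter-++ P? xs ys)) (length-++ (filter P? xs))

      count-single : ∀ {Q : Pred ℕ 0ℓ} (Q? : Decidable Q) (h : ℕ → ℚ) n →
                     count (map h (filter Q? [ n ])) ≡ Σℕ.χ (Q? n) ℕ.* Σℕ.χ (P? (h n))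
      count-single Q? h n with Q? n
      ... | no  _ = refl
      ... | yes _ with P? (h n)
      ...   | yes _ = refl
      ...   | no  _ = refl

      count-prefix : ∀ d n → count (layerPrefix d n) ≡ Σℕ.∑ n (λ c → Σℕ.χ (coprime? (pred c) (suc d)) ℕ.* Σℕ.χ (P? (+ pred c / suc d)))
      count-prefix d zero    = refl
      count-prefix d (suc n) = trans (cong count (layerPrefix-suc d n)) (trans (count-++ (layerPrefix d n) (layerPiece d n))
        (cong₂ ℕ._+_ (count-prefix d n) (count-single (λ a → coprime? a (suc d)) (λ a → + a / suc d) n)))

    -- Sums start at 1 but numerators at 0, hence `pred c`; `suc (pred e)` equals e in the range of
    -- summation and is visibly nonzero.
    count-farey : ∀ T → length (filter P? (farey T)) ≡
      Σℕ.∑ T (λ e → Σℕ.∑ (suc (pred e)) (λ c → Σℕ.χ (coprime? (pred c) (suc (pred e))) ℕ.* Σℕ.χ (P? (+ pred c / suc (pred e)))))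
    count-farey zero    = refl
    count-farey (suc T) = trans (cong count (farey-suc T)) (trans (count-++ (farey T) (fareyLayer T)) (cong₂ ℕ._+_ (count-farey T) (count-prefix T (suc T))))

  χ-pos : ∀ {P : Set} (d : Dec P) → + Σℕ.χ d ≡ Σℤ.χ d
  χ-pos (yes _) = refl
  χ-pos (no  _) = refl

  coprime-∸ : ∀ {c e} → c ℕ.≤ e → Coprime (e ∸ c) e → Coprime c e
  coprime-∸ {c} {e} c≤e h (d∣c , d∣e) = h (∣m+n∣m⇒∣n (subst (_ ∣_) (sym (ℕ.m+[n∸m]≡n c≤e)) d∣e) d∣c , d∣e)

  coprime-∸′ : ∀ {c e} → c ℕ.≤ e → Coprime c e → Coprime (e ∸ c) e
  coprime-∸′ {c} {e} c≤e h (d∣e∸c , d∣e) = h (∣m+n∣m⇒∣n (subst (_ ∣_) (sym (ℕ.m∸n+n≡m c≤e)) d∣e) d∣e∸c , d∣e)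

  -- A fraction (e - c)/e of the Farey sequence is counted through its reflection c/e.
  count-reflected : ∀ {P : Pred ℚ 0ℓ} (P? : Decidable P) A B T → 1 ℕ.≤ B → A ℕ.≤ B →
    (∀ c k → c ℕ.≤ suc k → P (+ (suc k ∸ c) / suc k) → c ℕ.* B ℕ.≤ A ℕ.* suc k) →
    (∀ c k → c ℕ.≤ suc k → c ℕ.* B ℕ.≤ A ℕ.* suc k → P (+ (suc k ∸ c) / suc k)) →
    + length (filter P? (farey T)) ≡ coprimeCount A B T
  count-reflected P? A B T 1≤B A≤B to from = trans (cong +_ (count-farey P? T)) (trans (sym (∑-pos T _)) (Σℤ.∑-cong T row))
    where
    open ≡-Reasoning
    row : ∀ e → 1 ℕ.≤ e → e ℕ.≤ T →
          + Σℕ.∑ (suc (pred e)) (λ c → Σℕ.χ (coprime? (pred c) (suc (pred e))) ℕ.* Σℕ.χ (P? (+ pred c / suc (pred e))))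
          ≡ Σℤ.∑ T (λ c → Σℤ.χ (coprime? c e) ℤ.* Σℤ.χ (c ℕ.* B ℕ.≤? A ℕ.* e))
    row e@(suc k) _ e≤T = begin
      + Σℕ.∑ e (λ c → Σℕ.χ (coprime? (pred c) e) ℕ.* Σℕ.χ (P? (+ pred c / e)))
        -- The reversal turns the numerator c - 1 into e - c, which is the reflection ζ ↦ 1 - ζ for
        -- the fraction c/e.
        ≡⟨ cong +_ (Σℕ.∑-reverse e (λ c → Σℕ.χ (coprime? (pred c) e) ℕ.* Σℕ.χ (P? (+ pred c / e)))) ⟩
      + Σℕ.∑ e (λ c → Σℕ.χ (coprime? (pred (suc e ∸ c)) e) ℕ.* Σℕ.χ (P? (+ pred (suc e ∸ c) / e)))
        ≡⟨ sym (∑-pos e _) ⟩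
      Σℤ.∑ e (λ c → + (Σℕ.χ (coprime? (pred (suc e ∸ c)) e) ℕ.* Σℕ.χ (P? (+ pred (suc e ∸ c) / e))))
        ≡⟨ Σℤ.∑-cong e cell ⟩
      Σℤ.∑ e (λ c → Σℤ.χ (coprime? c e) ℤ.* Σℤ.χ (c ℕ.* B ℕ.≤? A ℕ.* e))
        ≡⟨ Σℤ.∑-≤ (λ c → Σℤ.χ (coprime? c e) ℤ.* Σℤ.χ (c ℕ.* B ℕ.≤? A ℕ.* e)) e≤T ⟨
      Σℤ.∑ T (λ c → Σℤ.χ (c ℕ.≤? e) ℤ.* (Σℤ.χ (coprime? c e) ℤ.* Σℤ.χ (c ℕ.* B ℕ.≤? A ℕ.* e)))
        ≡⟨ Σℤ.∑-cong′ T (λ c → absorb c (c ℕ.≤? e)) ⟩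
      Σℤ.∑ T (λ c → Σℤ.χ (coprime? c e) ℤ.* Σℤ.χ (c ℕ.* B ℕ.≤? A ℕ.* e)) ∎
      where
      cell : ∀ c → 1 ℕ.≤ c → c ℕ.≤ e →
             + (Σℕ.χ (coprime? (pred (suc e ∸ c)) e) ℕ.* Σℕ.χ (P? (+ pred (suc e ∸ c) / e)))
             ≡ Σℤ.χ (coprime? c e) ℤ.* Σℤ.χ (c ℕ.* B ℕ.≤? A ℕ.* e)
      cell c _ c≤e = trans (cong (λ z → + (Σℕ.χ (coprime? z e) ℕ.* Σℕ.χ (P? (+ z / e)))) (cong pred (ℕ.+-∸-assoc 1 c≤e)))
        (trans (ℤ.pos-* (Σℕ.χ (coprime? (e ∸ c) e)) (Σℕ.χ (P? (+ (e ∸ c) / e))))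
          (cong₂ ℤ._*_
            (trans (χ-pos (coprime? (e ∸ c) e)) (Σℤ.χ-cong (coprime? (e ∸ c) e) (coprime? c e) (coprime-∸ c≤e) (coprime-∸′ c≤e)))
            (trans (χ-pos (P? (+ (e ∸ c) / e))) (Σℤ.χ-cong (P? (+ (e ∸ c) / e)) (c ℕ.* B ℕ.≤? A ℕ.* e) (to c k c≤e) (from c k c≤e)))))
      absorb : ∀ c (dec : Dec (c ℕ.≤ e)) →
               Σℤ.χ dec ℤ.* (Σℤ.χ (coprime? c e) ℤ.* Σℤ.χ (c ℕ.* B ℕ.≤? A ℕ.* e)) ≡ Σℤ.χ (coprime? c e) ℤ.* Σℤ.χ (c ℕ.* B ℕ.≤? A ℕ.* e)
      absorb c (yes _)  = ℤ.*-identityˡ _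
      absorb c (no c≰e) = sym (trans (cong (Σℤ.χ (coprime? c e) ℤ.*_) (Σℤ.χ-no (c ℕ.* B ℕ.≤? A ℕ.* e) tooLarge)) (ℤ.*-zeroʳ (Σℤ.χ (coprime? c e))))
        where
        tooLarge : ¬ c ℕ.* B ℕ.≤ A ℕ.* e
        tooLarge h = c≰e (ℕ.*-cancelʳ-≤ c e B {{ℕ.>-nonZero 1≤B}} (ℕ.≤-trans h (ℕ.≤-trans (ℕ.*-monoˡ-≤ e A≤B) (ℕ.≤-reflexive (ℕ.*-comm B e)))))

  -- For a predicate that always holds, the reflected fractions fill (0, 1], which is the slope A/B
  -- = 1.
  F≡coprimeCount : ∀ T → + F T ≡ coprimeCount 1 1 T
  F≡coprimeCount T = trans (cong +_ (cong length (sym (all-farey (farey T))))) (count-reflected (λ _ → yes refl) 1 1 T ℕ.≤-refl ℕ.≤-refl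
      (λ c k c≤ _ → subst₂ ℕ._≤_ (sym (ℕ.*-identityʳ c)) (sym (ℕ.*-identityˡ (suc k))) c≤) (λ _ _ _ _ → refl))
    where
    all-farey : (l : List ℚ) → filter {P = λ _ → 0 ≡ 0} (λ _ → yes refl) l ≡ l
    all-farey []      = refl
    all-farey (x ∷ l) = cong (x ∷_) (all-farey l)

  nearOne? : ∀ ξ → Decidable (λ ζ → 1ℚ - ξ * ξ ≤ ζ × ζ ≤ 1ℚ)
  nearOne? ξ ζ = (1ℚ - ξ * ξ ≤? ζ) ×-dec (ζ ≤? 1ℚ)

  nearOneCount : ℕ → ℚ → ℕ
  nearOneCount T ξ = length (filter (nearOne? ξ) (farey T))

  module _ (a d : ℕ) (a≤ : a ℕ.≤ suc d) where
    private
      A = a ℕ.* a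
      B = suc d ℕ.* suc d
      ξ = + a / suc d
      r = recip d
      ξ≡ : ξ ≡ fromℕ a * r
      ξ≡ = /≡*recip a d
      A≤B : A ℕ.≤ B
      A≤B = ℕ.*-mono-≤ a≤ a≤

    fromℕ-B*r² : fromℕ B * (r * r) ≡ 1ℚ
    fromℕ-B*r² = trans (cong (_* (r * r)) (fromℕ-* (suc d) (suc d)))
      (trans (solve 2 (λ b r → b :* b :* (r :* r) := (r :* b) :* (r :* b)) refl (fromℕ (suc d)) r)
      (trans (cong (λ z → z * z) (recip-inverse d)) (ℚ.*-identityˡ 1ℚ)))

    ξ²≡ : ξ * ξ ≡ fromℕ A * (r * r)
    ξ²≡ = trans (cong (λ z → z * z) ξ≡) (trans (solve 2 (λ a r → a :* r :* (a :* r) := a :* a :* (r :* r)) refl (fromℕ a) r) (cong (_* (r * r)) (sym (fromℕ-* a a))))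

    private
      module _ (c k : ℕ) (c≤ : c ℕ.≤ suc k) where
        open ℚ.≤-Reasoning
        e = suc k
        t = recip k
        ζ = + (e ∸ c) / e

        ζ≡ : ζ ≡ 1ℚ - fromℕ c * t
        ζ≡ = trans (/≡*recip (e ∸ c) k) (trans (solve 3 (λ x c t → x :* t := (x :+ c) :* t :- c :* t) refl (fromℕ (e ∸ c)) (fromℕ c) t)
          (cong (_- fromℕ c * t) (trans (cong (_* t) (trans (sym (fromℕ-+ (e ∸ c) c)) (cong fromℕ (ℕ.m∸n+n≡m c≤)))) (trans (ℚ.*-comm (fromℕ e) t) (recip-inverse k)))))

        neg-cancel : ∀ x y → 1ℚ - x ≤ 1ℚ - y → y ≤ x
        neg-cancel x y h = begin
          y ≡⟨ solve 2 (λ x y → y := (con 1ℚ :- x) :+ (x :+ y :- con 1ℚ)) refl x y ⟩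
          (1ℚ - x) + (x + y - 1ℚ) ≤⟨ ℚ.+-monoˡ-≤ (x + y - 1ℚ) h ⟩
          (1ℚ - y) + (x + y - 1ℚ) ≡⟨ solve 2 (λ x y → (con 1ℚ :- y) :+ (x :+ y :- con 1ℚ) := x) refl x y ⟩
          x ∎

        near⇒ : 1ℚ - ξ * ξ ≤ ζ × ζ ≤ 1ℚ → c ℕ.* B ℕ.≤ A ℕ.* e
        near⇒ (h , _) = fromℕ-cancel-≤ (begin
          fromℕ (c ℕ.* B) ≡⟨ fromℕ-* c B ⟩
          fromℕ c * fromℕ B ≡⟨ cong (_* fromℕ B) (ℚ.*-identityʳ (fromℕ c)) ⟨
          fromℕ c * 1ℚ * fromℕ B ≡⟨ cong (λ z → fromℕ c * z * fromℕ B) (recip-inverse k) ⟨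
          fromℕ c * (t * fromℕ e) * fromℕ B ≡⟨ solve 4 (λ c t e b → c :* (t :* e) :* b := c :* t :* (b :* e)) refl (fromℕ c) t (fromℕ e) (fromℕ B) ⟩
          fromℕ c * t * (fromℕ B * fromℕ e) ≤⟨ *-monoʳ {fromℕ c * t} {ξ * ξ} (fromℕ B * fromℕ e) (0≤* (0≤fromℕ B) (0≤fromℕ e)) (neg-cancel (ξ * ξ) (fromℕ c * t) (subst (1ℚ - ξ * ξ ≤_) ζ≡ h)) ⟩
          ξ * ξ * (fromℕ B * fromℕ e) ≡⟨ cong (_* (fromℕ B * fromℕ e)) ξ²≡ ⟩
          fromℕ A * (r * r) * (fromℕ B * fromℕ e) ≡⟨ solve 4 (λ a r b e → a :* r :* (b :* e) := (b :* r) :* (a :* e)) refl (fromℕ A) (r * r) (fromℕ B) (fromℕ e) ⟩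
          fromℕ B * (r * r) * (fromℕ A * fromℕ e) ≡⟨ cong (_* (fromℕ A * fromℕ e)) fromℕ-B*r² ⟩
          1ℚ * (fromℕ A * fromℕ e) ≡⟨ ℚ.*-identityˡ _ ⟩
          fromℕ A * fromℕ e ≡⟨ fromℕ-* A e ⟨
          fromℕ (A ℕ.* e) ∎)

        near⇐ : c ℕ.* B ℕ.≤ A ℕ.* e → 1ℚ - ξ * ξ ≤ ζ × ζ ≤ 1ℚ
        near⇐ h = subst (1ℚ - ξ * ξ ≤_) (sym ζ≡) (ℚ.+-monoʳ-≤ 1ℚ (ℚ.neg-antimono-≤ ct≤)) ,
          subst₂ _≤_ (sym ζ≡) (ℚ.+-identityʳ 1ℚ) (ℚ.+-monoʳ-≤ 1ℚ (ℚ.neg-antimono-≤ (0≤* (0≤fromℕ c) (0≤recip k))))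
          where
          0≤w : 0ℚ ≤ (r * r) * t
          0≤w = 0≤* (0≤* (0≤recip d) (0≤recip d)) (0≤recip k)
          ct≤ : fromℕ c * t ≤ ξ * ξ
          ct≤ = begin
            fromℕ c * t ≡⟨ ℚ.*-identityˡ _ ⟨
            1ℚ * (fromℕ c * t) ≡⟨ cong (_* (fromℕ c * t)) fromℕ-B*r² ⟨
            fromℕ B * (r * r) * (fromℕ c * t) ≡⟨ solve 4 (λ b r c t → b :* r :* (c :* t) := (c :* b) :* (r :* t)) refl (fromℕ B) (r * r) (fromℕ c) t ⟩
            fromℕ c * fromℕ B * (r * r * t) ≡⟨ cong (_* (r * r * t)) (fromℕ-* c B) ⟨
            fromℕ (c ℕ.* B) * (r * r * t) ≤⟨ *-monoʳ (r * r * t) 0≤w (fromℕ-mono h) ⟩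
            fromℕ (A ℕ.* e) * (r * r * t) ≡⟨ cong (_* (r * r * t)) (fromℕ-* A e) ⟩
            fromℕ A * fromℕ e * (r * r * t) ≡⟨ solve 4 (λ a e r t → a :* e :* (r :* t) := a :* r :* (t :* e)) refl (fromℕ A) (fromℕ e) (r * r) t ⟩
            fromℕ A * (r * r) * (t * fromℕ e) ≡⟨ cong (fromℕ A * (r * r) *_) (recip-inverse k) ⟩
            fromℕ A * (r * r) * 1ℚ ≡⟨ ℚ.*-identityʳ _ ⟩
            fromℕ A * (r * r) ≡⟨ ξ²≡ ⟨
            ξ * ξ ∎

    nearOneCount≡ : ∀ T → + nearOneCount T ξ ≡ coprimeCount A B T
    nearOneCount≡ T = count-reflected (nearOne? ξ) A B T (s≤s z≤n) A≤B near⇒ near⇐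

  ∣2[BN-AF]∣⇒Near : ∀ A F B N V → ℤ.∣ + 2 ℤ.* (+ A ℤ.* + F ℤ.- + B ℤ.* + N) ∣ ℕ.≤ B ℕ.* V →
                    Near (B ℕ.* V) (2 ℕ.* (A ℕ.* F)) (2 ℕ.* (B ℕ.* N))
  ∣2[BN-AF]∣⇒Near A F B N V h = dist⇒Near (2 ℕ.* (A ℕ.* F)) (2 ℕ.* (B ℕ.* N)) (subst (λ z → ℤ.∣ z ∣ ℕ.≤ B ℕ.* V) eq h)
    where
    eq : + 2 ℤ.* (+ A ℤ.* + F ℤ.- + B ℤ.* + N) ≡ + (2 ℕ.* (A ℕ.* F)) ℤ.- + (2 ℕ.* (B ℕ.* N))
    eq = trans (ℤ.*-distribˡ-+ (+ 2) (+ A ℤ.* + F) (ℤ.- (+ B ℤ.* + N)))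
      (cong₂ ℤ._+_ (trans (cong (λ z → + 2 ℤ.* z) (sym (ℤ.pos-* A F))) (sym (ℤ.pos-* 2 (A ℕ.* F))))
        (trans (sym (ℤ.neg-distribʳ-* (+ 2) (+ B ℤ.* + N))) (cong ℤ.-_ (trans (cong (λ z → + 2 ℤ.* z) (sym (ℤ.pos-* B N))) (sym (ℤ.pos-* 2 (B ℕ.* N)))))))
    dist⇒Near : ∀ {k} m n → ℤ.∣ + m ℤ.- + n ∣ ℕ.≤ k → Near k m n
    dist⇒Near {k} m n h with subst (λ z → ℤ.∣ z ∣ ℕ.≤ k) (ℤ.[+m]-[+n]≡m⊖n m n) h | ℕ.≤-total m n
    ... | h′ | inj₁ m≤n = ℕ.≤-trans m≤n (ℕ.m≤m+n n k) , ℕ.≤-trans (ℕ.≤-reflexive (sym (ℕ.m+[n∸m]≡n m≤n))) (ℕ.+-monoʳ-≤ m (subst (ℕ._≤ k) (ℤ.∣⊖∣-≤ m≤n) h′))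
    ... | h′ | inj₂ n≤m = ℕ.≤-trans (ℕ.≤-reflexive (sym (ℕ.m+[n∸m]≡n n≤m))) (ℕ.+-monoʳ-≤ n (subst (ℕ._≤ k) (cong ℤ.∣_∣ (ℤ.⊖-≥ n≤m)) h′)) , ℕ.≤-trans n≤m (ℕ.m≤m+n m k)

  module _ (g : ℚ → ℕ) (k : ℚ) where
    private
      value : List ℚ → ℚ
      value l = fromℕ 2 * (fromℕ (sum (map g l)) - k * sumℚ (map (λ ξ → ξ * ξ) l))

    -- Stated for an arbitrary list because the error is additive under concatenation, so a bound
    -- can be collected fraction by fraction. The factor 2 is that of `discrepancy`.
    Bounded : List ℚ → ℕ → Set
    Bounded l v = ∣ value l ∣ ≤ fromℕ v

    private
      sumℚ-++ : ∀ xs ys → sumℚ (xs ++ ys) ≡ sumℚ xs + sumℚ ys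
      sumℚ-++ []       ys = sym (ℚ.+-identityˡ (sumℚ ys))
      sumℚ-++ (x ∷ xs) ys = trans (cong (λ z → x + z) (sumℚ-++ xs ys)) (sym (ℚ.+-assoc x (sumℚ xs) (sumℚ ys)))

      value-++ : ∀ xs ys → value (xs ++ ys) ≡ value xs + value ys
      value-++ xs ys = trans (cong₂ (λ u v → fromℕ 2 * (u - k * v))
          (trans (cong fromℕ (trans (cong sum (map-++ g xs ys)) (sum-++ (map g xs) (map g ys)))) (fromℕ-+ (sum (map g xs)) (sum (map g ys))))
          (trans (cong sumℚ (map-++ sq xs ys)) (sumℚ-++ (map sq xs) (map sq ys))))
        (solve 6 (λ two a b k x y → two :* (a :+ b :- k :* (x :+ y)) := two :* (a :- k :* x) :+ two :* (b :- k :* y)) refl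
          (fromℕ 2) (fromℕ (sum (map g xs))) (fromℕ (sum (map g ys))) k (sumℚ (map sq xs)) (sumℚ (map sq ys)))
        where sq = λ ξ → ξ * ξ

    Bounded-[] : ∀ v → Bounded [] v
    Bounded-[] v = subst (λ z → ∣ z ∣ ≤ fromℕ v) (solve 1 (λ k → con 0ℚ := con (fromℕ 2) :* (con 0ℚ :- k :* con 0ℚ)) refl k) (0≤fromℕ v)

    Bounded-++ : ∀ xs ys v w → Bounded xs v → Bounded ys w → Bounded (xs ++ ys) (v ℕ.+ w)
    Bounded-++ xs ys v w p q = begin
      ∣ value (xs ++ ys) ∣ ≡⟨ cong ∣_∣ (value-++ xs ys) ⟩
      ∣ value xs + value ys ∣ ≤⟨ ℚ.∣p+q∣≤∣p∣+∣q∣ (value xs) (value ys) ⟩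
      ∣ value xs ∣ + ∣ value ys ∣ ≤⟨ ℚ.+-mono-≤ p q ⟩
      fromℕ v + fromℕ w ≡⟨ fromℕ-+ v w ⟨
      fromℕ (v ℕ.+ w) ∎
      where open ℚ.≤-Reasoning

    module _ {P : Pred ℚ 0ℓ} (P? : Decidable P) where
      Bounded-single : ∀ {Q : Pred ℕ 0ℓ} (Q? : Decidable Q) (h : ℕ → ℚ) n v → Bounded [ h n ] v → Bounded (filter P? (map h (filter Q? [ n ]))) v
      Bounded-single Q? h n v b with Q? n
      ... | no  _ = Bounded-[] v
      ... | yes _ with P? (h n)
      ...   | yes _ = b
      ...   | no  _ = Bounded-[] v

      -- Pairs that are not coprime and fractions rejected by P have error 0, so summing v over all
      -- pairs is safe; the condition ξ ≤ 1/2 is never exploited for the size of the error. The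
      -- first argument of v is the numerator plus one, as sums start at 1.
      Bounded-farey : ∀ T (v : ℕ → ℕ → ℕ) → (∀ b a → a ℕ.≤ b → Bounded [ + a / suc b ] (v (suc a) (suc b))) →
                      Bounded (filter P? (farey T)) (Σℕ.∑ T (λ b → Σℕ.∑ b (λ a → v a b)))
      Bounded-farey zero    v h = Bounded-[] 0
      Bounded-farey (suc T) v h = subst (λ l → Bounded l (Σℕ.∑ (suc T) (λ b → Σℕ.∑ b (λ a → v a b))))
        (sym (trans (cong (filter P?) (farey-suc T)) (filter-++ P? (farey T) (fareyLayer T))))
        (Bounded-++ (filter P? (farey T)) (filter P? (fareyLayer T)) (Σℕ.∑ T (λ b → Σℕ.∑ b (λ a → v a b))) (Σℕ.∑ (suc T) (λ a → v a (suc T)))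
          (Bounded-farey T v h) (layer (suc T) ℕ.≤-refl))
        where
        layer : ∀ n → n ℕ.≤ suc T → Bounded (filter P? (layerPrefix T n)) (Σℕ.∑ n (λ a → v a (suc T)))
        layer zero    _    = Bounded-[] 0
        layer (suc n) n<1+T = subst (λ l → Bounded l (Σℕ.∑ (suc n) (λ a → v a (suc T))))
          (sym (trans (cong (filter P?) (layerPrefix-suc T n)) (filter-++ P? (layerPrefix T n) (layerPiece T n))))
          (Bounded-++ (filter P? (layerPrefix T n)) (filter P? (layerPiece T n)) (Σℕ.∑ n (λ a → v a (suc T))) (v (suc n) (suc T))
            (layer n (ℕ.≤-trans (ℕ.n≤1+n n) n<1+T)) (Bounded-single (λ a → coprime? a (suc T)) (λ a → + a / suc T) n (v (suc n) (suc T)) (h T n (ℕ.s≤s⁻¹ n<1+T))))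

  Bounded-fraction : ∀ g F a d V → Near (suc d ℕ.* suc d ℕ.* V) (2 ℕ.* (a ℕ.* a ℕ.* F)) (2 ℕ.* (suc d ℕ.* suc d ℕ.* g (+ a / suc d))) →
                     a ℕ.≤ suc d → Bounded g (fromℕ F) [ + a / suc d ] V
  Bounded-fraction g F a d V (p , q) a≤ = ∣p∣≤ upper lower
    where
    open ℚ.≤-Reasoning
    A = a ℕ.* a
    B = suc d ℕ.* suc d
    ξ = + a / suc d
    N = g ξ
    r² = recip d * recip d
    0≤r² : 0ℚ ≤ r²
    0≤r² = 0≤* (0≤recip d) (0≤recip d)
    value≡ : fromℕ 2 * (fromℕ (N ℕ.+ 0) - fromℕ F * (ξ * ξ + 0ℚ)) ≡ (fromℕ 2 * (fromℕ B * fromℕ N) - fromℕ 2 * (fromℕ A * fromℕ F)) * r²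
    value≡ = trans (cong₂ (λ n x → fromℕ 2 * (fromℕ n - fromℕ F * x)) (ℕ.+-identityʳ N) (trans (ℚ.+-identityʳ (ξ * ξ)) (ξ²≡ a d a≤)))
      (trans (cong (λ z → fromℕ 2 * (z - fromℕ F * (fromℕ A * r²))) (trans (sym (ℚ.*-identityˡ (fromℕ N))) (cong (_* fromℕ N) (sym (fromℕ-B*r² a d a≤)))))
        (solve 6 (λ two b r n f a → two :* (b :* r :* n :- f :* (a :* r)) := (two :* (b :* n) :- two :* (a :* f)) :* r) refl
          (fromℕ 2) (fromℕ B) r² (fromℕ N) (fromℕ F) (fromℕ A)))
    cast : ∀ x y → fromℕ (2 ℕ.* (x ℕ.* y)) ≡ fromℕ 2 * (fromℕ x * fromℕ y)
    cast x y = trans (fromℕ-* 2 (x ℕ.* y)) (cong (fromℕ 2 *_) (fromℕ-* x y))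
    bound : ∀ x y → x ℕ.≤ y ℕ.+ B ℕ.* V → (fromℕ x - fromℕ y) * r² ≤ fromℕ V
    bound x y h = begin
      (fromℕ x - fromℕ y) * r² ≤⟨ *-monoʳ r² 0≤r² (ℚ.+-monoˡ-≤ (- fromℕ y) (fromℕ-mono h)) ⟩
      (fromℕ (y ℕ.+ B ℕ.* V) - fromℕ y) * r² ≡⟨ cong (λ z → (z - fromℕ y) * r²) (trans (fromℕ-+ y (B ℕ.* V)) (cong (λ z → fromℕ y + z) (fromℕ-* B V))) ⟩
      (fromℕ y + fromℕ B * fromℕ V - fromℕ y) * r² ≡⟨ solve 4 (λ y b v r → (y :+ b :* v :- y) :* r := b :* r :* v) refl (fromℕ y) (fromℕ B) (fromℕ V) r² ⟩
      fromℕ B * r² * fromℕ V ≡⟨ cong (_* fromℕ V) (fromℕ-B*r² a d a≤) ⟩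
      1ℚ * fromℕ V ≡⟨ ℚ.*-identityˡ (fromℕ V) ⟩
      fromℕ V ∎
    upper = subst (_≤ fromℕ V) (sym (trans value≡ (cong₂ (λ u v → (u - v) * r²) (sym (cast B N)) (sym (cast A F))))) (bound (2 ℕ.* (B ℕ.* N)) (2 ℕ.* (A ℕ.* F)) q)
    lower = subst (_≤ fromℕ V) (sym (trans (cong -_ value≡) (trans (solve 3 (λ u v r → :- ((u :- v) :* r) := (v :- u) :* r) refl (fromℕ 2 * (fromℕ B * fromℕ N)) (fromℕ 2 * (fromℕ A * fromℕ F)) r²)
      (cong₂ (λ u v → (u - v) * r²) (sym (cast A F)) (sym (cast B N)))))) (bound (2 ℕ.* (A ℕ.* F)) (2 ℕ.* (B ℕ.* N)) p)

  module FareyBound {T Q L : ℕ} (scale : Scale T Q L) where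
    open Total scale
    open Hyperbola scale

    private
      V : ℕ → ℕ → ℕ
      -- The fraction 0 has no error, since no c ≥ 1 satisfies c B ≤ 0; `discrepancy` itself
      -- requires a ≥ 1.
      V zero      b = 0
      V a@(suc _) b = 1 ℕ.+ mertensSum ℕ.+ tailWeight a b

      fraction : ∀ b a → a ℕ.≤ b → Bounded (nearOneCount T) (fromℕ (F T)) [ + a / suc b ] (V a (suc b))
      fraction b a a≤b = Bounded-fraction (nearOneCount T) (F T) a b (V a (suc b))
          (∣2[BN-AF]∣⇒Near (a ℕ.* a) (F T) B (nearOneCount T (+ a / suc b)) (V a (suc b))
            (subst₂ (λ f n → ℤ.∣ + 2 ℤ.* (+ (a ℕ.* a) ℤ.* f ℤ.- + B ℤ.* n) ∣ ℕ.≤ B ℕ.* V a (suc b))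
              (sym (F≡coprimeCount T)) (sym (nearOneCount≡ a b a≤1+b T)) (bound a a≤1+b)))
          a≤1+b
        where
        B = suc b ℕ.* suc b
        a≤1+b : a ℕ.≤ suc b
        a≤1+b = ℕ.m≤n⇒m≤1+n a≤b
        bound : ∀ a → a ℕ.≤ suc b → ℤ.∣ + 2 ℤ.* (+ (a ℕ.* a) ℤ.* coprimeCount 1 1 T ℤ.- + B ℤ.* coprimeCount (a ℕ.* a) B T) ∣ ℕ.≤ B ℕ.* V a (suc b)
        bound zero _ = ℕ.≤-trans (ℕ.≤-reflexive (cong ℤ.∣_∣ (trans (cong (λ n → + 2 ℤ.* (+ 0 ℤ.* coprimeCount 1 1 T ℤ.- + B ℤ.* n)) none)
            (trans (cong₂ (λ x y → + 2 ℤ.* (x ℤ.- y)) (ℤ.*-zeroˡ (coprimeCount 1 1 T)) (ℤ.*-zeroʳ (+ B))) refl)))) z≤n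
          where
          none : coprimeCount 0 B T ≡ + 0
          none = Σℤ.∑-zero T (λ e _ _ → Σℤ.∑-zero T (λ c 1≤c _ → trans (cong (Σℤ.χ (coprime? c e) ℤ.*_)
            (Σℤ.χ-no (c ℕ.* B ℕ.≤? 0) (ℕ.<⇒≱ (ℕ.≤-trans (s≤s z≤n) (ℕ.*-mono-≤ 1≤c (s≤s (z≤n {b ℕ.+ b ℕ.* suc b}))))))) (ℤ.*-zeroʳ (Σℤ.χ (coprime? c e)))))
        bound a@(suc _) a≤ = discrepancy a (suc b) (s≤s z≤n) a≤

      shift : ∀ b → Σℕ.∑ b (λ a → V (pred a) b) ℕ.≤ Σℕ.∑ b (λ a → 1 ℕ.+ mertensSum ℕ.+ tailWeight a b)
      shift zero    = z≤n
      shift (suc b) = begin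
        Σℕ.∑ (suc b) (λ a → V (pred a) (suc b)) ≡⟨ Σℕ.∑-shift b (λ a → V (pred a) (suc b)) ⟩
        Σℕ.∑ b (λ a → V a (suc b)) ≡⟨ Σℕ.∑-cong b (λ { (suc a) _ _ → refl }) ⟩
        Σℕ.∑ b (λ a → 1 ℕ.+ mertensSum ℕ.+ tailWeight a (suc b)) ≤⟨ ℕ.m≤m+n _ _ ⟩
        Σℕ.∑ (suc b) (λ a → 1 ℕ.+ mertensSum ℕ.+ tailWeight a (suc b)) ∎
        where open ℕ.≤-Reasoning

      total : Σℕ.∑ T (λ b → Σℕ.∑ b (λ a → V (pred a) b)) ℕ.≤ T ℕ.* (T ℕ.* (1 ℕ.+ mertensSum)) ℕ.+ 128 ℕ.* (L ℕ.* (L ℕ.* L) ℕ.* (T ℕ.* T) ℕ.* (Q ℕ.* (Q ℕ.* Q)))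
      total = begin
        Σℕ.∑ T (λ b → Σℕ.∑ b (λ a → V (pred a) b)) ≤⟨ ∑-mono T (λ b _ _ → shift b) ⟩
        Σℕ.∑ T (λ b → Σℕ.∑ b (λ a → 1 ℕ.+ mertensSum ℕ.+ tailWeight a b)) ≡⟨ trans (Σℕ.∑-cong′ T (λ b → Σℕ.∑-+ b (λ _ → 1 ℕ.+ mertensSum) (λ a → tailWeight a b))) (Σℕ.∑-+ T _ _) ⟩
        Σℕ.∑ T (λ b → Σℕ.∑ b (λ _ → 1 ℕ.+ mertensSum)) ℕ.+ Σℕ.∑ T (λ b → Σℕ.∑ b (λ a → tailWeight a b))
          ≤⟨ ℕ.+-mono-≤ (∑-≤-const T _ (λ b _ b≤T → ℕ.≤-trans (∑-≤-const b (1 ℕ.+ mertensSum) (λ _ _ _ → ℕ.≤-refl)) (ℕ.*-monoˡ-≤ (1 ℕ.+ mertensSum) b≤T))) ∑-tailWeight ⟩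
        T ℕ.* (T ℕ.* (1 ℕ.+ mertensSum)) ℕ.+ 128 ℕ.* (L ℕ.* (L ℕ.* L) ℕ.* (T ℕ.* T) ℕ.* (Q ℕ.* (Q ℕ.* Q))) ∎
        where open ℕ.≤-Reasoning

    farey-bound : ∣ fromℕ 2 * (fromℕ (C T) - fromℕ (F T) * G T) ∣
                  ≤ fromℕ (T ℕ.* (T ℕ.* (1 ℕ.+ mertensSum)) ℕ.+ 128 ℕ.* (L ℕ.* (L ℕ.* L) ℕ.* (T ℕ.* T) ℕ.* (Q ℕ.* (Q ℕ.* Q))))
    farey-bound = ℚ.≤-trans (Bounded-farey (nearOneCount T) (fromℕ (F T)) (_≤? ½) T (λ a b → V (pred a) b) fraction) (fromℕ-mono total)

-- Exponential and logarithm

0≤1 : 0ℚ ≤ 1ℚ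
0≤1 = ℚ.nonNegative⁻¹ 1ℚ

≤-+ʳ : ∀ p q → 0ℚ ≤ q → p ≤ p + q
≤-+ʳ p q 0≤q = subst (_≤ p + q) (ℚ.+-identityʳ p) (ℚ.+-monoʳ-≤ p 0≤q)

≤-from-diff : ∀ p q → 0ℚ ≤ q - p → p ≤ q
≤-from-diff p q h = subst (p ≤_) (solve 2 (λ p q → p :+ (q :- p) := q) refl p q) (≤-+ʳ p (q - p) h)

diff-nonneg : ∀ p q → p ≤ q → 0ℚ ≤ q - p
diff-nonneg p q h = subst (_≤ q - p) (ℚ.+-inverseʳ p) (ℚ.+-monoˡ-≤ (- p) h)

recip-fromℕ : ∀ n → fromℕ (suc n) * recip n ≡ 1ℚ
recip-fromℕ n = trans (ℚ.*-comm (fromℕ (suc n)) (recip n)) (recip-inverse n)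

expTerm-suc : ∀ x k → fromℕ (suc k) * expTerm x (suc k) ≡ x * expTerm x k
expTerm-suc x k = trans (solve 4 (λ n t x r → n :* (t :* (x :* r)) := (n :* r) :* (x :* t)) refl (fromℕ (suc k)) (expTerm x k) x (recip k))
  (trans (cong (_* (x * expTerm x k)) (recip-fromℕ k)) (ℚ.*-identityˡ (x * expTerm x k)))

module ExpAdd (x y : ℚ) where
  private
    X Y : ℕ → ℚ
    X = expTerm x
    Y = expTerm y

    -- K n j = Σ_{i ≤ n} X i * Y (n - i + j), and V, W weight the i-th term by i and by n - i + j.
    K V W : ℕ → ℕ → ℚ
    K zero    j = X 0 * Y j
    K (suc n) j = K n (suc j) + X (suc n) * Y j
    V zero    j = 0ℚ
    V (suc n) j = V n (suc j) + fromℕ (suc n) * X (suc n) * Y j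
    W zero    j = fromℕ j * (X 0 * Y j)
    W (suc n) j = W n (suc j) + fromℕ j * (X (suc n) * Y j)

    W-suc : ∀ n j → W n (suc j) ≡ y * K n j
    W-suc zero j = trans (solve 3 (λ n a b → n :* (a :* b) := a :* (n :* b)) refl (fromℕ (suc j)) (X 0) (Y (suc j)))
      (trans (cong (X 0 *_) (expTerm-suc y j)) (solve 3 (λ a y b → a :* (y :* b) := y :* (a :* b)) refl (X 0) y (Y j)))
    W-suc (suc n) j = trans (cong₂ _+_ (W-suc n (suc j)) (trans (solve 3 (λ n a b → n :* (a :* b) := a :* (n :* b)) refl (fromℕ (suc j)) (X (suc n)) (Y (suc j))) (cong (X (suc n) *_) (expTerm-suc y j))))
      (solve 4 (λ y k a b → y :* k :+ a :* (y :* b) := y :* (k :+ a :* b)) refl y (K n (suc j)) (X (suc n)) (Y j))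

    V-suc : ∀ n j → V (suc n) j ≡ x * K n j
    V-suc zero    j = trans (cong (λ z → 0ℚ + z * Y j) (expTerm-suc x 0)) (solve 3 (λ x a b → con 0ℚ :+ x :* a :* b := x :* (a :* b)) refl x (X 0) (Y j))
    V-suc (suc n) j = trans (cong₂ (λ u v → u + v * Y j) (V-suc n (suc j)) (expTerm-suc x (suc n)))
      (solve 4 (λ x k a b → x :* k :+ x :* a :* b := x :* (k :+ a :* b)) refl x (K n (suc j)) (X (suc n)) (Y j))

    V+W : ∀ n j → V n j + W n j ≡ fromℕ (n ℕ.+ j) * K n j
    V+W zero    j = ℚ.+-identityˡ _
    V+W (suc n) j = trans (solve 6 (λ v w n a b j → (v :+ n :* a :* b) :+ (w :+ j :* (a :* b)) := (v :+ w) :+ (n :+ j) :* (a :* b)) refl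
        (V n (suc j)) (W n (suc j)) (fromℕ (suc n)) (X (suc n)) (Y j) (fromℕ j))
      (trans (cong₂ (λ u v → u + v * (X (suc n) * Y j)) (trans (V+W n (suc j)) (cong (λ z → fromℕ z * K n (suc j)) (ℕ.+-suc n j))) (sym (fromℕ-+ (suc n) j)))
        (sym (ℚ.*-distribˡ-+ (fromℕ (suc n ℕ.+ j)) (K n (suc j)) (X (suc n) * Y j))))

    -- The binomial theorem without binomial coefficients: (n + 1) times the convolution of order n
    -- + 1 splits, by i + (n + 1 - i) = n + 1, into x and y times the convolution of order n.
    expTerm-+ : ∀ n → expTerm (x + y) n ≡ K n 0
    expTerm-+ zero    = sym (ℚ.*-identityˡ 1ℚ)
    expTerm-+ (suc n) = begin
      expTerm (x + y) n * ((x + y) * r) ≡⟨ cong (_* ((x + y) * r)) (expTerm-+ n) ⟩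
      K n 0 * ((x + y) * r) ≡⟨ solve 4 (λ k x y r → k :* ((x :+ y) :* r) := r :* (x :* k :+ y :* k)) refl (K n 0) x y r ⟩
      r * (x * K n 0 + y * K n 0) ≡⟨ cong₂ (λ u v → r * (u + v)) (V-suc n 0) W-zero ⟨
      r * (V (suc n) 0 + W (suc n) 0) ≡⟨ cong (r *_) (trans (V+W (suc n) 0) (cong (λ z → fromℕ (suc z) * K (suc n) 0) (ℕ.+-identityʳ n))) ⟩
      r * (fromℕ (suc n) * K (suc n) 0) ≡⟨ sym (ℚ.*-assoc r (fromℕ (suc n)) (K (suc n) 0)) ⟩
      r * fromℕ (suc n) * K (suc n) 0 ≡⟨ cong (_* K (suc n) 0) (recip-inverse n) ⟩
      1ℚ * K (suc n) 0 ≡⟨ ℚ.*-identityˡ (K (suc n) 0) ⟩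
      K (suc n) 0 ∎
      where
      open ≡-Reasoning
      r = recip n
      W-zero : W (suc n) 0 ≡ y * K n 0
      W-zero = trans (cong₂ _+_ (W-suc n 0) (ℚ.*-zeroˡ (X (suc n) * Y 0))) (ℚ.+-identityʳ (y * K n 0))

    -- J n m = Σ_{i ≤ n} X i * (Y 0 + … + Y (n - i + m))
    J : ℕ → ℕ → ℚ
    J zero    m = X 0 * expSum y m
    J (suc n) m = J n (suc m) + X (suc n) * expSum y m

    J-suc : ∀ n m → J n (suc m) ≡ J n m + K n (suc m)
    J-suc zero    m = ℚ.*-distribˡ-+ (X 0) (expSum y m) (Y (suc m))
    J-suc (suc n) m = trans (cong₂ _+_ (J-suc n (suc m)) (ℚ.*-distribˡ-+ (X (suc n)) (expSum y m) (Y (suc m))))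
      (solve 4 (λ a b c d → (a :+ b) :+ (c :+ d) := (a :+ c) :+ (b :+ d)) refl (J n (suc m)) (K n (suc (suc m))) (X (suc n) * expSum y m) (X (suc n) * Y (suc m)))

    expSum-J : ∀ n → expSum (x + y) n ≡ J n 0
    expSum-J zero    = sym (ℚ.*-identityˡ 1ℚ)
    expSum-J (suc n) = trans (cong₂ _+_ (expSum-J n) (expTerm-+ (suc n)))
      (trans (sym (ℚ.+-assoc (J n 0) (K n 1) (X (suc n) * Y 0))) (cong (_+ X (suc n) * 1ℚ) (sym (J-suc n 0))))

  module _ (0≤x : 0ℚ ≤ x) (0≤y : 0ℚ ≤ y) where
    open ℚ.≤-Reasoning
    private
      0≤X : ∀ k → 0ℚ ≤ X k
      0≤X = expTerm-nonNeg 0≤x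
      0≤Y : ∀ k → 0ℚ ≤ Y k
      0≤Y = expTerm-nonNeg 0≤y
      0≤E : ∀ m → 0ℚ ≤ expSum y m
      0≤E zero    = 0≤1
      0≤E (suc m) = 0≤+ (0≤E m) (0≤Y (suc m))
      0≤EX : ∀ m → 0ℚ ≤ expSum x m
      0≤EX zero    = 0≤1
      0≤EX (suc m) = 0≤+ (0≤EX m) (0≤X (suc m))
      E-suc : ∀ m → expSum y m ≤ expSum y (suc m)
      E-suc m = ≤-+ʳ (expSum y m) (Y (suc m)) (0≤Y (suc m))
      E-+ : ∀ j m → expSum y m ≤ expSum y (j ℕ.+ m)
      E-+ zero    m = ℚ.≤-refl
      E-+ (suc j) m = ℚ.≤-trans (E-+ j m) (E-suc (j ℕ.+ m))

      J-upper : ∀ n m → J n m ≤ expSum x n * expSum y (n ℕ.+ m)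
      J-upper zero    m = ℚ.≤-refl
      J-upper (suc n) m = begin
        J n (suc m) + X (suc n) * expSum y m
          ≤⟨ ℚ.+-mono-≤ (J-upper n (suc m)) (*-monoˡ (X (suc n)) (0≤X (suc n)) (E-+ (suc n) m)) ⟩
        expSum x n * expSum y (n ℕ.+ suc m) + X (suc n) * expSum y (suc n ℕ.+ m)
          ≡⟨ cong (λ z → expSum x n * expSum y z + X (suc n) * expSum y (suc n ℕ.+ m)) (ℕ.+-suc n m) ⟩
        expSum x n * expSum y (suc n ℕ.+ m) + X (suc n) * expSum y (suc n ℕ.+ m)
          ≡⟨ ℚ.*-distribʳ-+ (expSum y (suc n ℕ.+ m)) (expSum x n) (X (suc n)) ⟨
        expSum x (suc n) * expSum y (suc n ℕ.+ m) ∎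

      J-lower : ∀ n m → expSum x n * expSum y m ≤ J n m
      J-lower zero    m = ℚ.≤-refl
      J-lower (suc n) m = begin
        expSum x (suc n) * expSum y m ≡⟨ ℚ.*-distribʳ-+ (expSum y m) (expSum x n) (X (suc n)) ⟩
        expSum x n * expSum y m + X (suc n) * expSum y m ≤⟨ ℚ.+-monoˡ-≤ (X (suc n) * expSum y m) (ℚ.≤-trans (*-monoˡ (expSum x n) (0≤EX n) (E-suc m)) (J-lower n (suc m))) ⟩
        J n (suc m) + X (suc n) * expSum y m ∎

      J-shift : ∀ m n → J n m ≤ J (n ℕ.+ m) 0
      J-shift zero    n = ℚ.≤-reflexive (cong (λ z → J z 0) (sym (ℕ.+-identityʳ n)))
      J-shift (suc m) n = begin
        J n (suc m) ≤⟨ ≤-+ʳ (J n (suc m)) (X (suc n) * expSum y m) (0≤* (0≤X (suc n)) (0≤E m)) ⟩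
        J (suc n) m ≤⟨ J-shift m (suc n) ⟩
        J (suc n ℕ.+ m) 0 ≡⟨ cong (λ z → J z 0) (ℕ.+-suc n m) ⟨
        J (n ℕ.+ suc m) 0 ∎

    -- For nonnegative arguments all terms are nonnegative, and the triangle i + k ≤ n of index
    -- pairs lies in the square i, k ≤ n.
    expSum-+-≤ : ∀ n → expSum (x + y) n ≤ expSum x n * expSum y n
    expSum-+-≤ n = subst₂ _≤_ (sym (expSum-J n)) (cong (λ z → expSum x n * expSum y z) (ℕ.+-identityʳ n)) (J-upper n 0)

    -- The rectangle i ≤ d, k ≤ e lies in the triangle i + k ≤ d + e. This is why truncation orders
    -- add up below.
    expSum-+-≥ : ∀ d e → expSum x d * expSum y e ≤ expSum (x + y) (d ℕ.+ e)
    expSum-+-≥ d e = subst (expSum x d * expSum y e ≤_) (sym (expSum-J (d ℕ.+ e))) (ℚ.≤-trans (J-lower d e) (J-shift e d))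

open ExpAdd public using (expSum-+-≤; expSum-+-≥)

1≤expSum : ∀ x → 0ℚ ≤ x → ∀ n → 1ℚ ≤ expSum x n
1≤expSum x 0≤x zero    = ℚ.≤-refl
1≤expSum x 0≤x (suc n) = ℚ.≤-trans (1≤expSum x 0≤x n) (≤-+ʳ (expSum x n) (expTerm x (suc n)) (expTerm-nonNeg 0≤x (suc n)))

0≤expSum : ∀ x → 0ℚ ≤ x → ∀ n → 0ℚ ≤ expSum x n
0≤expSum x 0≤x n = ℚ.≤-trans 0≤1 (1≤expSum x 0≤x n)

expSum-mono : ∀ x → 0ℚ ≤ x → ∀ {m n} → m ℕ.≤ n → expSum x m ≤ expSum x n
expSum-mono x 0≤x {m} {n} m≤n = subst (λ z → expSum x m ≤ expSum x z) (ℕ.m∸n+n≡m m≤n) (go (n ℕ.∸ m))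
  where
  go : ∀ j → expSum x m ≤ expSum x (j ℕ.+ m)
  go zero    = ℚ.≤-refl
  go (suc j) = ℚ.≤-trans (go j) (≤-+ʳ (expSum x (j ℕ.+ m)) (expTerm x (suc (j ℕ.+ m))) (expTerm-nonNeg 0≤x (suc (j ℕ.+ m))))

expTerm-monoˡ : ∀ x y → 0ℚ ≤ x → x ≤ y → ∀ n → expTerm x n ≤ expTerm y n
expTerm-monoˡ x y 0≤x x≤y zero    = ℚ.≤-refl
expTerm-monoˡ x y 0≤x x≤y (suc n) = *-mono {expTerm x n} {expTerm y n} {x * recip n} {y * recip n}
  (0≤* 0≤x (0≤recip n)) (expTerm-nonNeg (ℚ.≤-trans 0≤x x≤y) n) (expTerm-monoˡ x y 0≤x x≤y n) (*-monoʳ {x} {y} (recip n) (0≤recip n) x≤y)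

expSum-monoˡ : ∀ x y → 0ℚ ≤ x → x ≤ y → ∀ n → expSum x n ≤ expSum y n
expSum-monoˡ x y 0≤x x≤y zero    = ℚ.≤-refl
expSum-monoˡ x y 0≤x x≤y (suc n) = ℚ.+-mono-≤ (expSum-monoˡ x y 0≤x x≤y n) (expTerm-monoˡ x y 0≤x x≤y (suc n))

0≤power : ∀ x → 0ℚ ≤ x → ∀ k → 0ℚ ≤ power x k
0≤power x 0≤x zero    = 0≤1
0≤power x 0≤x (suc k) = 0≤* 0≤x (0≤power x 0≤x k)

recip-anti : ∀ {j k} → j ℕ.≤ k → recip k ≤ recip j
recip-anti = MercatorBounds.recip-anti 0

recip≤1 : ∀ k → recip k ≤ 1ℚ
recip≤1 k = recip-anti {0} {k} z≤n

expTerm≤power : ∀ x → 0ℚ ≤ x → ∀ k → expTerm x k ≤ power x k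
expTerm≤power x 0≤x zero    = ℚ.≤-refl
expTerm≤power x 0≤x (suc k) = begin
  expTerm x k * (x * recip k) ≤⟨ *-mono {expTerm x k} {power x k} {x * recip k} {x * 1ℚ} (0≤* 0≤x (0≤recip k)) (0≤power x 0≤x k) (expTerm≤power x 0≤x k) (*-monoˡ {recip k} {1ℚ} x 0≤x (recip≤1 k)) ⟩
  power x k * (x * 1ℚ) ≡⟨ solve 2 (λ p x → p :* (x :* con 1ℚ) := x :* p) refl (power x k) x ⟩
  x * power x k ∎
  where open ℚ.≤-Reasoning

-- Termwise comparison with the geometric series; the induction carries the remainder y^(n+1) along.
expSum-geometric : ∀ y → 0ℚ ≤ y → y ≤ 1ℚ → ∀ n → expSum y n * (1ℚ - y) ≤ 1ℚ
expSum-geometric y 0≤y y≤1 n = ℚ.≤-trans (≤-+ʳ (expSum y n * (1ℚ - y)) (power y (suc n)) (0≤power y 0≤y (suc n))) (go n)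
  where
  open ℚ.≤-Reasoning
  go : ∀ n → expSum y n * (1ℚ - y) + power y (suc n) ≤ 1ℚ
  go zero    = ℚ.≤-reflexive (solve 1 (λ y → con 1ℚ :* (con 1ℚ :- y) :+ y :* con 1ℚ := con 1ℚ) refl y)
  go (suc n) = begin
    (s + expTerm y (suc n)) * (1ℚ - y) + y * p ≤⟨ ℚ.+-monoˡ-≤ (y * p) (*-monoʳ {s + expTerm y (suc n)} {s + p} (1ℚ - y) (diff-nonneg y 1ℚ y≤1) (ℚ.+-monoʳ-≤ s (expTerm≤power y 0≤y (suc n)))) ⟩
    (s + p) * (1ℚ - y) + y * p ≡⟨ solve 3 (λ s p y → (s :+ p) :* (con 1ℚ :- y) :+ y :* p := s :* (con 1ℚ :- y) :+ p) refl s p y ⟩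
    s * (1ℚ - y) + p ≤⟨ go n ⟩
    1ℚ ∎
    where
    s = expSum y n
    p = power y (suc n)

open import Data.Nat.Tactic.RingSolver using (solve-∀)
open ℚ.≤-Reasoning

-- Harmonic sums in place of the logarithm, and their truncated exponentials.

-- Every partial sum of log (t + 1) is at most `H t`, and from some index on it is at least `H₃ t`.
H : ℕ → ℚ
H zero    = 0ℚ
H (suc n) = H n + recip n

-- 1/3 + 1/4 + … + 1/(t+2)
H₃ : ℕ → ℚ
H₃ zero    = 0ℚ
H₃ (suc t) = H₃ t + recip (suc (suc t))

0≤H : ∀ n → 0ℚ ≤ H n
0≤H zero    = ℚ.≤-refl
0≤H (suc n) = 0≤+ (0≤H n) (0≤recip n)

0≤H₃ : ∀ n → 0ℚ ≤ H₃ n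
0≤H₃ zero    = ℚ.≤-refl
0≤H₃ (suc n) = 0≤+ (0≤H₃ n) (0≤recip (suc (suc n)))

H≤fromℕ : ∀ n → H n ≤ fromℕ n
H≤fromℕ zero    = ℚ.≤-refl
H≤fromℕ (suc n) = begin
  H n + recip n ≤⟨ ℚ.+-mono-≤ (H≤fromℕ n) (recip≤1 n) ⟩
  fromℕ n + 1ℚ ≡⟨ trans (ℚ.+-comm (fromℕ n) 1ℚ) (sym (fromℕ-suc n)) ⟩
  fromℕ (suc n) ∎

expSum-½ : ∀ m → expSum ½ m ≤ fromℕ 2
expSum-½ m = begin
  expSum ½ m ≡⟨ solve 1 (λ e → e := e :* (con 1ℚ :- con ½) :* con (fromℕ 2)) refl (expSum ½ m) ⟩
  expSum ½ m * (1ℚ - ½) * fromℕ 2 ≤⟨ *-monoʳ {expSum ½ m * (1ℚ - ½)} {1ℚ} (fromℕ 2) (0≤fromℕ 2) (expSum-geometric ½ (ℚ.nonNegative⁻¹ ½) (toWitness {a? = ½ ℚ.≤? 1ℚ} _) m) ⟩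
  1ℚ * fromℕ 2 ≡⟨ ℚ.*-identityˡ (fromℕ 2) ⟩
  fromℕ 2 ∎

expSum-recip : ∀ n m → expSum (recip n) m * fromℕ n ≤ fromℕ (suc n)
expSum-recip n m = begin
  e * fromℕ n ≡⟨ solve 2 (λ e n → e :* n := e :* (con 1ℚ :+ n :- con 1ℚ)) refl e (fromℕ n) ⟩
  e * (1ℚ + fromℕ n - 1ℚ) ≡⟨ cong₂ (λ u v → e * (u - v)) (sym (fromℕ-suc n)) (sym (recip-inverse n)) ⟩
  e * (fromℕ (suc n) - r * fromℕ (suc n)) ≡⟨ solve 3 (λ e n r → e :* (n :- r :* n) := e :* (con 1ℚ :- r) :* n) refl e (fromℕ (suc n)) r ⟩
  e * (1ℚ - r) * fromℕ (suc n) ≤⟨ *-monoʳ {e * (1ℚ - r)} {1ℚ} (fromℕ (suc n)) (0≤fromℕ (suc n)) (expSum-geometric r (0≤recip n) (recip≤1 n) m) ⟩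
  1ℚ * fromℕ (suc n) ≡⟨ ℚ.*-identityˡ (fromℕ (suc n)) ⟩
  fromℕ (suc n) ∎
  where
  r = recip n
  e = expSum r m

-- The factor gained in each step is exp (1/(n+2)) ≤ (n+2)/(n+1), so the product telescopes; the
-- start exp 1 ≤ 4 gives the constant.
expSum-H : ∀ n m → expSum (H (suc n)) m ≤ fromℕ 4 * fromℕ (suc n)
-- The geometric bound is void at y = 1, hence the splitting 1 = ½ + ½ with exp ½ ≤ 2.
expSum-H zero m = begin
  expSum (½ + ½) m ≤⟨ expSum-+-≤ ½ ½ (ℚ.nonNegative⁻¹ ½) (ℚ.nonNegative⁻¹ ½) m ⟩
  expSum ½ m * expSum ½ m ≤⟨ *-mono {expSum ½ m} {fromℕ 2} {expSum ½ m} {fromℕ 2} (0≤expSum ½ (ℚ.nonNegative⁻¹ ½) m) (0≤fromℕ 2) (expSum-½ m) (expSum-½ m) ⟩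
  fromℕ 2 * fromℕ 2 ≡⟨⟩
  fromℕ 4 * fromℕ 1 ∎
expSum-H (suc n) m = begin
  expSum (H (suc n) + recip (suc n)) m ≤⟨ expSum-+-≤ (H (suc n)) (recip (suc n)) (0≤H (suc n)) (0≤recip (suc n)) m ⟩
  expSum (H (suc n)) m * e ≤⟨ *-monoʳ {expSum (H (suc n)) m} {fromℕ 4 * fromℕ (suc n)} e (0≤expSum (recip (suc n)) (0≤recip (suc n)) m) (expSum-H n m) ⟩
  fromℕ 4 * fromℕ (suc n) * e ≡⟨ solve 3 (λ f n e → f :* n :* e := f :* (e :* n)) refl (fromℕ 4) (fromℕ (suc n)) e ⟩
  fromℕ 4 * (e * fromℕ (suc n)) ≤⟨ *-monoˡ {e * fromℕ (suc n)} {fromℕ (suc (suc n))} (fromℕ 4) (0≤fromℕ 4) (expSum-recip (suc n) m) ⟩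
  fromℕ 4 * fromℕ (suc (suc n)) ∎
  where e = expSum (recip (suc n)) m

-- Here the telescoping factor is 1 + 1/(t+3), which is the truncation of exp (1/(t+3)) of order 1.
-- Each step therefore raises the order by one, and order t is enough for `H₃ t`.
expSum-H₃ : ∀ t → fromℕ (3 ℕ.+ t) ≤ fromℕ 3 * expSum (H₃ t) t
expSum-H₃ zero    = ℚ.≤-refl
expSum-H₃ (suc t) = begin
  fromℕ (4 ℕ.+ t) ≡⟨ fromℕ-suc (3 ℕ.+ t) ⟩
  1ℚ + n ≡⟨ cong (_+ n) (recip-fromℕ (2 ℕ.+ t)) ⟨
  n * r + n ≡⟨ solve 2 (λ n r → n :* r :+ n := n :* (con 1ℚ :+ con 1ℚ :* (r :* con 1ℚ))) refl n r ⟩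
  n * expSum r 1 ≤⟨ *-monoʳ {n} {fromℕ 3 * expSum (H₃ t) t} (expSum r 1) (0≤expSum r (0≤recip (2 ℕ.+ t)) 1) (expSum-H₃ t) ⟩
  fromℕ 3 * expSum (H₃ t) t * expSum r 1 ≡⟨ ℚ.*-assoc (fromℕ 3) (expSum (H₃ t) t) (expSum r 1) ⟩
  fromℕ 3 * (expSum (H₃ t) t * expSum r 1) ≤⟨ *-monoˡ {expSum (H₃ t) t * expSum r 1} {expSum (H₃ t + r) (t ℕ.+ 1)} (fromℕ 3) (0≤fromℕ 3) (expSum-+-≥ (H₃ t) r (0≤H₃ t) (0≤recip (2 ℕ.+ t)) t 1) ⟩
  fromℕ 3 * expSum (H₃ t + r) (t ℕ.+ 1) ≡⟨ cong (λ z → fromℕ 3 * expSum (H₃ t + r) z) (ℕ.+-comm t 1) ⟩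
  fromℕ 3 * expSum (H₃ (suc t)) (suc t) ∎
  where
  n = fromℕ (3 ℕ.+ t)
  r = recip (2 ℕ.+ t)

-- Increments of the truncated Mercator series, and the bounds by harmonic sums.

module PowerDiff (x y : ℚ) (0≤y : 0ℚ ≤ y) (y≤x : y ≤ x) where
  private
    0≤x : 0ℚ ≤ x
    0≤x = ℚ.≤-trans 0≤y y≤x
    d = x - y
    0≤d : 0ℚ ≤ d
    0≤d = diff-nonneg y x y≤x

  power-mono : ∀ k → power y k ≤ power x k
  power-mono zero    = ℚ.≤-refl
  power-mono (suc k) = *-mono {y} {x} {power y k} {power x k} (0≤power y 0≤y k) 0≤x y≤x (power-mono k)

  private
    upper : ∀ k → power x (suc k) - power y (suc k) ≤ fromℕ (suc k) * (d * power x k)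
    upper zero    = ℚ.≤-reflexive (solve 2 (λ x y → x :* con 1ℚ :- y :* con 1ℚ := con 1ℚ :* ((x :- y) :* con 1ℚ)) refl x y)
    upper (suc k) = begin
      x * p - y * q ≡⟨ solve 4 (λ x y p q → x :* p :- y :* q := x :* (p :- q) :+ (x :- y) :* q) refl x y p q ⟩
      x * (p - q) + d * q ≤⟨ ℚ.+-mono-≤ (*-monoˡ {p - q} {fromℕ (suc k) * (d * power x k)} x 0≤x (upper k)) (*-monoˡ {q} {p} d 0≤d (power-mono (suc k))) ⟩
      x * (fromℕ (suc k) * (d * power x k)) + d * p ≡⟨ solve 4 (λ x n d w → x :* (n :* (d :* w)) :+ d :* (x :* w) := (con 1ℚ :+ n) :* (d :* (x :* w))) refl x (fromℕ (suc k)) d (power x k) ⟩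
      (1ℚ + fromℕ (suc k)) * (d * p) ≡⟨ cong (_* (d * p)) (fromℕ-suc (suc k)) ⟨
      fromℕ (suc (suc k)) * (d * p) ∎
      where
      p = power x (suc k)
      q = power y (suc k)

    lower : ∀ k → fromℕ (suc k) * (d * power y k) ≤ power x (suc k) - power y (suc k)
    lower zero    = ℚ.≤-reflexive (solve 2 (λ x y → con 1ℚ :* ((x :- y) :* con 1ℚ) := x :* con 1ℚ :- y :* con 1ℚ) refl x y)
    lower (suc k) = begin
      fromℕ (suc (suc k)) * (d * q) ≡⟨ cong (_* (d * q)) (fromℕ-suc (suc k)) ⟩
      (1ℚ + fromℕ (suc k)) * (d * q) ≡⟨ solve 4 (λ y n d w → (con 1ℚ :+ n) :* (d :* (y :* w)) := y :* (n :* (d :* w)) :+ d :* (y :* w)) refl y (fromℕ (suc k)) d (power y k) ⟩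
      y * (fromℕ (suc k) * (d * power y k)) + d * q ≤⟨ ℚ.+-mono-≤ (*-monoˡ {fromℕ (suc k) * (d * power y k)} {p - q} y 0≤y (lower k)) (*-monoˡ {q} {p} d 0≤d (power-mono (suc k))) ⟩
      y * (p - q) + d * p ≡⟨ solve 4 (λ x y p q → y :* (p :- q) :+ (x :- y) :* p := x :* p :- y :* q) refl x y p q ⟩
      x * p - y * q ∎
      where
      p = power x (suc k)
      q = power y (suc k)

    cancel : ∀ k z → fromℕ (suc k) * z * recip k ≡ z
    cancel k z = trans (solve 3 (λ n z r → n :* z :* r := (n :* r) :* z) refl (fromℕ (suc k)) z (recip k)) (trans (cong (_* z) (recip-fromℕ k)) (ℚ.*-identityˡ z))

  term-upper : ∀ k → power x (suc k) * recip k ≤ power y (suc k) * recip k + d * power x k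
  term-upper k = begin
    power x (suc k) * recip k ≡⟨ solve 3 (λ p q r → p :* r := q :* r :+ (p :- q) :* r) refl (power x (suc k)) (power y (suc k)) (recip k) ⟩
    power y (suc k) * recip k + (power x (suc k) - power y (suc k)) * recip k
      ≤⟨ ℚ.+-monoʳ-≤ (power y (suc k) * recip k) (*-monoʳ {power x (suc k) - power y (suc k)} {fromℕ (suc k) * (d * power x k)} (recip k) (0≤recip k) (upper k)) ⟩
    power y (suc k) * recip k + fromℕ (suc k) * (d * power x k) * recip k ≡⟨ cong (λ z → power y (suc k) * recip k + z) (cancel k (d * power x k)) ⟩
    power y (suc k) * recip k + d * power x k ∎

  term-lower : ∀ k → power y (suc k) * recip k + d * power y k ≤ power x (suc k) * recip k
  term-lower k = begin
    power y (suc k) * recip k + d * power y k ≡⟨ cong (λ z → power y (suc k) * recip k + z) (cancel k (d * power y k)) ⟨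
    power y (suc k) * recip k + fromℕ (suc k) * (d * power y k) * recip k
      ≤⟨ ℚ.+-monoʳ-≤ (power y (suc k) * recip k) (*-monoʳ {fromℕ (suc k) * (d * power y k)} {power x (suc k) - power y (suc k)} (recip k) (0≤recip k) (lower k)) ⟩
    power y (suc k) * recip k + (power x (suc k) - power y (suc k)) * recip k ≡⟨ solve 3 (λ p q r → q :* r :+ (p :- q) :* r := p :* r) refl (power x (suc k)) (power y (suc k)) (recip k) ⟩
    power x (suc k) * recip k ∎

  -- For x = 1 - 1/u and y = 1 - 1/v this is log u - log v ≤ (u - v)/v with its truncation term: the
  -- increments are at most d x^k by the mean value bound, and they sum to α (1 - x^K).
  -- `mercator-lower` is the companion bound by (u - v)/u.
  mercator-upper : ∀ α → α * (1ℚ - x) ≡ d → ∀ K → mercatorSum x K + α * power x K ≤ mercatorSum y K + α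
  mercator-upper α e zero    = ℚ.≤-reflexive (cong (0ℚ +_) (ℚ.*-identityʳ α))
  mercator-upper α e (suc K) = begin
    (sx + px * r) + α * (x * pk) ≤⟨ ℚ.+-monoˡ-≤ (α * (x * pk)) (ℚ.+-monoʳ-≤ sx (term-upper K)) ⟩
    (sx + (py * r + d * pk)) + α * (x * pk) ≡⟨ cong (λ z → (sx + (py * r + z * pk)) + α * (x * pk)) (sym e) ⟩
    (sx + (py * r + α * (1ℚ - x) * pk)) + α * (x * pk) ≡⟨ solve 5 (λ s q α x p → (s :+ (q :+ α :* (con 1ℚ :- x) :* p)) :+ α :* (x :* p) := (s :+ α :* p) :+ q) refl sx (py * r) α x pk ⟩
    (sx + α * pk) + py * r ≤⟨ ℚ.+-monoˡ-≤ (py * r) (mercator-upper α e K) ⟩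
    (sy + α) + py * r ≡⟨ solve 3 (λ s a q → (s :+ a) :+ q := (s :+ q) :+ a) refl sy α (py * r) ⟩
    (sy + py * r) + α ∎
    where
    sx = mercatorSum x K ; sy = mercatorSum y K ; px = power x (suc K) ; py = power y (suc K) ; pk = power x K ; r = recip K

  mercator-lower : ∀ β → β * (1ℚ - y) ≡ d → ∀ K → mercatorSum y K + β ≤ mercatorSum x K + β * power y K
  mercator-lower β e zero    = ℚ.≤-reflexive (cong (0ℚ +_) (sym (ℚ.*-identityʳ β)))
  mercator-lower β e (suc K) = begin
    (sy + py * r) + β ≡⟨ solve 3 (λ s q b → (s :+ q) :+ b := (s :+ b) :+ q) refl sy (py * r) β ⟩
    (sy + β) + py * r ≤⟨ ℚ.+-monoˡ-≤ (py * r) (mercator-lower β e K) ⟩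
    (sx + β * pk) + py * r ≡⟨ solve 5 (λ s q β y p → (s :+ β :* p) :+ q := (s :+ (q :+ β :* (con 1ℚ :- y) :* p)) :+ β :* (y :* p)) refl sx (py * r) β y pk ⟩
    (sx + (py * r + β * (1ℚ - y) * pk)) + β * (y * pk) ≡⟨ cong (λ z → (sx + (py * r + z * pk)) + β * (y * pk)) e ⟩
    (sx + (py * r + d * pk)) + β * (y * pk) ≤⟨ ℚ.+-monoˡ-≤ (β * (y * pk)) (ℚ.+-monoʳ-≤ sx (term-lower K)) ⟩
    (sx + px * r) + β * (y * pk) ∎
    where
    sx = mercatorSum x K ; sy = mercatorSum y K ; px = power x (suc K) ; py = power y (suc K) ; pk = power y K ; r = recip K

recip-diff : ∀ i → recip i - recip (suc i) ≡ recip i * recip (suc i)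
recip-diff i = trans (cong₂ _-_ (trans (sym (ℚ.*-identityʳ a)) (cong (a *_) (sym (trans (cong (b *_) (sym (fromℕ-suc (suc i)))) (recip-inverse (suc i))))))
                                (trans (sym (ℚ.*-identityʳ b)) (cong (b *_) (sym (recip-inverse i)))))
  (solve 3 (λ a b n → a :* (b :* (con 1ℚ :+ n)) :- b :* (a :* n) := a :* b) refl a b (fromℕ (suc i)))
  where
  a = recip i
  b = recip (suc i)

private
  point : ℕ → ℚ
  point i = 1ℚ - recip i

  0≤point : ∀ i → 0ℚ ≤ point i
  0≤point i = diff-nonneg (recip i) 1ℚ (recip≤1 i)

  point≤1 : ∀ i → point i ≤ 1ℚ
  point≤1 i = subst (point i ≤_) (ℚ.+-identityʳ 1ℚ) (ℚ.+-monoʳ-≤ 1ℚ (ℚ.neg-antimono-≤ (0≤recip i)))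

  point-mono : ∀ i → point i ≤ point (suc i)
  point-mono i = ℚ.+-monoʳ-≤ 1ℚ (ℚ.neg-antimono-≤ (recip-anti (ℕ.n≤1+n i)))

  point-diff : ∀ i → point (suc i) - point i ≡ recip i * recip (suc i)
  point-diff i = trans (solve 2 (λ a b → (con 1ℚ :- b) :- (con 1ℚ :- a) := a :- b) refl (recip i) (recip (suc i))) (recip-diff i)

mercator≤H : ∀ i K → mercatorSum (1ℚ - recip i) K ≤ H i
mercator≤H zero    zero    = ℚ.≤-refl
mercator≤H zero    (suc K) = subst (_≤ 0ℚ) (solve 3 (λ s p r → s := s :+ con 0ℚ :* p :* r) refl (mercatorSum (1ℚ - recip 0) K) (power (1ℚ - recip 0) K) (recip K)) (mercator≤H zero K)
mercator≤H (suc i) K = begin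
  mercatorSum (point (suc i)) K ≤⟨ ≤-+ʳ (mercatorSum (point (suc i)) K) (recip i * power (point (suc i)) K) (0≤* (0≤recip i) (0≤power (point (suc i)) (0≤point (suc i)) K)) ⟩
  mercatorSum (point (suc i)) K + recip i * power (point (suc i)) K ≤⟨ PowerDiff.mercator-upper (point (suc i)) (point i) (0≤point i) (point-mono i) (recip i) eq K ⟩
  mercatorSum (point i) K + recip i ≤⟨ ℚ.+-monoˡ-≤ (recip i) (mercator≤H i K) ⟩
  H i + recip i ∎
  where
  eq : recip i * (1ℚ - point (suc i)) ≡ point (suc i) - point i
  eq = trans (solve 2 (λ a b → a :* (con 1ℚ :- (con 1ℚ :- b)) := a :* b) refl (recip i) (recip (suc i))) (sym (point-diff i))

-- The right side is (1 - y)(1 + y + ... + y^(K-1)), and each of these K powers is at least y^K. It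
-- supplies an explicit rate at which y^K tends to 0 for y < 1.
bernoulli : ∀ y → 0ℚ ≤ y → y ≤ 1ℚ → ∀ K → fromℕ K * (power y K * (1ℚ - y)) ≤ 1ℚ - power y K
bernoulli y 0≤y y≤1 zero    = ℚ.≤-reflexive (solve 1 (λ z → con 0ℚ :* z := con 1ℚ :- con 1ℚ) refl (1ℚ * (1ℚ - y)))
bernoulli y 0≤y y≤1 (suc K) = begin
  fromℕ (suc K) * (y * p * (1ℚ - y)) ≡⟨ cong (_* (y * p * (1ℚ - y))) (fromℕ-suc K) ⟩
  (1ℚ + fromℕ K) * (y * p * (1ℚ - y)) ≡⟨ solve 3 (λ n y p → (con 1ℚ :+ n) :* (y :* p :* (con 1ℚ :- y)) := y :* (n :* (p :* (con 1ℚ :- y))) :+ y :* p :* (con 1ℚ :- y)) refl (fromℕ K) y p ⟩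
  y * (fromℕ K * (p * (1ℚ - y))) + y * p * (1ℚ - y) ≤⟨ ℚ.+-monoˡ-≤ (y * p * (1ℚ - y)) (*-monoˡ {fromℕ K * (p * (1ℚ - y))} {1ℚ - p} y 0≤y (bernoulli y 0≤y y≤1 K)) ⟩
  y * (1ℚ - p) + y * p * (1ℚ - y) ≤⟨ ≤-+ʳ (y * (1ℚ - p) + y * p * (1ℚ - y)) ((1ℚ - y) * (1ℚ - y * p)) (0≤* (diff-nonneg y 1ℚ y≤1) (diff-nonneg (y * p) 1ℚ (pow≤1 (suc K)))) ⟩
  y * (1ℚ - p) + y * p * (1ℚ - y) + (1ℚ - y) * (1ℚ - y * p) ≡⟨ solve 2 (λ y p → y :* (con 1ℚ :- p) :+ y :* p :* (con 1ℚ :- y) :+ (con 1ℚ :- y) :* (con 1ℚ :- y :* p) := con 1ℚ :- y :* p) refl y p ⟩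
  1ℚ - y * p ∎
  where
  p = power y K
  pow≤1 : ∀ k → power y k ≤ 1ℚ
  pow≤1 zero    = ℚ.≤-refl
  pow≤1 (suc k) = *-mono {y} {1ℚ} {power y k} {1ℚ} (0≤power y 0≤y k) 0≤1 y≤1 (pow≤1 k)

power-point-small : ∀ t K → (3 ℕ.+ t) ℕ.* (3 ℕ.+ t) ℕ.≤ K → power (1ℚ - recip t) K ≤ recip (2 ℕ.+ t)
power-point-small t K h = begin
  p ≡⟨ trans (sym (ℚ.*-identityʳ p)) (cong (p *_) (sym (recip-inverse (2 ℕ.+ t)))) ⟩
  p * (c * fromℕ (3 ℕ.+ t)) ≡⟨ solve 3 (λ p c n → p :* (c :* n) := (n :* p) :* c) refl p c (fromℕ (3 ℕ.+ t)) ⟩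
  fromℕ (3 ℕ.+ t) * p * c ≤⟨ *-monoʳ {fromℕ (3 ℕ.+ t) * p} {1ℚ} c (0≤recip (2 ℕ.+ t)) small ⟩
  1ℚ * c ≡⟨ ℚ.*-identityˡ c ⟩
  c ∎
  where
  y = point t
  p = power y K
  c = recip (2 ℕ.+ t)
  0≤p : 0ℚ ≤ p
  0≤p = 0≤power y (0≤point t) K
  big : (3 ℕ.+ t) ℕ.* suc t ℕ.≤ K
  big = ℕ.≤-trans (ℕ.*-monoʳ-≤ (3 ℕ.+ t) (s≤s (ℕ.m≤n+m t 2))) h
  small : fromℕ (3 ℕ.+ t) * p ≤ 1ℚ
  small = begin
    fromℕ (3 ℕ.+ t) * p ≡⟨ trans (sym (ℚ.*-identityʳ (fromℕ (3 ℕ.+ t) * p))) (cong (fromℕ (3 ℕ.+ t) * p *_) (sym (recip-fromℕ t))) ⟩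
    fromℕ (3 ℕ.+ t) * p * (fromℕ (suc t) * recip t) ≡⟨ solve 4 (λ a p b r → a :* p :* (b :* r) := (a :* b) :* (p :* r)) refl (fromℕ (3 ℕ.+ t)) p (fromℕ (suc t)) (recip t) ⟩
    fromℕ (3 ℕ.+ t) * fromℕ (suc t) * (p * recip t) ≡⟨ cong (_* (p * recip t)) (fromℕ-* (3 ℕ.+ t) (suc t)) ⟨
    fromℕ ((3 ℕ.+ t) ℕ.* suc t) * (p * recip t) ≤⟨ *-monoʳ (p * recip t) (0≤* 0≤p (0≤recip t)) (fromℕ-mono big) ⟩
    fromℕ K * (p * recip t) ≡⟨ cong (λ z → fromℕ K * (p * z)) (solve 1 (λ r → r := con 1ℚ :- (con 1ℚ :- r)) refl (recip t)) ⟩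
    fromℕ K * (p * (1ℚ - y)) ≤⟨ bernoulli y (0≤point t) (point≤1 t) K ⟩
    1ℚ - p ≤⟨ ≤-+ʳ (1ℚ - p) p 0≤p ⟩
    1ℚ - p + p ≡⟨ solve 1 (λ p → con 1ℚ :- p :+ p := con 1ℚ) refl p ⟩
    1ℚ ∎

-- The full increment of log would be at least β = 1/(t+2). Truncation at K loses β p, where p ≤ c =
-- 1/(t+3), and β - β c = c. Shifting the harmonic sum by one place, which is why it starts at 1/3,
-- pays for exactly this loss.
H₃≤mercator : ∀ t K → (3 ℕ.+ t) ℕ.* (3 ℕ.+ t) ℕ.≤ K → H₃ t ≤ mercatorSum (1ℚ - recip t) K
H₃≤mercator zero    K h = go K
  where
  go : ∀ K → 0ℚ ≤ mercatorSum (1ℚ - recip 0) K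
  go zero    = ℚ.≤-refl
  go (suc K) = 0≤+ (go K) (0≤* (0≤power (1ℚ - recip 0) ℚ.≤-refl (suc K)) (0≤recip K))
H₃≤mercator (suc t) K h = ≤-from-diff (H₃ t + c) sx (subst (0ℚ ≤_)
    (solve 5 (λ s β p g c → (s :+ β :* p) :- (g :+ β) :+ (β :- β :* p :- c) := s :- (g :+ c)) refl sx β p (H₃ t) c)
    (0≤+ (diff-nonneg (H₃ t + β) (sx + β * p) (ℚ.≤-trans (ℚ.+-monoˡ-≤ β (H₃≤mercator t K h′)) (PowerDiff.mercator-lower (point (suc t)) (point t) (0≤point t) (point-mono t) β eq K)))
         gap))
  where
  sx = mercatorSum (point (suc t)) K
  β = recip (suc t)
  c = recip (2 ℕ.+ t)
  p = power (point t) K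
  h′ : (3 ℕ.+ t) ℕ.* (3 ℕ.+ t) ℕ.≤ K
  h′ = ℕ.≤-trans (ℕ.*-mono-≤ (ℕ.n≤1+n (3 ℕ.+ t)) (ℕ.n≤1+n (3 ℕ.+ t))) h
  eq : β * (1ℚ - point t) ≡ point (suc t) - point t
  eq = trans (solve 2 (λ a b → b :* (con 1ℚ :- (con 1ℚ :- a)) := a :* b) refl (recip t) β) (sym (point-diff t))
  gap : 0ℚ ≤ β - β * p - c
  gap = begin
    0ℚ ≤⟨ 0≤* (0≤recip (suc t)) (diff-nonneg p c (power-point-small t K h′)) ⟩
    β * (c - p) ≡⟨ solve 3 (λ β c p → β :* (c :- p) := β :- β :* p :- (β :- β :* c)) refl β c p ⟩
    β - β * p - (β - β * c) ≡⟨ cong (λ z → β - β * p - z) (trans (cong (λ z → β - z) (sym (recip-diff (suc t)))) (solve 2 (λ b c → b :- (b :- c) := c) refl β c)) ⟩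
    β - β * p - c ∎

open import Data.Integer.Base using (+_)
open ResidueSums using (Scale; module Scale)

-- The parameters Q ≍ T^{1/4}, L = (r + 1)² ≍ log T and the exponent η = 8/(r + 1)

H-mono : ∀ {m n} → m ℕ.≤ n → H m ≤ H n
H-mono {m} {n} m≤n = subst (λ z → H m ≤ H z) (ℕ.m∸n+n≡m m≤n) (go (n ℕ.∸ m))
  where
  go : ∀ j → H m ≤ H (j ℕ.+ m)
  go zero    = ℚ.≤-refl
  go (suc j) = ℚ.≤-trans (go j) (≤-+ʳ (H (j ℕ.+ m)) (recip (j ℕ.+ m)) (0≤recip (j ℕ.+ m)))

H₃-mono : ∀ {m n} → m ℕ.≤ n → H₃ m ≤ H₃ n
H₃-mono {m} {n} m≤n = subst (λ z → H₃ m ≤ H₃ z) (ℕ.m∸n+n≡m m≤n) (go (n ℕ.∸ m))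
  where
  go : ∀ j → H₃ m ≤ H₃ (j ℕ.+ m)
  go zero    = ℚ.≤-refl
  go (suc j) = ℚ.≤-trans (go j) (≤-+ʳ (H₃ (j ℕ.+ m)) (recip (2 ℕ.+ (j ℕ.+ m))) (0≤recip (2 ℕ.+ (j ℕ.+ m))))

-- The n terms added in passing from n to 2n are each at least 1/(2n).
H-double : ∀ m → fromℕ 2 * H (suc m) + 1ℚ ≤ fromℕ 2 * H (suc m ℕ.+ suc m)
H-double m = begin
  fromℕ 2 * H n + 1ℚ ≡⟨ cong (λ z → fromℕ 2 * H n + z) (trans (sym (recip-fromℕ (m ℕ.+ n))) (cong (_* r) (fromℕ-+ n n))) ⟩
  fromℕ 2 * H n + (fromℕ n + fromℕ n) * r ≡⟨ solve 3 (λ h n r → con (fromℕ 2) :* h :+ (n :+ n) :* r := con (fromℕ 2) :* (h :+ n :* r)) refl (H n) (fromℕ n) r ⟩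
  fromℕ 2 * (H n + fromℕ n * r) ≤⟨ *-monoˡ {H n + fromℕ n * r} {H (n ℕ.+ n)} (fromℕ 2) (0≤fromℕ 2) (go n ℕ.≤-refl) ⟩
  fromℕ 2 * H (n ℕ.+ n) ∎
  where
  n = suc m
  r = recip (m ℕ.+ n)
  go : ∀ j → j ℕ.≤ n → H n + fromℕ j * r ≤ H (n ℕ.+ j)
  go zero    _   = ℚ.≤-reflexive (trans (solve 2 (λ h r → h :+ con 0ℚ :* r := h) refl (H n) r) (cong H (sym (ℕ.+-identityʳ n))))
  go (suc j) j<n = begin
    H n + fromℕ (suc j) * r ≡⟨ cong (λ z → H n + z * r) (fromℕ-suc j) ⟩
    H n + (1ℚ + fromℕ j) * r ≡⟨ solve 3 (λ h n r → h :+ (con 1ℚ :+ n) :* r := (h :+ n :* r) :+ r) refl (H n) (fromℕ j) r ⟩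
    (H n + fromℕ j * r) + r ≤⟨ ℚ.+-mono-≤ (go j (ℕ.<⇒≤ j<n)) (recip-anti (ℕ.≤-trans (ℕ.≤-reflexive (sym (ℕ.+-suc m j))) (ℕ.+-monoʳ-≤ m j<n))) ⟩
    H (n ℕ.+ j) + recip (n ℕ.+ j) ≡⟨ cong H (ℕ.+-suc n j) ⟨
    H (n ℕ.+ suc j) ∎

H-2^ : ∀ k → fromℕ (2 ℕ.+ k) ≤ fromℕ 2 * H (2 ℕ.^ k)
H-2^ zero    = ℚ.≤-refl
H-2^ (suc k) = begin
  fromℕ (3 ℕ.+ k) ≡⟨ trans (fromℕ-suc (2 ℕ.+ k)) (ℚ.+-comm 1ℚ (fromℕ (2 ℕ.+ k))) ⟩
  fromℕ (2 ℕ.+ k) + 1ℚ ≤⟨ ℚ.+-monoˡ-≤ 1ℚ (H-2^ k) ⟩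
  fromℕ 2 * H n + 1ℚ ≤⟨ subst (λ z → fromℕ 2 * H z + 1ℚ ≤ fromℕ 2 * H (z ℕ.+ z)) (ℕ.suc-pred n {{ℕ.m^n≢0 2 k}}) (H-double (ℕ.pred n)) ⟩
  fromℕ 2 * H (n ℕ.+ n) ≡⟨ cong (λ z → fromℕ 2 * H (n ℕ.+ z)) (ℕ.+-identityʳ n) ⟨
  fromℕ 2 * H (2 ℕ.^ suc k) ∎
  where n = 2 ℕ.^ k

H≡H₃ : ∀ t → H (2 ℕ.+ t) ≡ 1ℚ + ½ + H₃ t
H≡H₃ zero    = refl
H≡H₃ (suc t) = trans (cong (_+ recip (2 ℕ.+ t)) (H≡H₃ t)) (ℚ.+-assoc (1ℚ + ½) (H₃ t) (recip (2 ℕ.+ t)))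

log₂≤H₃ : ∀ t k → 2 ℕ.^ k ℕ.≤ 2 ℕ.+ t → fromℕ k ≤ fromℕ 2 * H₃ t + 1ℚ
log₂≤H₃ t k h = begin
  fromℕ k ≡⟨ solve 1 (λ k → k := con (fromℕ 2) :+ k :- con (fromℕ 2)) refl (fromℕ k) ⟩
  fromℕ 2 + fromℕ k - fromℕ 2 ≡⟨ cong (_- fromℕ 2) (fromℕ-+ 2 k) ⟨
  fromℕ (2 ℕ.+ k) - fromℕ 2 ≤⟨ ℚ.+-monoˡ-≤ (- fromℕ 2) (ℚ.≤-trans (H-2^ k) (*-monoˡ {H (2 ℕ.^ k)} {H (2 ℕ.+ t)} (fromℕ 2) (0≤fromℕ 2) (H-mono h))) ⟩
  fromℕ 2 * H (2 ℕ.+ t) - fromℕ 2 ≡⟨ cong (λ z → fromℕ 2 * z - fromℕ 2) (H≡H₃ t) ⟩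
  fromℕ 2 * (1ℚ + ½ + H₃ t) - fromℕ 2 ≡⟨ solve 1 (λ g → con (fromℕ 2) :* (con 1ℚ :+ con ½ :+ g) :- con (fromℕ 2) := con (fromℕ 2) :* g :+ con 1ℚ) refl (H₃ t) ⟩
  fromℕ 2 * H₃ t + 1ℚ ∎

-- The threshold fits its use: if Y ≥ 1 then t + 1 = T ≥ s ≥ 8.
1≤H₃ : ∀ t → 7 ℕ.≤ t → 1ℚ ≤ H₃ t
1≤H₃ t h = ℚ.≤-trans (toWitness {a? = 1ℚ ℚ.≤? H₃ 7} _) (H₃-mono h)

floorInverse : (f : ℕ → ℕ) → (∀ k → f k ℕ.< f (suc k)) → ∀ n → f 0 ℕ.≤ n → ∃[ k ] f k ℕ.≤ n × n ℕ.< f (suc k)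
floorInverse f inc zero    f0≤0 = 0 , f0≤0 , ℕ.≤-<-trans z≤n (inc 0)
floorInverse f inc (suc n) f0≤1+n with f 0 ℕ.≤? n
... | no f0≰n = 0 , f0≤1+n , subst (ℕ._< f 1) (ℕ.≤-antisym f0≤1+n (ℕ.≰⇒> f0≰n)) (inc 0)
... | yes f0≤n with floorInverse f inc n f0≤n
...   | k , lo , hi with suc n ℕ.<? f (suc k)
...     | yes hi′ = k , ℕ.≤-trans lo (ℕ.n≤1+n n) , hi′
...     | no ¬hi′ = suc k , ℕ.≮⇒≥ ¬hi′ , ℕ.≤-<-trans hi (inc (suc k))

abstract
  -- r is about the square root of log₂ T, so that both L = (r + 1)² and the exponent 8/(r + 1) are
  -- simple in r. The searches are kept opaque, since only the stated inequalities are used.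
  rootLog : (T : ℕ) → ∃[ r ] 2 ℕ.^ (r ℕ.* r) ℕ.≤ suc T × suc T ℕ.< 2 ℕ.^ (suc r ℕ.* suc r)
  rootLog T = floorInverse (λ r → 2 ℕ.^ (r ℕ.* r)) (λ k → ℕ.^-monoʳ-< 2 (s≤s (s≤s z≤n)) (ℕ.*-mono-< (ℕ.n<1+n k) (ℕ.n<1+n k))) (suc T) (s≤s z≤n)

  fourthRoot : (T : ℕ) → ∃[ k ] k ℕ.* k ℕ.* (k ℕ.* k) ℕ.≤ T × T ℕ.< suc k ℕ.* suc k ℕ.* (suc k ℕ.* suc k)
  fourthRoot T = floorInverse (λ k → k ℕ.* k ℕ.* (k ℕ.* k)) (λ k → ℕ.*-mono-< (ℕ.*-mono-< (ℕ.n<1+n k) (ℕ.n<1+n k)) (ℕ.*-mono-< (ℕ.n<1+n k) (ℕ.n<1+n k))) T z≤n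

logRoot : ℕ → ℕ
logRoot T = proj₁ (rootLog T)

module Parameters (t : ℕ) where
  T k Q r L : ℕ
  T = suc t
  k = proj₁ (fourthRoot T)
  Q = suc k
  r = logRoot T
  L = suc r ℕ.* suc r

  private
    k⁴≤T : k ℕ.* k ℕ.* (k ℕ.* k) ℕ.≤ T
    k⁴≤T = proj₁ (proj₂ (fourthRoot T))
    T<Q⁴ : T ℕ.< Q ℕ.* Q ℕ.* (Q ℕ.* Q)
    T<Q⁴ = proj₂ (proj₂ (fourthRoot T))
    1≤k : 1 ℕ.≤ k
    1≤k = go k T<Q⁴
      where
      go : ∀ k → T ℕ.< suc k ℕ.* suc k ℕ.* (suc k ℕ.* suc k) → 1 ℕ.≤ k
      go zero    (s≤s ())
      go (suc _) _ = s≤s z≤n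
    Q≤2k : Q ℕ.≤ 2 ℕ.* k
    Q≤2k = ℕ.≤-trans (ℕ.+-monoˡ-≤ k 1≤k) (ℕ.≤-reflexive (cong (k ℕ.+_) (sym (ℕ.+-identityʳ k))))
    k²≤k⁴ : k ℕ.* k ℕ.≤ k ℕ.* k ℕ.* (k ℕ.* k)
    k²≤k⁴ = ℕ.m≤m*n (k ℕ.* k) (k ℕ.* k) {{ℕ.>-nonZero (ℕ.*-mono-≤ 1≤k 1≤k)}}

  Q⁴≤16T : Q ℕ.* Q ℕ.* (Q ℕ.* Q) ℕ.≤ 16 ℕ.* T
  Q⁴≤16T = ℕ.≤-trans (ℕ.*-mono-≤ (ℕ.*-mono-≤ Q≤2k Q≤2k) (ℕ.*-mono-≤ Q≤2k Q≤2k)) (ℕ.≤-trans (ℕ.≤-reflexive (e k)) (ℕ.*-monoʳ-≤ 16 k⁴≤T))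
    where
    e : ∀ k → 2 ℕ.* k ℕ.* (2 ℕ.* k) ℕ.* (2 ℕ.* k ℕ.* (2 ℕ.* k)) ≡ 16 ℕ.* (k ℕ.* k ℕ.* (k ℕ.* k))
    e = solve-∀
  private
    Q²≤4T : Q ℕ.* Q ℕ.≤ 4 ℕ.* T
    Q²≤4T = ℕ.≤-trans (ℕ.*-mono-≤ Q≤2k Q≤2k) (ℕ.≤-trans (ℕ.≤-reflexive (e k)) (ℕ.*-monoʳ-≤ 4 (ℕ.≤-trans k²≤k⁴ k⁴≤T)))
      where
      e : ∀ k → 2 ℕ.* k ℕ.* (2 ℕ.* k) ≡ 4 ℕ.* (k ℕ.* k)
      e = solve-∀
    1+T<2^L : suc T ℕ.< 2 ℕ.^ L
    1+T<2^L = proj₂ (proj₂ (rootLog T))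

  2^r²≤ : 2 ℕ.^ (r ℕ.* r) ℕ.≤ 2 ℕ.+ t
  2^r²≤ = proj₁ (proj₂ (rootLog T))
  1≤r : 1 ℕ.≤ r
  1≤r = go r 1+T<2^L
    where
    go : ∀ r → suc T ℕ.< 2 ℕ.^ (suc r ℕ.* suc r) → 1 ℕ.≤ r
    go zero    (s≤s (s≤s ()))
    go (suc _) _ = s≤s z≤n

  scale : Scale T Q L
  scale = record
    { 1≤T   = s≤s z≤n
    ; 2≤Q   = s≤s 1≤k
    ; 1≤L   = s≤s z≤n
    ; T≤Q⁴  = ℕ.<⇒≤ T<Q⁴
    ; Q²≤4T = Q²≤4T
    ; T<2^L = ℕ.<⇒≤ 1+T<2^L
    ; Q<2^L = ℕ.≤-<-trans (s≤s (ℕ.≤-trans (ℕ.m≤m*n k k {{ℕ.>-nonZero 1≤k}}) (ℕ.≤-trans k²≤k⁴ k⁴≤T))) 1+T<2^L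
    }

-- The quantities T, Q and L against truncated exponentials.

-- The last term alone is r⁶/6!, and 6! = 720.
fromℕ-≤-expSum : ∀ r → fromℕ (r ℕ.* r ℕ.* (r ℕ.* r) ℕ.* (r ℕ.* r)) ≤ fromℕ 720 * expSum (fromℕ r) 6
fromℕ-≤-expSum r = begin
  fromℕ (r ℕ.* r ℕ.* (r ℕ.* r) ℕ.* (r ℕ.* r)) ≡⟨ trans (fromℕ-* (r ℕ.* r ℕ.* (r ℕ.* r)) (r ℕ.* r)) (cong₂ _*_ (trans (fromℕ-* (r ℕ.* r) (r ℕ.* r)) (cong₂ _*_ (fromℕ-* r r) (fromℕ-* r r))) (fromℕ-* r r)) ⟩
  x * x * (x * x) * (x * x) ≡⟨ solve 1 (λ x → x :* x :* (x :* x) :* (x :* x) := con (fromℕ 720) :* (con 1ℚ :* (x :* con (recip 0)) :* (x :* con (recip 1)) :* (x :* con (recip 2)) :* (x :* con (recip 3)) :* (x :* con (recip 4)) :* (x :* con (recip 5)))) refl x ⟩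
  fromℕ 720 * expTerm x 6 ≤⟨ *-monoˡ {expTerm x 6} {expSum x 6} (fromℕ 720) (0≤fromℕ 720) (subst (_≤ expSum x 6) (ℚ.+-identityˡ (expTerm x 6)) (ℚ.+-monoˡ-≤ (expTerm x 6) (0≤expSum x (0≤fromℕ r) 5))) ⟩
  fromℕ 720 * expSum x 6 ∎
  where x = fromℕ r

square-cancel-≤ : ∀ p q → 0ℚ ≤ p → 0ℚ ≤ q → p * p ≤ q * q → p ≤ q
square-cancel-≤ p q 0≤p 0≤q h with p ℚ.≤? q
... | yes p≤q = p≤q
... | no  p≰q = contradiction (ℚ.<-≤-trans q²<p² h) (ℚ.<-irrefl refl)
  where
  q<p : q < p
  q<p = ℚ.≰⇒> p≰q
  q²<p² : q * q < p * p
  q²<p² = ℚ.≤-<-trans (*-monoˡ {q} {p} q 0≤q (ℚ.<⇒≤ q<p)) (ℚ.*-monoˡ-<-pos p {{positive (ℚ.≤-<-trans 0≤q q<p)}} q<p)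

module _ (t Q : ℕ) (T≤Q⁴ : suc t ℕ.≤ Q ℕ.* Q ℕ.* (Q ℕ.* Q)) where
  -- The square of the left side is at most a truncation of exp z, hence at most 4 T ≤ (2 Q²)². The
  -- 4 of `expSum-H` is the origin of the 2 in `s`.
  expSum-½-upper : ∀ z n → 0ℚ ≤ z → z ≤ H t → expSum (½ * z) n ≤ fromℕ (2 ℕ.* (Q ℕ.* Q))
  expSum-½-upper z n 0≤z z≤H = square-cancel-≤ e s (0≤expSum (½ * z) 0≤½z n) (0≤fromℕ (2 ℕ.* (Q ℕ.* Q))) (begin
    e * e ≤⟨ expSum-+-≥ (½ * z) (½ * z) 0≤½z 0≤½z n n ⟩
    expSum (½ * z + ½ * z) (n ℕ.+ n) ≡⟨ cong (λ w → expSum w (n ℕ.+ n)) (solve 1 (λ z → con ½ :* z :+ con ½ :* z := z) refl z) ⟩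
    expSum z (n ℕ.+ n) ≤⟨ expSum-monoˡ z (H (suc t)) 0≤z (ℚ.≤-trans z≤H (≤-+ʳ (H t) (recip t) (0≤recip t))) (n ℕ.+ n) ⟩
    expSum (H (suc t)) (n ℕ.+ n) ≤⟨ expSum-H t (n ℕ.+ n) ⟩
    fromℕ 4 * fromℕ (suc t) ≡⟨ fromℕ-* 4 (suc t) ⟨
    fromℕ (4 ℕ.* suc t) ≤⟨ fromℕ-mono (ℕ.≤-trans (ℕ.*-monoʳ-≤ 4 T≤Q⁴) (ℕ.≤-reflexive (c Q))) ⟩
    fromℕ (2 ℕ.* (Q ℕ.* Q) ℕ.* (2 ℕ.* (Q ℕ.* Q))) ≡⟨ fromℕ-* (2 ℕ.* (Q ℕ.* Q)) (2 ℕ.* (Q ℕ.* Q)) ⟩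
    s * s ∎)
    where
    e = expSum (½ * z) n
    s = fromℕ (2 ℕ.* (Q ℕ.* Q))
    0≤½z : 0ℚ ≤ ½ * z
    0≤½z = 0≤* (ℚ.nonNegative⁻¹ ½) 0≤z
    c : ∀ Q → 4 ℕ.* (Q ℕ.* Q ℕ.* (Q ℕ.* Q)) ≡ 2 ℕ.* (Q ℕ.* Q) ℕ.* (2 ℕ.* (Q ℕ.* Q))
    c = solve-∀

¼ : ℚ
¼ = ½ * ½

module _ (t Q : ℕ) (Q⁴≤16T : Q ℕ.* Q ℕ.* (Q ℕ.* Q) ℕ.≤ 16 ℕ.* suc t) where
  private
    g = H₃ t
    q = g * ¼
    e = expSum q t
    0≤q : 0ℚ ≤ q
    0≤q = 0≤* (0≤H₃ t) (ℚ.nonNegative⁻¹ ¼)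
    0≤e : 0ℚ ≤ e
    0≤e = 0≤expSum q 0≤q t

    fourth : expSum g t ≤ e * e * (e * e)
    fourth = begin
      expSum g t ≡⟨ cong (λ w → expSum w t) (solve 1 (λ g → g := (g :* con ¼ :+ g :* con ¼) :+ (g :* con ¼ :+ g :* con ¼)) refl g) ⟩
      expSum ((q + q) + (q + q)) t ≤⟨ expSum-+-≤ (q + q) (q + q) (0≤+ 0≤q 0≤q) (0≤+ 0≤q 0≤q) t ⟩
      expSum (q + q) t * expSum (q + q) t ≤⟨ *-mono {expSum (q + q) t} {e * e} {expSum (q + q) t} {e * e} (0≤expSum (q + q) (0≤+ 0≤q 0≤q) t) (0≤* 0≤e 0≤e) two two ⟩
      e * e * (e * e) ∎
      where
      two : expSum (q + q) t ≤ e * e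
      two = expSum-+-≤ q q 0≤q 0≤q t

  -- Fourth powers are compared and two square roots taken. The constant 3 of `expSum-H₃` is rounded
  -- up to 16, so that 16 · 16 = 4⁴ is a fourth power.
  expSum-¼ : fromℕ Q ≤ fromℕ 4 * expSum (H₃ t * ¼) t
  expSum-¼ = square-cancel-≤ (fromℕ Q) (fromℕ 4 * e) (0≤fromℕ Q) 0≤4e
    (square-cancel-≤ (fromℕ Q * fromℕ Q) (fromℕ 4 * e * (fromℕ 4 * e)) (0≤* (0≤fromℕ Q) (0≤fromℕ Q)) (0≤* 0≤4e 0≤4e) (begin
      fromℕ Q * fromℕ Q * (fromℕ Q * fromℕ Q) ≡⟨ trans (fromℕ-* (Q ℕ.* Q) (Q ℕ.* Q)) (cong₂ _*_ (fromℕ-* Q Q) (fromℕ-* Q Q)) ⟨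
      fromℕ (Q ℕ.* Q ℕ.* (Q ℕ.* Q)) ≤⟨ fromℕ-mono (ℕ.≤-trans Q⁴≤16T (ℕ.*-monoʳ-≤ 16 (s≤s (ℕ.m≤n+m t 2)))) ⟩
      fromℕ (16 ℕ.* (3 ℕ.+ t)) ≡⟨ fromℕ-* 16 (3 ℕ.+ t) ⟩
      fromℕ 16 * fromℕ (3 ℕ.+ t) ≤⟨ *-monoˡ {fromℕ (3 ℕ.+ t)} {fromℕ 3 * expSum g t} (fromℕ 16) (0≤fromℕ 16) (expSum-H₃ t) ⟩
      fromℕ 16 * (fromℕ 3 * expSum g t) ≤⟨ *-monoˡ {fromℕ 3 * expSum g t} {fromℕ 16 * (e * e * (e * e))} (fromℕ 16) (0≤fromℕ 16)
                                                          (*-mono {fromℕ 3} {fromℕ 16} {expSum g t} {e * e * (e * e)} (0≤expSum g (0≤H₃ t) t) (0≤fromℕ 16) (fromℕ-mono {3} {16} (s≤s (s≤s (s≤s z≤n)))) fourth) ⟩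
      fromℕ 16 * (fromℕ 16 * (e * e * (e * e))) ≡⟨ solve 1 (λ e → con (fromℕ 16) :* (con (fromℕ 16) :* (e :* e :* (e :* e))) := con (fromℕ 4) :* e :* (con (fromℕ 4) :* e) :* (con (fromℕ 4) :* e :* (con (fromℕ 4) :* e))) refl e ⟩
      fromℕ 4 * e * (fromℕ 4 * e) * (fromℕ 4 * e * (fromℕ 4 * e)) ∎))
    where
    0≤4e : 0ℚ ≤ fromℕ 4 * e
    0≤4e = 0≤* (0≤fromℕ 4) 0≤e

-- L³ = (r + 1)⁶ ≤ 64 r⁶, and r⁶ is below 6! times exp z as soon as r ≤ z. For r = 1 the bound r ≤ z
-- is not at hand, but there L³ = 64 outright.
expSum-sextic : ∀ r z → 1 ℕ.≤ r → 0ℚ ≤ z → (2 ℕ.≤ r → fromℕ r ≤ z) →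
                let L = suc r ℕ.* suc r in fromℕ (L ℕ.* (L ℕ.* L)) ≤ fromℕ 64 * (fromℕ 720 * expSum z 6)
expSum-sextic r z 1≤r 0≤z r≤z = go (2 ℕ.≤? r)
  where
  r⁶ L : ℕ
  r⁶ = r ℕ.* r ℕ.* (r ℕ.* r) ℕ.* (r ℕ.* r)
  L = suc r ℕ.* suc r
  1+r≤ : suc r ℕ.≤ 2 ℕ.* r
  1+r≤ = ℕ.≤-trans (ℕ.+-monoˡ-≤ r 1≤r) (ℕ.≤-reflexive (cong (r ℕ.+_) (sym (ℕ.+-identityʳ r))))
  L≤ : L ℕ.≤ 2 ℕ.* r ℕ.* (2 ℕ.* r)
  L≤ = ℕ.*-mono-≤ 1+r≤ 1+r≤
  e : ∀ r → 2 ℕ.* r ℕ.* (2 ℕ.* r) ℕ.* (2 ℕ.* r ℕ.* (2 ℕ.* r) ℕ.* (2 ℕ.* r ℕ.* (2 ℕ.* r))) ≡ 64 ℕ.* (r ℕ.* r ℕ.* (r ℕ.* r) ℕ.* (r ℕ.* r))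
  e = solve-∀
  L³≤ : L ℕ.* (L ℕ.* L) ℕ.≤ 64 ℕ.* r⁶
  L³≤ = ℕ.≤-trans (ℕ.*-mono-≤ L≤ (ℕ.*-mono-≤ L≤ L≤)) (ℕ.≤-reflexive (e r))
  scale : ∀ x y → x ≤ y → fromℕ 64 * x ≤ fromℕ 64 * y
  scale x y = *-monoˡ {x} {y} (fromℕ 64) (0≤fromℕ 64)
  go : Dec (2 ℕ.≤ r) → fromℕ (L ℕ.* (L ℕ.* L)) ≤ fromℕ 64 * (fromℕ 720 * expSum z 6)
  go (yes 2≤r) = ℚ.≤-trans (fromℕ-mono L³≤) (ℚ.≤-trans (ℚ.≤-reflexive (fromℕ-* 64 r⁶)) (scale (fromℕ r⁶) (fromℕ 720 * expSum z 6)
    (ℚ.≤-trans (fromℕ-≤-expSum r) (*-monoˡ {expSum (fromℕ r) 6} {expSum z 6} (fromℕ 720) (0≤fromℕ 720) (expSum-monoˡ (fromℕ r) z (0≤fromℕ r) (r≤z 2≤r) 6)))))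
  go (no 2≰r)  = ℚ.≤-trans (ℚ.≤-reflexive (trans (cong (λ k → fromℕ (suc k ℕ.* suc k ℕ.* (suc k ℕ.* suc k ℕ.* (suc k ℕ.* suc k)))) (ℕ.≤-antisym (ℕ.s≤s⁻¹ (ℕ.≰⇒> 2≰r)) 1≤r)) (sym (ℚ.*-identityʳ (fromℕ 64)))))
    (scale 1ℚ (fromℕ 720 * expSum z 6) (subst (_≤ fromℕ 720 * expSum z 6) (ℚ.*-identityˡ 1ℚ)
      (*-mono {1ℚ} {fromℕ 720} {1ℚ} {expSum z 6} 0≤1 (0≤fromℕ 720) (fromℕ-mono {1} {720} (s≤s z≤n)) (1≤expSum z 0≤z 6))))

-- Large enough that its product with `H₃ t` exceeds r when r ≥ 2, so that the resulting power of T
-- absorbs r⁶; yet it tends to 0 with 1/r.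
oOne : ℕ → ℚ
oOne r = fromℕ 8 * recip r

0≤oOne : ∀ r → 0ℚ ≤ oOne r
0≤oOne r = 0≤* (0≤fromℕ 8) (0≤recip r)

module _ (t r : ℕ) (1≤r : 1 ℕ.≤ r) (2^r²≤ : 2 ℕ.^ (r ℕ.* r) ℕ.≤ 2 ℕ.+ t) where
  private
    g = H₃ t

    r≤ηg : 2 ℕ.≤ r → fromℕ r ≤ oOne r * g
    r≤ηg 2≤r = begin
      fromℕ r ≡⟨ trans (sym (ℚ.*-identityʳ (fromℕ r))) (cong (fromℕ r *_) (sym (recip-fromℕ r))) ⟩
      fromℕ r * (fromℕ (suc r) * recip r) ≡⟨ ℚ.*-assoc (fromℕ r) (fromℕ (suc r)) (recip r) ⟨
      fromℕ r * fromℕ (suc r) * recip r ≤⟨ *-monoʳ {fromℕ r * fromℕ (suc r)} {fromℕ 8 * g} (recip r) (0≤recip r) r[r+1]≤ ⟩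
      fromℕ 8 * g * recip r ≡⟨ solve 3 (λ e g r → e :* g :* r := e :* r :* g) refl (fromℕ 8) g (recip r) ⟩
      oOne r * g ∎
      where
      -- The summand 4 cancels four times the 1 in `log₂≤H₃`, which leaves r (r + 1) ≤ 8 g. The
      -- inequality fails at r = 1.
      nat : r ℕ.* suc r ℕ.+ 4 ℕ.≤ 4 ℕ.* (r ℕ.* r)
      nat = subst (λ z → z ℕ.* suc z ℕ.+ 4 ℕ.≤ 4 ℕ.* (z ℕ.* z)) (ℕ.m+[n∸m]≡n 2≤r) (ℕ.≤-trans (ℕ.m≤m+n _ (11 ℕ.* m ℕ.+ 3 ℕ.* (m ℕ.* m) ℕ.+ 6)) (ℕ.≤-reflexive (c m)))
        where
        m = r ℕ.∸ 2
        c : ∀ m → (2 ℕ.+ m) ℕ.* suc (2 ℕ.+ m) ℕ.+ 4 ℕ.+ (11 ℕ.* m ℕ.+ 3 ℕ.* (m ℕ.* m) ℕ.+ 6) ≡ 4 ℕ.* ((2 ℕ.+ m) ℕ.* (2 ℕ.+ m))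
        c = solve-∀
      r[r+1]≤ : fromℕ r * fromℕ (suc r) ≤ fromℕ 8 * g
      r[r+1]≤ = begin
        fromℕ r * fromℕ (suc r) ≡⟨ solve 1 (λ x → x := x :+ con (fromℕ 4) :- con (fromℕ 4)) refl (fromℕ r * fromℕ (suc r)) ⟩
        fromℕ r * fromℕ (suc r) + fromℕ 4 - fromℕ 4 ≡⟨ cong (_- fromℕ 4) (trans (cong (_+ fromℕ 4) (sym (fromℕ-* r (suc r)))) (sym (fromℕ-+ (r ℕ.* suc r) 4))) ⟩
        fromℕ (r ℕ.* suc r ℕ.+ 4) - fromℕ 4 ≤⟨ ℚ.+-monoˡ-≤ (- fromℕ 4) (fromℕ-mono nat) ⟩
        fromℕ (4 ℕ.* (r ℕ.* r)) - fromℕ 4 ≡⟨ cong (_- fromℕ 4) (fromℕ-* 4 (r ℕ.* r)) ⟩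
        fromℕ 4 * fromℕ (r ℕ.* r) - fromℕ 4 ≤⟨ ℚ.+-monoˡ-≤ (- fromℕ 4) (*-monoˡ {fromℕ (r ℕ.* r)} {fromℕ 2 * g + 1ℚ} (fromℕ 4) (0≤fromℕ 4) (log₂≤H₃ t (r ℕ.* r) 2^r²≤)) ⟩
        fromℕ 4 * (fromℕ 2 * g + 1ℚ) - fromℕ 4 ≡⟨ solve 1 (λ g → con (fromℕ 4) :* (con (fromℕ 2) :* g :+ con 1ℚ) :- con (fromℕ 4) := con (fromℕ 8) :* g) refl g ⟩
        fromℕ 8 * g ∎

    L = suc r ℕ.* suc r

  expSum-oOne : fromℕ (L ℕ.* (L ℕ.* L)) ≤ fromℕ 64 * (fromℕ 720 * expSum (oOne r * H₃ t) 6)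
  expSum-oOne = expSum-sextic r (oOne r * g) 1≤r (0≤* (0≤oOne r) (0≤H₃ t)) r≤ηg

abstract
  -- One factor 3 for each of the two T, one factor 4 for each of the three Q, and 64 · 720 for L³.
  -- Being opaque, the number is never multiplied out.
  c₀ : ℚ
  c₀ = fromℕ 3 * fromℕ 3 * (fromℕ 4 * fromℕ 4 * fromℕ 4) * (fromℕ 64 * fromℕ 720)

  c₀≡ : c₀ ≡ fromℕ 3 * fromℕ 3 * (fromℕ 4 * fromℕ 4 * fromℕ 4) * (fromℕ 64 * fromℕ 720)
  c₀≡ = refl

  0≤c₀ : 0ℚ ≤ c₀
  0≤c₀ = 0≤* {fromℕ 3 * fromℕ 3 * (fromℕ 4 * fromℕ 4 * fromℕ 4)} {fromℕ 64 * fromℕ 720} (0≤* {fromℕ 3 * fromℕ 3} {fromℕ 4 * fromℕ 4 * fromℕ 4} (0≤* {fromℕ 3} {fromℕ 3} (0≤fromℕ 3) (0≤fromℕ 3))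
    (0≤* {fromℕ 4 * fromℕ 4} {fromℕ 4} (0≤* {fromℕ 4} {fromℕ 4} (0≤fromℕ 4) (0≤fromℕ 4)) (0≤fromℕ 4))) (0≤* {fromℕ 64} {fromℕ 720} (0≤fromℕ 64) (0≤fromℕ 720))

module _ (t Q r : ℕ) (1≤r : 1 ℕ.≤ r) (2^r²≤ : 2 ℕ.^ (r ℕ.* r) ℕ.≤ 2 ℕ.+ t) (Q⁴≤16T : Q ℕ.* Q ℕ.* (Q ℕ.* Q) ℕ.≤ 16 ℕ.* suc t) where
  private
    T = suc t
    L = suc r ℕ.* suc r
    g = H₃ t
    η = oOne r
    a = fromℕ T
    b = fromℕ Q
    l = fromℕ (L ℕ.* (L ℕ.* L))
    E₁ = expSum g t
    E₂ = expSum (g * ¼) t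
    E₃ = expSum (η * g) 6
    0≤g : 0ℚ ≤ g
    0≤g = 0≤H₃ t
    0≤q : 0ℚ ≤ g * ¼
    0≤q = 0≤* 0≤g (ℚ.nonNegative⁻¹ ¼)
    0≤ηg : 0ℚ ≤ η * g
    0≤ηg = 0≤* (0≤oOne r) 0≤g

    level : ∀ x y d e → 0ℚ ≤ x → 0ℚ ≤ y → ∀ E → E ≤ expSum y e → expSum x d * E ≤ expSum (x + y) (d ℕ.+ e)
    level x y d e 0≤x 0≤y E h = ℚ.≤-trans (*-monoˡ {E} {expSum y e} (expSum x d) (0≤expSum x 0≤x d) h) (expSum-+-≥ x y 0≤x 0≤y d e)

    x₃ x₂ x₁ x₀ x₋ : ℚ
    x₃ = g * ¼ + η * g
    x₂ = g * ¼ + x₃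
    x₁ = g * ¼ + x₂
    x₀ = g + x₁
    x₋ = g + x₀

    0≤x₃ : 0ℚ ≤ x₃
    0≤x₃ = 0≤+ 0≤q 0≤ηg
    0≤x₂ : 0ℚ ≤ x₂
    0≤x₂ = 0≤+ 0≤q 0≤x₃
    0≤x₁ : 0ℚ ≤ x₁
    0≤x₁ = 0≤+ 0≤q 0≤x₂
    0≤x₀ : 0ℚ ≤ x₀
    0≤x₀ = 0≤+ 0≤g 0≤x₁
    0≤x₋ : 0ℚ ≤ x₋
    0≤x₋ = 0≤+ 0≤g 0≤x₀

    -- Orders add under multiplication of truncated exponentials: five factors of order t and one of
    -- order 6.
    depth : ℕ
    depth = t ℕ.+ (t ℕ.+ (t ℕ.+ (t ℕ.+ (t ℕ.+ 6))))

    product≤ : E₁ * (E₁ * (E₂ * (E₂ * (E₂ * E₃)))) ≤ expSum x₋ depth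
    product≤ = level g x₀ t d₄ 0≤g 0≤x₀ F₄ (level g x₁ t d₃ 0≤g 0≤x₁ F₃ (level (g * ¼) x₂ t d₂ 0≤q 0≤x₂ F₂
      (level (g * ¼) x₃ t d₁ 0≤q 0≤x₃ F₁ (level (g * ¼) (η * g) t 6 0≤q 0≤ηg E₃ ℚ.≤-refl))))
      where
      d₁ = t ℕ.+ 6
      d₂ = t ℕ.+ d₁
      d₃ = t ℕ.+ d₂
      d₄ = t ℕ.+ d₃
      F₁ = E₂ * E₃
      F₂ = E₂ * F₁
      F₃ = E₂ * F₂
      F₄ = E₁ * F₃

    x₋≡ : x₋ ≡ (+ 11 / 4 + η) * g
    x₋≡ = solve 2 (λ g η → g :+ (g :+ (g :* con ¼ :+ (g :* con ¼ :+ (g :* con ¼ :+ η :* g)))) := (con (+ 11 / 4) :+ η) :* g) refl g η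

    pieces : a * (a * (b * (b * (b * l)))) ≤ fromℕ 3 * E₁ * (fromℕ 3 * E₁ * (fromℕ 4 * E₂ * (fromℕ 4 * E₂ * (fromℕ 4 * E₂ * (fromℕ 64 * (fromℕ 720 * E₃))))))
    pieces = mul a A₁ 0≤a a≤ m₄ M₄ (0≤* 0≤a 0≤m₃) (mul a A₁ 0≤a a≤ m₃ M₃ 0≤m₃ (mul b B₁ 0≤b b≤ m₂ M₂ 0≤m₂
        (mul b B₁ 0≤b b≤ m₁ M₁ 0≤m₁ (mul b B₁ 0≤b b≤ l M₀ 0≤l (expSum-oOne t r 1≤r 2^r²≤)))))
      where
      0≤a = 0≤fromℕ T
      0≤b = 0≤fromℕ Q
      0≤l = 0≤fromℕ (L ℕ.* (L ℕ.* L))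
      a≤ : a ≤ fromℕ 3 * E₁
      a≤ = ℚ.≤-trans (fromℕ-mono (s≤s (ℕ.m≤n+m t 2))) (expSum-H₃ t)
      b≤ : b ≤ fromℕ 4 * E₂
      b≤ = expSum-¼ t Q Q⁴≤16T
      A₁ = fromℕ 3 * E₁
      B₁ = fromℕ 4 * E₂
      M₀ = fromℕ 64 * (fromℕ 720 * E₃)
      M₁ = B₁ * M₀
      M₂ = B₁ * M₁
      M₃ = B₁ * M₂
      M₄ = A₁ * M₃
      m₁ = b * l
      m₂ = b * m₁
      m₃ = b * m₂
      m₄ = a * m₃
      0≤m₁ : 0ℚ ≤ m₁
      0≤m₁ = 0≤* 0≤b 0≤l
      0≤m₂ : 0ℚ ≤ m₂
      0≤m₂ = 0≤* 0≤b 0≤m₁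
      0≤m₃ : 0ℚ ≤ m₃
      0≤m₃ = 0≤* 0≤b 0≤m₂
      mul : ∀ p q → 0ℚ ≤ p → p ≤ q → ∀ x y → 0ℚ ≤ x → x ≤ y → p * x ≤ q * y
      mul p q 0≤p p≤q x y 0≤x x≤y = *-mono {p} {q} {x} {y} 0≤x (ℚ.≤-trans 0≤p p≤q) p≤q x≤y

  -- The exponents g for each T, g/4 for each Q and η g for L³ add up to (11/4 + η) g. Here z is to
  -- be a partial sum of log T, so the right side is the n-th approximation of T^{11/4 + η}.
  power-lower : ∀ z n → H₃ t ≤ z → t ℕ.+ (t ℕ.+ (t ℕ.+ (t ℕ.+ (t ℕ.+ 6)))) ℕ.≤ n →
                fromℕ (L ℕ.* (L ℕ.* L) ℕ.* (T ℕ.* T) ℕ.* (Q ℕ.* (Q ℕ.* Q))) ≤ c₀ * expSum ((+ 11 / 4 + oOne r) * z) n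
  power-lower z n g≤z d≤n = begin
    fromℕ (L ℕ.* (L ℕ.* L) ℕ.* (T ℕ.* T) ℕ.* (Q ℕ.* (Q ℕ.* Q)))
      ≡⟨ trans (fromℕ-* (L ℕ.* (L ℕ.* L) ℕ.* (T ℕ.* T)) (Q ℕ.* (Q ℕ.* Q))) (cong₂ _*_ (trans (fromℕ-* (L ℕ.* (L ℕ.* L)) (T ℕ.* T)) (cong (l *_) (fromℕ-* T T))) (trans (fromℕ-* Q (Q ℕ.* Q)) (cong (b *_) (fromℕ-* Q Q)))) ⟩
    l * (a * a) * (b * (b * b))
      ≡⟨ solve 3 (λ l a b → l :* (a :* a) :* (b :* (b :* b)) := a :* (a :* (b :* (b :* (b :* l))))) refl l a b ⟩
    a * (a * (b * (b * (b * l))))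
      ≤⟨ pieces ⟩
    fromℕ 3 * E₁ * (fromℕ 3 * E₁ * (fromℕ 4 * E₂ * (fromℕ 4 * E₂ * (fromℕ 4 * E₂ * (fromℕ 64 * (fromℕ 720 * E₃))))))
      ≡⟨ trans (solve 7 (λ c d e f x y z → c :* x :* (c :* x :* (d :* y :* (d :* y :* (d :* y :* (e :* (f :* z)))))) := c :* c :* (d :* d :* d) :* (e :* f) :* (x :* (x :* (y :* (y :* (y :* z)))))) refl (fromℕ 3) (fromℕ 4) (fromℕ 64) (fromℕ 720) E₁ E₂ E₃) (cong (_* (E₁ * (E₁ * (E₂ * (E₂ * (E₂ * E₃)))))) (sym c₀≡)) ⟩
    c₀ * (E₁ * (E₁ * (E₂ * (E₂ * (E₂ * E₃)))))
      ≤⟨ *-monoˡ {E₁ * (E₁ * (E₂ * (E₂ * (E₂ * E₃))))} {expSum ((+ 11 / 4 + η) * z) n} c₀ 0≤c₀ bound ⟩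
    c₀ * expSum ((+ 11 / 4 + η) * z) n ∎
    where
    bound : E₁ * (E₁ * (E₂ * (E₂ * (E₂ * E₃)))) ≤ expSum ((+ 11 / 4 + η) * z) n
    bound = begin
      E₁ * (E₁ * (E₂ * (E₂ * (E₂ * E₃)))) ≤⟨ product≤ ⟩
      expSum x₋ depth ≤⟨ expSum-mono x₋ 0≤x₋ d≤n ⟩
      expSum x₋ n ≤⟨ expSum-monoˡ x₋ ((+ 11 / 4 + η) * z) 0≤x₋ (subst (_≤ (+ 11 / 4 + η) * z) (sym x₋≡) (*-monoˡ {g} {z} (+ 11 / 4 + η) (0≤+ (ℚ.nonNegative⁻¹ (+ 11 / 4)) (0≤oOne r)) g≤z)) n ⟩
      expSum ((+ 11 / 4 + η) * z) n ∎

open ResidueSums using (∑-÷; module Total)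
open HyperbolaMethod using (module Hyperbola)
open FareySum using (module FareyBound)

-- The error term

0<* : ∀ p q → 0ℚ < p → 0ℚ < q → 0ℚ < p * q
0<* p q 0<p 0<q = subst (_< p * q) (ℚ.*-zeroˡ q) (ℚ.*-monoˡ-<-pos q {{positive 0<q}} 0<p)

0<fromℕ-suc : ∀ n → 0ℚ < fromℕ (suc n)
0<fromℕ-suc n = ℚ.<-≤-trans (ℚ.positive⁻¹ 1ℚ) (fromℕ-mono {1} {suc n} (s≤s z≤n))

≤ʳ-trans : ∀ x y z → x ≤ʳ y → y ≤ʳ z → x ≤ʳ z
≤ʳ-trans x y z x≤y y≤z ε 0<ε =
  let (N₁ , p) = x≤y (ε * ½) (half>0 0<ε)
      (N₂ , q) = y≤z (ε * ½) (half>0 0<ε)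
  in N₁ ℕ.⊔ N₂ , λ n N≤n → begin
    seq x n ≤⟨ p n (ℕ.m⊔n≤o⇒m≤o N₁ N₂ N≤n) ⟩
    seq y n + ε * ½ ≤⟨ ℚ.+-monoˡ-≤ (ε * ½) (q n (ℕ.m⊔n≤o⇒n≤o N₁ N₂ N≤n)) ⟩
    (seq z n + ε * ½) + ε * ½ ≡⟨ ℚ.+-assoc (seq z n) (ε * ½) (ε * ½) ⟩
    seq z n + (ε * ½ + ε * ½) ≡⟨ cong (λ w → seq z n + w) (half+half ε) ⟩
    seq z n + ε ∎

≤ʳ-pointwise : ∀ x y → (∀ n → seq x n ≤ seq y n) → x ≤ʳ y
≤ʳ-pointwise x y h ε 0<ε = 0 , λ n _ → ℚ.≤-trans (h n) (≤-+ʳ (seq y n) ε (ℚ.<⇒≤ 0<ε))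

-- A rational majorant of finitely many of the quotients m u / u lies below every real majorant.
module Supremum (m : ℕ → ℕ) (y : ℝ) (s : ℕ) (1≤s : 1 ℕ.≤ s)
                (bound : ∀ u → s ℕ.≤ suc u → fromℚʳ (fromℕ (m (suc u)) * recip u) ≤ʳ y) where
  private
    ratio : ℕ → ℚ
    ratio u = fromℕ (m (suc u)) * recip u

    0≤ratio : ∀ u → 0ℚ ≤ ratio u
    0≤ratio u = 0≤* (0≤fromℕ (m (suc u))) (0≤recip u)

    ratio-* : ∀ u → ratio u * fromℕ (suc u) ≡ fromℕ (m (suc u))
    ratio-* u = trans (ℚ.*-assoc (fromℕ (m (suc u))) (recip u) (fromℕ (suc u))) (trans (cong (fromℕ (m (suc u)) *_) (recip-inverse u)) (ℚ.*-identityʳ (fromℕ (m (suc u)))))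

    0≤y : fromℚʳ 0ℚ ≤ʳ y
    0≤y = ≤ʳ-trans (fromℚʳ 0ℚ) (fromℚʳ (ratio (pred s))) y (≤ʳ-pointwise (fromℚʳ 0ℚ) (fromℚʳ (ratio (pred s))) (λ _ → 0≤ratio (pred s)))
      (bound (pred s) (ℕ.≤-reflexive (sym (ℕ.suc-pred s {{ℕ.>-nonZero 1≤s}}))))

  Majorant : ℕ → ℚ → Set
  Majorant K κ = ∀ u → s ℕ.≤ u → u ℕ.≤ K → fromℕ (m u) ≤ κ * fromℕ u

  private
    extend : ∀ {K κ κ′} → Majorant K κ → κ ≤ κ′ → ratio K ≤ κ′ → Majorant (suc K) κ′
    extend {K} {κ} {κ′} h κ≤κ′ ρ≤κ′ u s≤u u≤1+K = go (u ℕ.≟ suc K)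
      where
      go : Dec (u ≡ suc K) → fromℕ (m u) ≤ κ′ * fromℕ u
      go (yes refl) = ℚ.≤-trans (ℚ.≤-reflexive (sym (ratio-* K))) (*-monoʳ {ratio K} {κ′} (fromℕ (suc K)) (0≤fromℕ (suc K)) ρ≤κ′)
      go (no u≢)    = ℚ.≤-trans (h u s≤u (ℕ.s≤s⁻¹ (ℕ.≤∧≢⇒< u≤1+K u≢))) (*-monoʳ {κ} {κ′} (fromℕ u) (0≤fromℕ u) κ≤κ′)

  -- The order of the rationals is total, so the maximum is itself 0 or one of the quotients and
  -- inherits their bound by y. That 0 lies below y follows from any single quotient.
  majorant : ∀ K → ∃[ κ ] 0ℚ ≤ κ × fromℚʳ κ ≤ʳ y × Majorant K κ
  majorant zero    = 0ℚ , ℚ.≤-refl , 0≤y , λ u s≤u u≤0 → contradiction (ℕ.≤-trans 1≤s (ℕ.≤-trans s≤u u≤0)) λ ()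
  majorant (suc K) = go (majorant K) (s ℕ.≤? suc K)
    where
    larger : ∀ κ → 0ℚ ≤ κ → fromℚʳ κ ≤ʳ y → Majorant K κ → s ℕ.≤ suc K → κ ≤ ratio K ⊎ ratio K ≤ κ →
             ∃[ κ′ ] 0ℚ ≤ κ′ × fromℚʳ κ′ ≤ʳ y × Majorant (suc K) κ′
    larger κ 0≤κ κ≤y h s≤1+K (inj₁ κ≤ρ) = ratio K , 0≤ratio K , bound K s≤1+K , extend {K} {κ} {ratio K} h κ≤ρ ℚ.≤-refl
    larger κ 0≤κ κ≤y h s≤1+K (inj₂ ρ≤κ) = κ , 0≤κ , κ≤y , extend {K} {κ} {κ} h ℚ.≤-refl ρ≤κ
    go : (∃[ κ ] 0ℚ ≤ κ × fromℚʳ κ ≤ʳ y × Majorant K κ) → Dec (s ℕ.≤ suc K) → ∃[ κ ] 0ℚ ≤ κ × fromℚʳ κ ≤ʳ y × Majorant (suc K) κ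
    go (κ , 0≤κ , κ≤y , h) (no s≰)     = κ , 0≤κ , κ≤y , λ u s≤u u≤1+K → contradiction (ℕ.≤-trans s≤u u≤1+K) s≰
    go (κ , 0≤κ , κ≤y , h) (yes s≤1+K) = larger κ 0≤κ κ≤y h s≤1+K (ℚ.≤-total κ (ratio K))

module _ (m : ℕ → ℕ) (δ : ℝ → ℝ) (decreasing : Decreasing δ)
         (mertens : ∀ t n → 1ʳ ≤ʳ t → IsFloor t n → fromℕʳ (m n) ≤ʳ t *ʳ δ t) where
  private
    ratio≤δ : ∀ u → fromℚʳ (fromℕ (m (suc u)) * recip u) ≤ʳ δ (fromℕʳ (suc u))
    ratio≤δ u ε 0<ε =
      -- The hypothesis is used at the integer n, its own floor, with tolerance ε n, which becomes ε
      -- after division by n.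
      let (N , p) = mertens (fromℕʳ n) n (≤ʳ-pointwise 1ʳ (fromℕʳ n) (λ _ → fromℕ-mono {1} {n} (s≤s z≤n)))
                      (≤ʳ-pointwise (fromℕʳ n) (fromℕʳ n) (λ _ → ℚ.≤-refl) , 1ℚ , ℚ.positive⁻¹ 1ℚ , 0 , λ _ _ → ℚ.≤-reflexive (trans (ℚ.+-comm (fromℕ n) 1ℚ) (sym (fromℕ-suc n))))
                      (ε * fromℕ n) (0<* ε (fromℕ n) 0<ε (0<fromℕ-suc u))
      in N , λ i N≤i → begin
        fromℕ (m n) * recip u ≤⟨ *-monoʳ {fromℕ (m n)} {fromℕ n * d i + ε * fromℕ n} (recip u) (0≤recip u) (p i N≤i) ⟩
        (fromℕ n * d i + ε * fromℕ n) * recip u ≡⟨ solve 4 (λ n d e r → (n :* d :+ e :* n) :* r := (n :* r) :* (d :+ e)) refl (fromℕ n) (d i) ε (recip u) ⟩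
        fromℕ n * recip u * (d i + ε) ≡⟨ cong (_* (d i + ε)) (recip-fromℕ u) ⟩
        1ℚ * (d i + ε) ≡⟨ ℚ.*-identityˡ (d i + ε) ⟩
        d i + ε ∎
      where
      n = suc u
      d = seq (δ (fromℕʳ n))

  ratio≤δx : ∀ x s → 1ʳ ≤ʳ x → x ≤ʳ fromℕʳ s → ∀ u → s ℕ.≤ suc u → fromℚʳ (fromℕ (m (suc u)) * recip u) ≤ʳ δ x
  ratio≤δx x s 1≤x x≤s u s≤ = ≤ʳ-trans (fromℚʳ (fromℕ (m (suc u)) * recip u)) (δ (fromℕʳ (suc u))) (δ x) (ratio≤δ u)
    (decreasing x (fromℕʳ (suc u)) 1≤x (≤ʳ-trans x (fromℕʳ s) (fromℕʳ (suc u)) x≤s (≤ʳ-pointwise (fromℕʳ s) (fromℕʳ (suc u)) (λ _ → fromℕ-mono s≤))))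

∣M∣ : ℕ → ℕ
∣M∣ u = ℤ.∣ M u ∣

fromℕ-∑-≤ : ∀ κ n {f g} → (∀ i → 1 ℕ.≤ i → i ℕ.≤ n → fromℕ (f i) ≤ κ * fromℕ (g i)) → fromℕ (Σℕ.∑ n f) ≤ κ * fromℕ (Σℕ.∑ n g)
fromℕ-∑-≤ κ zero    h = ℚ.≤-reflexive (sym (ℚ.*-zeroʳ κ))
fromℕ-∑-≤ κ (suc n) {f} {g} h = begin
  fromℕ (Σℕ.∑ n f ℕ.+ f (suc n)) ≡⟨ fromℕ-+ (Σℕ.∑ n f) (f (suc n)) ⟩
  fromℕ (Σℕ.∑ n f) + fromℕ (f (suc n)) ≤⟨ ℚ.+-mono-≤ (fromℕ-∑-≤ κ n {f} {g} (λ i 1≤i i≤n → h i 1≤i (ℕ.m≤n⇒m≤1+n i≤n))) (h (suc n) (s≤s z≤n) ℕ.≤-refl) ⟩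
  κ * fromℕ (Σℕ.∑ n g) + κ * fromℕ (g (suc n)) ≡⟨ ℚ.*-distribˡ-+ κ (fromℕ (Σℕ.∑ n g)) (fromℕ (g (suc n))) ⟨
  κ * (fromℕ (Σℕ.∑ n g) + fromℕ (g (suc n))) ≡⟨ cong (κ *_) (fromℕ-+ (Σℕ.∑ n g) (g (suc n))) ⟨
  κ * fromℕ (Σℕ.∑ n g ℕ.+ g (suc n)) ∎

η : ℕ → ℝ
η T = fromℚʳ (oOne (logRoot T))

logRoot-large : ∀ k T → 2 ℕ.^ (k ℕ.* k) ℕ.≤ T → k ℕ.≤ logRoot T
logRoot-large k T h with k ℕ.≤? logRoot T
... | yes k≤r = k≤r
... | no  k≰r = contradiction (ℕ.<-trans (ℕ.n<1+n T) (ℕ.<-≤-trans (proj₂ (proj₂ (rootLog T))) (ℕ.≤-trans (ℕ.^-monoʳ-≤ 2 (ℕ.*-mono-≤ r<k r<k)) h))) (ℕ.<-irrefl refl)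
  where
  r<k : suc (logRoot T) ℕ.≤ k
  r<k = ℕ.≰⇒> k≰r

η→0 : η →0
η→0 ε (e , 0<e , N₀ , h) =
  let (k , small) = archimedean′ (fromℕ 8) (e * ½) (half>0 0<e)
  in 2 ℕ.^ (k ℕ.* k) , λ T N≤T → e * ½ , half>0 0<e , N₀ , λ n N₀≤n → begin
    ∣ oOne (logRoot T) ∣ + e * ½ ≡⟨ cong (_+ e * ½) (ℚ.0≤p⇒∣p∣≡p (0≤oOne (logRoot T))) ⟩
    oOne (logRoot T) + e * ½ ≤⟨ ℚ.+-monoˡ-≤ (e * ½) (small (logRoot T) (logRoot-large k T N≤T)) ⟩
    e * ½ + e * ½ ≡⟨ half+half e ⟩
    e ≡⟨ ℚ.+-identityˡ e ⟨
    0ℚ + e ≤⟨ h n N₀≤n ⟩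
    seq ε n ∎

0≤mercator : ∀ t n → 0ℚ ≤ mercatorSum (1ℚ - recip t) n
0≤mercator t zero    = ℚ.≤-refl
0≤mercator t (suc n) = 0≤+ (0≤mercator t n) (0≤* (0≤power (1ℚ - recip t) (diff-nonneg (recip t) 1ℚ (recip≤1 t)) (suc n)) (0≤recip n))

-- The harmonic sum of T/i supplies the logarithm of the second error term. An empty sum is treated
-- apart, since for small T the number L, always at least 1, need not be O(`H₃ t`).
mertens≤ : ∀ (m : ℕ → ℕ) κ T Y L t → 0ℚ ≤ κ → (∀ i → 1 ℕ.≤ i → i ℕ.≤ Y → fromℕ (m (T ÷ i)) ≤ κ * fromℕ (T ÷ i)) → Y ℕ.< 2 ℕ.^ L →
           (1 ℕ.≤ Y → fromℕ L ≤ fromℕ 12 * H₃ t) → fromℕ (Σℕ.∑ Y (λ i → m (T ÷ i))) ≤ fromℕ 12 * (κ * (fromℕ T * H₃ t))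
mertens≤ m κ T zero      L t 0≤κ h Y<2^L L≤ = 0≤* {fromℕ 12} {κ * (fromℕ T * H₃ t)} (0≤fromℕ 12) (0≤* {κ} {fromℕ T * H₃ t} 0≤κ (0≤* {fromℕ T} {H₃ t} (0≤fromℕ T) (0≤H₃ t)))
mertens≤ m κ T Y@(suc _) L t 0≤κ h Y<2^L L≤ = begin
  fromℕ (Σℕ.∑ Y (λ i → m (T ÷ i))) ≤⟨ fromℕ-∑-≤ κ Y {λ i → m (T ÷ i)} {λ i → T ÷ i} h ⟩
  κ * fromℕ (Σℕ.∑ Y (λ i → T ÷ i)) ≤⟨ *-monoˡ {fromℕ (Σℕ.∑ Y (λ i → T ÷ i))} {fromℕ (T ℕ.* L)} κ 0≤κ (fromℕ-mono (∑-÷ L Y T Y<2^L)) ⟩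
  κ * fromℕ (T ℕ.* L) ≡⟨ cong (κ *_) (fromℕ-* T L) ⟩
  κ * (fromℕ T * fromℕ L) ≤⟨ *-monoˡ {fromℕ T * fromℕ L} {fromℕ T * (fromℕ 12 * H₃ t)} κ 0≤κ (*-monoˡ {fromℕ L} {fromℕ 12 * H₃ t} (fromℕ T) (0≤fromℕ T) (L≤ (s≤s z≤n))) ⟩
  κ * (fromℕ T * (fromℕ 12 * H₃ t)) ≡⟨ solve 4 (λ k t z g → k :* (t :* (z :* g)) := z :* (k :* (t :* g))) refl κ (fromℕ T) (fromℕ 12) (H₃ t) ⟩
  fromℕ 12 * (κ * (fromℕ T * H₃ t)) ∎

abstract
  -- The sum of the constants of the two error terms, so that one factor serves both.
  c : ℚ
  c = fromℕ 129 * c₀ + fromℕ 12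

  c≡ : c ≡ fromℕ 129 * c₀ + fromℕ 12
  c≡ = refl

0≤129c₀ : 0ℚ ≤ fromℕ 129 * c₀
0≤129c₀ = 0≤* {fromℕ 129} {c₀} (0≤fromℕ 129) 0≤c₀

0≤c : 0ℚ ≤ c
0≤c = subst (0ℚ ≤_) (sym c≡) (0≤+ {fromℕ 129 * c₀} {fromℕ 12} 0≤129c₀ (0≤fromℕ 12))

∣2*∣≤⇒∣∣≤ : ∀ x k → ∣ fromℕ 2 * x ∣ ≤ k → ∣ x ∣ ≤ k
∣2*∣≤⇒∣∣≤ x k h = begin
  ∣ x ∣ ≤⟨ ≤-+ʳ ∣ x ∣ ∣ x ∣ (ℚ.0≤∣p∣ x) ⟩
  ∣ x ∣ + ∣ x ∣ ≡⟨ solve 1 (λ x → x :+ x := con (fromℕ 2) :* x) refl ∣ x ∣ ⟩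
  fromℕ 2 * ∣ x ∣ ≡⟨ ℚ.∣p*q∣≡∣p∣*∣q∣ (fromℕ 2) x ⟨
  ∣ fromℕ 2 * x ∣ ≤⟨ h ⟩
  k ∎

-- The leading 1 of the identity contributes T² in total; it is absorbed into Z, which turns 128
-- into 129.
fromℕ-main : ∀ T m Z → T ℕ.* T ℕ.≤ Z → fromℕ (T ℕ.* (T ℕ.* (1 ℕ.+ m)) ℕ.+ 128 ℕ.* Z) ≤ fromℕ (T ℕ.* T) * fromℕ m + fromℕ 129 * fromℕ Z
fromℕ-main T m Z T²≤Z = begin
  fromℕ (T ℕ.* (T ℕ.* (1 ℕ.+ m)) ℕ.+ 128 ℕ.* Z) ≤⟨ fromℕ-mono (ℕ.≤-trans (ℕ.≤-reflexive (e T m Z)) (ℕ.+-monoʳ-≤ (T ℕ.* T ℕ.* m) (ℕ.+-monoˡ-≤ (128 ℕ.* Z) T²≤Z))) ⟩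
  fromℕ (T ℕ.* T ℕ.* m ℕ.+ 129 ℕ.* Z) ≡⟨ trans (fromℕ-+ (T ℕ.* T ℕ.* m) (129 ℕ.* Z)) (cong₂ _+_ (fromℕ-* (T ℕ.* T) m) (fromℕ-* 129 Z)) ⟩
  fromℕ (T ℕ.* T) * fromℕ m + fromℕ 129 * fromℕ Z ∎
  where
  e : ∀ T m Z → T ℕ.* (T ℕ.* (1 ℕ.+ m)) ℕ.+ 128 ℕ.* Z ≡ T ℕ.* T ℕ.* m ℕ.+ (T ℕ.* T ℕ.+ 128 ℕ.* Z)
  e = solve-∀

logSquare≤12H₃ : ∀ t r → 1 ℕ.≤ r → 2 ℕ.^ (r ℕ.* r) ℕ.≤ 2 ℕ.+ t → 7 ℕ.≤ t → fromℕ (suc r ℕ.* suc r) ≤ fromℕ 12 * H₃ t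
logSquare≤12H₃ t r 1≤r 2^r²≤ 7≤t = begin
  fromℕ (suc r ℕ.* suc r) ≤⟨ fromℕ-mono (ℕ.≤-trans (ℕ.*-mono-≤ 1+r≤ 1+r≤) (ℕ.≤-reflexive (e r))) ⟩
  fromℕ (4 ℕ.* (r ℕ.* r)) ≡⟨ fromℕ-* 4 (r ℕ.* r) ⟩
  fromℕ 4 * fromℕ (r ℕ.* r) ≤⟨ *-monoˡ {fromℕ (r ℕ.* r)} {fromℕ 2 * H₃ t + 1ℚ} (fromℕ 4) (0≤fromℕ 4) (log₂≤H₃ t (r ℕ.* r) 2^r²≤) ⟩
  fromℕ 4 * (fromℕ 2 * H₃ t + 1ℚ) ≤⟨ *-monoˡ {fromℕ 2 * H₃ t + 1ℚ} {fromℕ 2 * H₃ t + H₃ t} (fromℕ 4) (0≤fromℕ 4) (ℚ.+-monoʳ-≤ (fromℕ 2 * H₃ t) (1≤H₃ t 7≤t)) ⟩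
  fromℕ 4 * (fromℕ 2 * H₃ t + H₃ t) ≡⟨ solve 1 (λ g → con (fromℕ 4) :* (con (fromℕ 2) :* g :+ g) := con (fromℕ 12) :* g) refl (H₃ t) ⟩
  fromℕ 12 * H₃ t ∎
  where
  1+r≤ : suc r ℕ.≤ 2 ℕ.* r
  1+r≤ = ℕ.≤-trans (ℕ.+-monoˡ-≤ r 1≤r) (ℕ.≤-reflexive (cong (r ℕ.+_) (sym (ℕ.+-identityʳ r))))
  e : ∀ r → 2 ℕ.* r ℕ.* (2 ℕ.* r) ≡ 4 ℕ.* (r ℕ.* r)
  e = solve-∀

combine : ∀ X m Z E z κ g t tt A → X ≤ tt * m + fromℕ 129 * Z → m ≤ fromℕ 12 * (κ * (t * g)) → Z ≤ c₀ * E → tt * t ≡ A →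
          0ℚ ≤ tt → 0ℚ ≤ κ → 0ℚ ≤ A → 0ℚ ≤ E → 0ℚ ≤ z → g ≤ z → X ≤ c * (E + A * κ * z)
combine X m Z E z κ g t tt A X≤ m≤ Z≤ refl 0≤tt 0≤κ 0≤A 0≤E 0≤z g≤z = begin
  X ≤⟨ X≤ ⟩
  tt * m + fromℕ 129 * Z ≤⟨ ℚ.+-mono-≤ (*-monoˡ {m} {fromℕ 12 * (κ * (t * g))} tt 0≤tt m≤) (*-monoˡ {Z} {c₀ * E} (fromℕ 129) (0≤fromℕ 129) Z≤) ⟩
  tt * (fromℕ 12 * (κ * (t * g))) + fromℕ 129 * (c₀ * E) ≡⟨ solve 8 (λ tt z k t g w c e → tt :* (z :* (k :* (t :* g))) :+ w :* (c :* e) := z :* (tt :* t :* k :* g) :+ w :* c :* e) refl tt (fromℕ 12) κ t g (fromℕ 129) c₀ E ⟩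
  fromℕ 12 * (A * κ * g) + fromℕ 129 * c₀ * E ≤⟨ ℚ.+-monoˡ-≤ (fromℕ 129 * c₀ * E) (*-monoˡ {A * κ * g} {W} (fromℕ 12) (0≤fromℕ 12) (*-monoˡ {g} {z} (A * κ) 0≤Aκ g≤z)) ⟩
  fromℕ 12 * W + fromℕ 129 * c₀ * E ≤⟨ ≤-+ʳ (fromℕ 12 * W + fromℕ 129 * c₀ * E) (fromℕ 12 * E + fromℕ 129 * c₀ * W)
                                                                     (0≤+ {fromℕ 12 * E} {fromℕ 129 * c₀ * W} (0≤* {fromℕ 12} {E} (0≤fromℕ 12) 0≤E) (0≤* {fromℕ 129 * c₀} {W} 0≤129c₀ (0≤* {A * κ} {z} 0≤Aκ 0≤z))) ⟩
  fromℕ 12 * W + fromℕ 129 * c₀ * E + (fromℕ 12 * E + fromℕ 129 * c₀ * W)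
    ≡⟨ solve 4 (λ a b w e → a :* w :+ b :* e :+ (a :* e :+ b :* w) := (b :+ a) :* (e :+ w)) refl (fromℕ 12) (fromℕ 129 * c₀) W E ⟩
  (fromℕ 129 * c₀ + fromℕ 12) * (E + W) ≡⟨ cong (_* (E + W)) (sym c≡) ⟩
  c * (E + W) ∎
  where
  W = A * κ * z
  0≤Aκ : 0ℚ ≤ A * κ
  0≤Aκ = 0≤* {A} {κ} 0≤A 0≤κ

fromℕ-cube : ∀ T → fromℕ (T ℕ.* T) * fromℕ T ≡ fromℕ (T ℕ.^ 3)
fromℕ-cube T = trans (sym (fromℕ-* (T ℕ.* T) T)) (cong fromℕ (e T))
  where
  e : ∀ T → T ℕ.* T ℕ.* T ≡ T ℕ.* (T ℕ.* (T ℕ.* 1))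
  e = solve-∀

≤-scaled : ∀ Z L Q T .{{_ : ℕ.NonZero L}} .{{_ : ℕ.NonZero Q}} → Z ≡ L ℕ.* (L ℕ.* L) ℕ.* (T ℕ.* T) ℕ.* (Q ℕ.* (Q ℕ.* Q)) → T ℕ.* T ℕ.≤ Z
≤-scaled Z L Q T refl = ℕ.≤-trans (ℕ.m≤n*m (T ℕ.* T) (L ℕ.* (L ℕ.* L)) {{ℕ.m*n≢0 L (L ℕ.* L) {{it}} {{ℕ.m*n≢0 L L}}}})
  (ℕ.m≤m*n (L ℕ.* (L ℕ.* L) ℕ.* (T ℕ.* T)) (Q ℕ.* (Q ℕ.* Q)) {{ℕ.m*n≢0 Q (Q ℕ.* Q) {{it}} {{ℕ.m*n≢0 Q Q}}}})

module Core (t : ℕ) where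
  open Parameters t
  open Scale scale using (2≤Q; T<2^L)
  open Total scale using (s; Y)
  open Hyperbola scale using (mertensSum)
  open FareyBound scale using (farey-bound)

  8≤s : 8 ℕ.≤ s
  8≤s = ℕ.*-monoʳ-≤ 2 (ℕ.*-mono-≤ 2≤Q 2≤Q)

  private
    Z : ℕ
    Z = L ℕ.* (L ℕ.* L) ℕ.* (T ℕ.* T) ℕ.* (Q ℕ.* (Q ℕ.* Q))

    error≤ : ∣ fromℕ (C T) - fromℕ (F T) * G T ∣ ≤ fromℕ (T ℕ.* T) * fromℕ mertensSum + fromℕ 129 * fromℕ Z
    error≤ = ℚ.≤-trans (∣2*∣≤⇒∣∣≤ (fromℕ (C T) - fromℕ (F T) * G T) (fromℕ (T ℕ.* (T ℕ.* (1 ℕ.+ mertensSum)) ℕ.+ 128 ℕ.* Z)) farey-bound)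
      (fromℕ-main T mertensSum Z (≤-scaled Z L Q T refl))

    8≤T : 1 ℕ.≤ Y → 8 ℕ.≤ T
    8≤T 1≤Y = ℕ.≤-trans 8≤s (ℕ.≤-trans (ℕ.≤-reflexive (sym (ℕ.*-identityˡ s))) (≤÷⇒*≤ s 1≤Y))

  module _ (κ : ℚ) (0≤κ : 0ℚ ≤ κ) (sup : ∀ u → s ℕ.≤ u → u ℕ.≤ T → fromℕ (∣M∣ u) ≤ κ * fromℕ u) where
    private
      sum≤ : ∀ m → 1 ℕ.≤ m → m ℕ.≤ Y → fromℕ (∣M∣ (T ÷ m)) ≤ κ * fromℕ (T ÷ m)
      sum≤ m 1≤m m≤Y = sup (T ÷ m) (*≤⇒≤÷ 1≤m (ℕ.≤-trans (ℕ.≤-reflexive (ℕ.*-comm s m)) (≤÷⇒*≤ s m≤Y))) (÷≤ T m)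

      mertensSum≤ : fromℕ mertensSum ≤ fromℕ 12 * (κ * (fromℕ T * H₃ t))
      mertensSum≤ = mertens≤ ∣M∣ κ T Y L t 0≤κ sum≤ (ℕ.≤-<-trans (÷≤ T s) T<2^L) (λ 1≤Y → logSquare≤12H₃ t r 1≤r 2^r²≤ (ℕ.s≤s⁻¹ (8≤T 1≤Y)))

    error≤c : ∀ z n → H₃ t ≤ z → t ℕ.+ (t ℕ.+ (t ℕ.+ (t ℕ.+ (t ℕ.+ 6)))) ℕ.≤ n →
              ∣ fromℕ (C T) - fromℕ (F T) * G T ∣ ≤ c * (expSum ((+ 11 / 4 + oOne r) * z) n + fromℕ (T ℕ.^ 3) * κ * z)
    error≤c z n g≤z d≤n = combine ∣ fromℕ (C T) - fromℕ (F T) * G T ∣ (fromℕ mertensSum) (fromℕ Z) (expSum ((+ 11 / 4 + oOne r) * z) n) z κ (H₃ t) (fromℕ T) (fromℕ (T ℕ.* T)) (fromℕ (T ℕ.^ 3))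
      error≤ mertensSum≤ (power-lower t Q r 1≤r 2^r²≤ Q⁴≤16T z n g≤z d≤n) (fromℕ-cube T)
      (0≤fromℕ (T ℕ.* T)) 0≤κ (0≤fromℕ (T ℕ.^ 3))
      (0≤expSum ((+ 11 / 4 + oOne r) * z) (0≤* {+ 11 / 4 + oOne r} {z} (0≤+ {+ 11 / 4} {oOne r} (ℚ.nonNegative⁻¹ (+ 11 / 4)) (0≤oOne r)) 0≤z) n) 0≤z g≤z
      where
      0≤z : 0ℚ ≤ z
      0≤z = ℚ.≤-trans (0≤H₃ t) g≤z

0<c : 0ʳ <ʳ fromℚʳ c
0<c = fromℕ 12 , 0<fromℕ-suc 11 , 0 , λ _ _ → subst (0ℚ + fromℕ 12 ≤_) (sym c≡) (ℚ.+-monoˡ-≤ (fromℕ 12) 0≤129c₀)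

-- Passes from κ to an approximation d of δ(√T) that is known only up to e. The excess c A e l is
-- controlled through an upper bound u for the logarithm that does not depend on the index.
absorb-error : ∀ X E A d e κ l u ε → X ≤ c * (E + A * κ * l) → κ ≤ d + e → c * A * u * e ≤ ε →
               0ℚ ≤ A → 0ℚ ≤ e → 0ℚ ≤ l → l ≤ u → X ≤ c * ∣ E + A * d * l ∣ + ε
absorb-error X E A d e κ l u ε X≤ κ≤ ce≤ε 0≤A 0≤e 0≤l l≤u = begin
  X ≤⟨ X≤ ⟩
  c * (E + A * κ * l) ≤⟨ *-monoˡ {E + A * κ * l} {E + A * (d + e) * l} c 0≤c (ℚ.+-monoʳ-≤ E (*-monoʳ {A * κ} {A * (d + e)} l 0≤l (*-monoˡ {κ} {d + e} A 0≤A κ≤))) ⟩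
  c * (E + A * (d + e) * l) ≡⟨ solve 6 (λ c E A d e l → c :* (E :+ A :* (d :+ e) :* l) := c :* (E :+ A :* d :* l) :+ c :* A :* e :* l) refl c E A d e l ⟩
  c * (E + A * d * l) + c * A * e * l ≤⟨ ℚ.+-mono-≤ (*-monoˡ {E + A * d * l} {∣ E + A * d * l ∣} c 0≤c (p≤∣p∣ (E + A * d * l)))
                                                       (*-monoˡ {l} {u} (c * A * e) (0≤* {c * A} {e} (0≤* {c} {A} 0≤c 0≤A) 0≤e) l≤u) ⟩
  c * ∣ E + A * d * l ∣ + c * A * e * u ≤⟨ ℚ.+-monoʳ-≤ (c * ∣ E + A * d * l ∣) (ℚ.≤-trans (ℚ.≤-reflexive (solve 4 (λ c A e t → c :* A :* e :* t := c :* A :* t :* e) refl c A e u)) ce≤ε) ⟩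
  c * ∣ E + A * d * l ∣ + ε ∎

-- The square root of T and the assembly of the real inequality.

module SquareRoot (t : ℕ) where
  open Parameters t using (Q; scale)
  open Scale scale using (T≤Q⁴)

  √T : ℝ
  √T = suc t ^ʳ fromℚʳ ½

  1≤√T : 1ʳ ≤ʳ √T
  1≤√T = ≤ʳ-pointwise 1ʳ √T (λ n → 1≤expSum (½ * mercatorSum (1ℚ - recip t) n) (0≤* {½} {mercatorSum (1ℚ - recip t) n} (ℚ.nonNegative⁻¹ ½) (0≤mercator t n)) n)

  √T≤2Q² : √T ≤ʳ fromℕʳ (2 ℕ.* (Q ℕ.* Q))
  √T≤2Q² = ≤ʳ-pointwise √T (fromℕʳ (2 ℕ.* (Q ℕ.* Q))) (λ n → expSum-½-upper t Q T≤Q⁴ (mercatorSum (1ℚ - recip t) n) n (0≤mercator t n) (mercator≤H t n))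

module _ (δ : ℝ → ℝ) (decreasing : Decreasing δ) (mertens : MertensBound δ) (t : ℕ) where
  open SquareRoot t
  open Parameters t using (Q; r)

  private
    A = fromℕ (suc t ℕ.^ 3)
    s = 2 ℕ.* (Q ℕ.* Q)
    ℓ : ℕ → ℚ
    ℓ = mercatorSum (1ℚ - recip t)

    sup : ∃[ κ ] 0ℚ ≤ κ × fromℚʳ κ ≤ʳ δ √T × (∀ u → s ℕ.≤ u → u ℕ.≤ suc t → fromℕ (∣M∣ u) ≤ κ * fromℕ u)
    sup = Supremum.majorant ∣M∣ (δ √T) s (ℕ.≤-trans (s≤s z≤n) (Core.8≤s t)) (ratio≤δx ∣M∣ δ decreasing mertens √T s 1≤√T √T≤2Q²) (suc t)

  farey-asymptotic-suc : fromℚʳ ∣ fromℕ (C (suc t)) - fromℕ (F (suc t)) * G (suc t) ∣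
    ≤ʳ fromℚʳ c *ʳ ∣ suc t ^ʳ (fromℚʳ (+ 11 / 4) +ʳ η (suc t)) +ʳ fromℕʳ (suc t ℕ.^ 3) *ʳ δ √T *ʳ log (suc t) ∣ʳ
  farey-asymptotic-suc ε 0<ε = go sup
    where
    go : (∃[ κ ] 0ℚ ≤ κ × fromℚʳ κ ≤ʳ δ √T × (∀ u → s ℕ.≤ u → u ℕ.≤ suc t → fromℕ (∣M∣ u) ≤ κ * fromℕ u)) →
         ∃[ N ] ∀ n → N ℕ.≤ n → ∣ fromℕ (C (suc t)) - fromℕ (F (suc t)) * G (suc t) ∣ ≤ c * ∣ expSum ((+ 11 / 4 + oOne r) * ℓ n) n + A * seq (δ √T) n * ℓ n ∣ + ε
    go (κ , 0≤κ , κ≤δ , κ-sup) =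
      -- The tolerance 1/(k + 1) for κ ≤ δ(√T) is fixed before the index; this is possible because
      -- every partial sum of log T is at most `H t` ≤ t.
      let (k , scale) = archimedean′ (c * A * fromℕ t) ε 0<ε
          (N , close) = κ≤δ (recip k) (0<recip k)
          -- From N₁ on the partial sums of log T exceed `H₃ t`, and from N₂ on the truncation order
          -- of exp suffices for `power-lower`.
          N₁ = (3 ℕ.+ t) ℕ.* (3 ℕ.+ t)
          N₂ = t ℕ.+ (t ℕ.+ (t ℕ.+ (t ℕ.+ (t ℕ.+ 6))))
      in N ℕ.⊔ (N₁ ℕ.⊔ N₂) , λ n N≤n →
        let N≤n′ = ℕ.m⊔n≤o⇒n≤o N (N₁ ℕ.⊔ N₂) N≤n
        in absorb-error ∣ fromℕ (C (suc t)) - fromℕ (F (suc t)) * G (suc t) ∣ (expSum ((+ 11 / 4 + oOne r) * ℓ n) n) A (seq (δ √T) n) (recip k) κ (ℓ n) (fromℕ t) ε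
             (Core.error≤c t κ 0≤κ κ-sup (ℓ n) n (H₃≤mercator t n (ℕ.m⊔n≤o⇒m≤o N₁ N₂ N≤n′)) (ℕ.m⊔n≤o⇒n≤o N₁ N₂ N≤n′))
             (close n (ℕ.m⊔n≤o⇒m≤o N (N₁ ℕ.⊔ N₂) N≤n)) (scale k ℕ.≤-refl)
             (0≤fromℕ (suc t ℕ.^ 3)) (0≤recip k) (0≤mercator t n) (ℚ.≤-trans (mercator≤H t n) (H≤fromℕ t))

-- `log` computes only on successors, so the proof is carried out for T = t + 1; the instance, being
-- irrelevant, serves only to refute T = 0.
nonZero-elim : (P : (n : ℕ) → .{{ℕ.NonZero n}} → Set) → (∀ t → P (suc t)) → ∀ T .{{_ : ℕ.NonZero T}} → P T
nonZero-elim P h zero    = contradiction refl (ℕ.≢-nonZero⁻¹ 0)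
nonZero-elim P h (suc t) = h t

theorem1p1 : ∃[ c ] 0ʳ <ʳ c ×
    ∃[ η ] η →0 ×
    (∀ (δ : ℝ → ℝ) → Decreasing δ → MertensBound δ →
    ∀ (T : ℕ) .{{_ : ℕ.NonZero T}} →
    fromℚʳ ∣ fromℕ (C T) - fromℕ (F T) * G T ∣
    ≤ʳ c *ʳ ∣ T ^ʳ (fromℚʳ (+ 11 / 4) +ʳ η T)
    +ʳ fromℕʳ (T ℕ.^ 3) *ʳ δ (T ^ʳ fromℚʳ ½) *ʳ log T ∣ʳ)
theorem1p1 = fromℚʳ c , 0<c , η , η→0 , λ δ decreasing mertens → nonZero-elim
  (λ T → fromℚʳ ∣ fromℕ (C T) - fromℕ (F T) * G T ∣
    ≤ʳ fromℚʳ c *ʳ ∣ T ^ʳ (fromℚʳ (+ 11 / 4) +ʳ η T) +ʳ fromℕʳ (T ℕ.^ 3) *ʳ δ (T ^ʳ fromℚʳ ½) *ʳ log T ∣ʳ)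
  (farey-asymptotic-suc δ decreasing mertens)
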